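{- Let $A_n^{(l)}(t,r,q)=\sum_{\pi\in C_l\wr\mathfrak{S}_n}t^{\mathrm{fexc}(\pi)}r^{\mathrm{fix}(\pi)}q^{(\mathrm{maj}-\mathrm{exc})\pi}$ (with $A_0^{(l)}(t,r,q)=1$) and $A_n^{(l)}(t,q)=A_n^{(l)}(t,1,q)$. Then for all $n\ge0$, $$A_{n+1}^{(l)}(t,r,q)=(r+t[l-1]_tq^n)A_n^{(l)}(t,r,q)+t[l]_t\sum_{k=0}^{n-1}{n\brack k}_{q}q^{k}A_k^{(l)}(t,r,q)A_{n-k}^{(l)}(t,q).$$
   Context: Fix $l\ge1$. $C_l\wr\mathfrak{S}_n$ is the set of words $\pi=\pi_1\cdots\pi_n$ with letters $\pi_i=|\pi_i|^{\epsilon_i}$, $\epsilon_i\in\{0,\dots,l-1\}$, such that $|\pi_1|\cdots|\pi_n|$ is a permutation of $[n]$. With the color order $1^{l-1}<\cdots<n^{l-1}<1^{l-2}<\cdots<n^{l-2}<\cdots<1^0<\cdots<n^0$: $\mathrm{maj}(\pi)=\sum\{j\in[n-1]:\pi_j>\pi_{j+1}\}$, $\mathrm{exc}(\pi)=|\{j:\pi_j>j^0\}|$, $\mathrm{fexc}(\pi)=l\,\mathrm{exc}(\pi)+\sum_i\epsilon_i$, $\mathrm{fix}(\pi)=|\{j:\pi_j=j^0\}|$. $[m]_t=1+t+\dots+t^{m-1}$ for $m\ge1$, $[0]_t=0$; $(a;q)_n=\prod_{i=0}^{n-1}(1-aq^i)$ and ${n\brack k}_q=\frac{(q;q)_n}{(q;q)_k(q;q)_{n-k}}$.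 -}

module Defs where

open import Data.Bool using (Bool; true; false; if_then_else_; _∧_; _∨_; not)
open import Data.Nat as ℕ using (ℕ; zero; suc; _+_; _*_; _<ᵇ_; _≡ᵇ_)
open import Data.Integer as ℤ using (ℤ; +_)
open import Data.List using (List; []; _∷_; map; concatMap; upTo; _++_; foldr; length)
open import Data.Product using (_×_; _,_)
open import Relation.Binary.PropositionalEquality using (_≡_)

-- Colored permutations.
-- A letter |π_i|^{ε_i} is the pair (|π_i| , ε_i) with |π_i| ∈ {1..n}, ε_i ∈ {0..l-1}.

Letter : Set
Letter = ℕ × ℕ

letters : ℕ → ℕ → List Letter
letters n l = concatMap (λ v → map (λ c → (suc v , c)) (upTo l)) (upTo n)

wordsOf : List Letter → ℕ → List (List Letter)
wordsOf A zero    = [] ∷ []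
wordsOf A (suc m) = concatMap (λ x → map (x ∷_) (wordsOf A m)) A

memb : ℕ → List ℕ → Bool
memb x []       = false
memb x (y ∷ ys) = (x ≡ᵇ y) ∨ memb x ys

distinct : List ℕ → Bool
distinct []       = true
distinct (x ∷ xs) = not (memb x xs) ∧ distinct xs

absVals : List Letter → List ℕ
absVals = map (λ { (v , c) → v })

filt : {A : Set} → (A → Bool) → List A → List A
filt p []       = []
filt p (x ∷ xs) = if p x then x ∷ filt p xs else filt p xs

-- C_l ≀ S_n : words of length n with letters in [n] × {0..l-1} whose
-- absolute values |π_1|…|π_n| are distinct (hence a permutation of [n]).
colPerms : ℕ → ℕ → List (List Letter)
colPerms l n = filt (λ w → distinct (absVals w)) (wordsOf (letters n l) n)

-- The color order: 1^{l-1}<…<n^{l-1}<1^{l-2}<…<1^0<…<n^0,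
-- i.e. a^e < b^f iff e > f, or e = f and a < b.
_≺_ : Letter → Letter → Bool
(a , e) ≺ (b , f) = (f <ᵇ e) ∨ ((e ≡ᵇ f) ∧ (a <ᵇ b))

_≡L_ : Letter → Letter → Bool
(a , e) ≡L (b , f) = (a ≡ᵇ b) ∧ (e ≡ᵇ f)

b2n : Bool → ℕ
b2n true  = 1
b2n false = 0

majFrom : ℕ → List Letter → ℕ
majFrom j []            = 0
majFrom j (x ∷ [])      = 0
majFrom j (x ∷ y ∷ ws)  = (if y ≺ x then j else 0) + majFrom (suc j) (y ∷ ws)

maj : List Letter → ℕ
maj = majFrom 1

excFrom : ℕ → List Letter → ℕ
excFrom j []       = 0
excFrom j (x ∷ ws) = b2n ((j , 0) ≺ x) + excFrom (suc j) ws

exc : List Letter → ℕ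
exc = excFrom 1

fixFrom : ℕ → List Letter → ℕ
fixFrom j []       = 0
fixFrom j (x ∷ ws) = b2n (x ≡L (j , 0)) + fixFrom (suc j) ws

fix : List Letter → ℕ
fix = fixFrom 1

colorSum : List Letter → ℕ
colorSum = foldr (λ { (v , c) s → c + s }) 0

fexc : ℕ → List Letter → ℕ
fexc l w = l * exc w + colorSum w

-- Laurent polynomials in t, r, q (integer coefficients; exponents of t, r
-- in ℕ, exponent of q in ℤ), represented as formal finite sums of monomials.
-- A monomial (a , i , j , k) stands for a · t^i r^j q^k.

Mono : Set
Mono = ℤ × ℕ × ℕ × ℤ

Poly : Set
Poly = List Mono

0P : Poly
0P = []

1P : Poly
1P = (+ 1 , 0 , 0 , + 0) ∷ []

tP rP : Poly
tP = (+ 1 , 1 , 0 , + 0) ∷ []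
rP = (+ 1 , 0 , 1 , + 0) ∷ []

qPow : ℤ → Poly
qPow k = (+ 1 , 0 , 0 , k) ∷ []

infixl 6 _+P_
infixl 7 _*P_

_+P_ : Poly → Poly → Poly
_+P_ = _++_

mulMono : Mono → Mono → Mono
mulMono (a , i , j , k) (b , i' , j' , k') = (a ℤ.* b , i + i' , j + j' , k ℤ.+ k')

_*P_ : Poly → Poly → Poly
P *P Q = concatMap (λ m → map (mulMono m) Q) P

sumP : List Poly → Poly
sumP = foldr _+P_ 0P

coeff : Poly → ℕ → ℕ → ℤ → ℤ
coeff [] i j k = + 0
coeff ((a , i' , j' , k') ∷ P) i j k =
  (if (i ≡ᵇ i') ∧ (j ≡ᵇ j') ∧ isEq k k' then a else + 0) ℤ.+ coeff P i j k
  where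
  isEq : ℤ → ℤ → Bool
  isEq x y = ℤ.∣ x ℤ.- y ∣ ≡ᵇ 0

infix 4 _≈P_
_≈P_ : Poly → Poly → Set
P ≈P Q = ∀ i j k → coeff P i j k ≡ coeff Q i j k

atR1 : Poly → Poly
atR1 = map (λ { (a , i , j , k) → (a , i , 0 , k) })

tBracket : ℕ → Poly
tBracket m = map (λ i → (+ 1 , i , 0 , + 0)) (upTo m)

qbinom : ℕ → ℕ → Poly
qbinom n       zero    = 1P
qbinom zero    (suc k) = 0P
qbinom (suc n) (suc k) = qbinom n k +P qPow (+ suc k) *P qbinom n (suc k)

weight : ℕ → List Letter → Mono
weight l w = (+ 1 , fexc l w , fix w , (+ maj w) ℤ.- (+ exc w))

A : ℕ → ℕ → Poly
A l zero    = 1P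
A l n@(suc _) = map (weight l) (colPerms l n)

A2 : ℕ → ℕ → Poly
A2 l n = atR1 (A l n)

{-# OPTIONS --safe #-}
-- By MacMahon's Verfahren, q^(maj - exc) / (q;q)_n is the limit for s → ∞ of the
-- sum of q^(b_1 + ⋯ + b_n) over the sequences s > b_1 ≥ ⋯ ≥ b_n ≥ 0 that decrease
-- strictly at the descents, for the order in which excedances come first and
-- the other letters follow in the color order: maj - exc is the major index for
-- this order. A permutation with such a sequence consists of blocks (the level
-- sets of b) in which the letters increase, and it is determined by the block
-- and the type of the letter that takes each value 1, …, n. For given block sizes
-- m the number of permutations is therefore the coefficient of x^m in a product
-- of linear forms, one for each value; apart from fixed points and the two ends of
-- each block, the form of a value depends only on the block of the value.
--
-- In such a coefficient the forms can be expanded in any order. Reading off the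
-- forms along the path that the letters trace through the blocks shows that each
-- form contributes a factor, its value at the solution of a linear system. With
-- F the generating function, G its value at r = 1, T = t^l and y = t [l-1]_t, this
-- gives a relation between s + 1 and s blocks,
--   F'(z) (1 - r z) (1 - z - z (T + y) G(qz)) = F(qz) (1 - T z) (1 - z),
-- which together with its case r = 1 yields
--   F'(z) (1 - r z) = F(qz) (1 - T z + z (T + y) G'(z)).
-- The coefficient of z^(n+1), for s → ∞, is the recurrence.
module Submission where

open import Defs
open import Level using (0ℓ)
open import Algebra.Bundles using (CommutativeRing)
import Algebra.Properties.CommutativeSemigroup as CSG
import Algebra.Properties.Group as GroupProps
import Algebra.Properties.Ring as RingProps
import Algebra.Properties.Semiring.Exp as Exp
import Algebra.Solver.Ring.NaturalCoefficients.Default as Solver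
open import Data.Bool using (Bool; true; false; if_then_else_; _∧_; _∨_; not)
import Data.Bool.Properties as Boolₚ
open import Data.Empty using (⊥-elim)
open import Data.Integer as ℤ using (ℤ; -[1+_]; ∣_∣)
import Data.Integer.Properties as ℤₚ
open import Data.List using (List; []; _∷_; _++_; map; length; reverse; replicate; concatMap; upTo; applyUpTo)
import Data.List.Properties as Listₚ
open import Data.List.Relation.Binary.Permutation.Propositional as Perm using (_↭_)
import Data.List.Relation.Binary.Permutation.Propositional.Properties as Permₚ
open import Data.List.Relation.Binary.Pointwise as PW using (Pointwise; []; _∷_)
open import Data.List.Relation.Unary.All as All using (All; []; _∷_)
import Data.List.Relation.Unary.All.Properties as Allₚ
open import Data.List.Relation.Unary.AllPairs using (AllPairs; []; _∷_)
open import Data.Maybe using (Maybe; just; nothing)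
open import Data.Nat as ℕ using (ℕ; zero; suc; _≤_; _∸_; _<ᵇ_; _≡ᵇ_)
import Data.Nat.Properties as ℕₚ
open import Data.Nat.ListAction using (sum)
open import Data.Nat.Solver using (module +-*-Solver)
open import Data.Product using (Σ-syntax; _,_; _×_; proj₁; proj₂)
open import Data.Unit using (tt)
open import Function using (_∘_; _$_; id)
open import Relation.Binary.Definitions using (tri<; tri≈; tri>)
open import Relation.Binary.PropositionalEquality as ≡ using (_≡_; _≢_)
import Relation.Binary.Reasoning.Setoid as SetoidR
open import Relation.Nullary using (yes; no)

-- Formal power series

-- Why a form contributes a factor: a term of the coefficient that takes the variable of column `a`
-- from the expanded form lowers the exponent of this column by one, while the product still
-- contains the block made for the larger exponent. That block is the block for the smaller exponent
-- times one full form. So the term costs a factor `z q^a` and leaves the same situation with a full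
-- form of column `a` to be expanded. One form thus generates a weighted sum of paths, which stop at
-- a variable set to 1, and the sums for several forms multiply. The obstacle is the irregularity of
-- small blocks: the step from size 0 to 1 or from 1 to 2 does not multiply the block by a full
-- form, and the two products agree only in the coefficient that is extracted. For the last block,
-- the sizes m ≥ 2 form a geometric series of ratio z λ, λ = 1 + (T + y) G(qz). The denominator 1 -
-- z λ is never inverted: identities are cleared of it and of all minus signs, and it is cancelled
-- in the end, as its constant term is 1. The limit s → ∞ is expressed by congruences modulo powers
-- of q.

module Series (R : CommutativeRing 0ℓ 0ℓ) where
  open CommutativeRing R renaming (Carrier to C)
  open SetoidR setoid
  open CSG +-commutativeSemigroup using () renaming (interchange to +-interchange)

  anti : ℕ → (ℕ → ℕ → C) → C
  anti zero    f = f 0 0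
  anti (suc n) f = f 0 (suc n) + anti n (λ i j → f (suc i) j)

  anti-cong : ∀ n {f g} → (∀ i j → i ℕ.+ j ≡ n → f i j ≈ g i j) → anti n f ≈ anti n g
  anti-cong zero    h = h 0 0 ≡.refl
  anti-cong (suc n) h =
    +-cong (h 0 (suc n) ≡.refl) (anti-cong n (λ i j eq → h (suc i) j (≡.cong suc eq)))

  anti-+ : ∀ n {f g} → anti n (λ i j → f i j + g i j) ≈ anti n f + anti n g
  anti-+ zero    = refl
  anti-+ (suc n) = trans (+-congˡ (anti-+ n)) (+-interchange _ _ _ _)

  anti-*ˡ : ∀ n x {f} → anti n (λ i j → x * f i j) ≈ x * anti n f
  anti-*ˡ zero    x = refl
  anti-*ˡ (suc n) x = trans (+-congˡ (anti-*ˡ n x)) (sym (distribˡ _ _ _))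

  anti-*ʳ : ∀ n x {f} → anti n (λ i j → f i j * x) ≈ anti n f * x
  anti-*ʳ n x = trans (anti-cong n (λ _ _ _ → *-comm _ _)) (trans (anti-*ˡ n x) (*-comm _ _))

  anti-0 : ∀ n → anti n (λ _ _ → 0#) ≈ 0#
  anti-0 zero    = refl
  anti-0 (suc n) = trans (+-identityˡ _) (anti-0 n)

  anti-snoc : ∀ n f → anti (suc n) f ≈ anti n (λ i j → f i (suc j)) + f (suc n) 0
  anti-snoc zero    f = refl
  anti-snoc (suc n) f = trans (+-congˡ (anti-snoc n (λ i j → f (suc i) j))) (sym (+-assoc _ _ _))

  anti-swap : ∀ n f → anti n f ≈ anti n (λ i j → f j i)
  anti-swap zero    f = refl
  anti-swap (suc n) f = begin
    f 0 (suc n) + anti n (λ i j → f (suc i) j) ≈⟨ +-comm _ _ ⟩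
    anti n (λ i j → f (suc i) j) + f 0 (suc n) ≈⟨ +-congʳ (anti-swap n (λ i j → f (suc i) j)) ⟩
    anti n (λ i j → f (suc j) i) + f 0 (suc n) ≈⟨ anti-snoc n (λ i j → f j i) ⟨
    anti (suc n) (λ i j → f j i) ∎

  anti-assoc : ∀ n (f : ℕ → ℕ → ℕ → C) →
    anti n (λ i j → anti i (λ a b → f a b j)) ≈ anti n (λ a k → anti k (λ b j → f a b j))
  anti-assoc zero    f = refl
  anti-assoc (suc n) f = begin
    f 0 0 (suc n) + anti n (λ i j → f 0 (suc i) j + anti i (λ a b → f (suc a) b j))
      ≈⟨ +-congˡ (anti-+ n) ⟩
    f 0 0 (suc n) + (anti n (λ i j → f 0 (suc i) j) + anti n (λ i j → anti i (λ a b → f (suc a) b j)))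
      ≈⟨ +-assoc _ _ _ ⟨
    anti (suc n) (f 0) + anti n (λ i j → anti i (λ a b → f (suc a) b j))
      ≈⟨ +-congˡ (anti-assoc n (λ a → f (suc a))) ⟩
    anti (suc n) (f 0) + anti n (λ a k → anti k (f (suc a))) ∎

  Σ< : ℕ → (ℕ → C) → C
  Σ< zero    f = 0#
  Σ< (suc s) f = f 0 + Σ< s (f ∘ suc)

  Σ<-cong : ∀ s {f g} → (∀ a → a ℕ.< s → f a ≈ g a) → Σ< s f ≈ Σ< s g
  Σ<-cong zero    h = refl
  Σ<-cong (suc s) h = +-cong (h 0 (ℕ.s≤s ℕ.z≤n)) (Σ<-cong s (λ a a< → h (suc a) (ℕ.s≤s a<)))

  Σ<-* : ∀ s c {f} → Σ< s (λ a → c * f a) ≈ c * Σ< s f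
  Σ<-* zero    c = sym (zeroʳ c)
  Σ<-* (suc s) c = trans (+-congˡ (Σ<-* s c)) (sym (distribˡ _ _ _))

  Σ<-+ : ∀ s {f g} → Σ< s (λ a → f a + g a) ≈ Σ< s f + Σ< s g
  Σ<-+ zero    = sym (+-identityˡ _)
  Σ<-+ (suc s) = trans (+-congˡ (Σ<-+ s)) (+-interchange _ _ _ _)

  Σ<-*ʳ : ∀ s c {f} → Σ< s (λ a → f a * c) ≈ Σ< s f * c
  Σ<-*ʳ s c = trans (Σ<-cong s (λ _ _ → *-comm _ _)) (trans (Σ<-* s c) (*-comm _ _))

  Σ<-0 : ∀ s {f} → (∀ a → a ℕ.< s → f a ≈ 0#) → Σ< s f ≈ 0#
  Σ<-0 zero    h = refl
  Σ<-0 (suc s) h = trans (+-cong (h 0 (ℕ.s≤s ℕ.z≤n)) (Σ<-0 s (λ a a< → h (suc a) (ℕ.s≤s a<)))) (+-identityˡ _)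

  infix  4 _≋_
  infixl 6 _⊕_
  infixl 7 _⊛_

  _≋_ : (f g : ℕ → C) → Set
  f ≋ g = ∀ n → f n ≈ g n

  _⊕_ _⊛_ : (f g : ℕ → C) → ℕ → C
  (f ⊕ g) n = f n + g n
  (f ⊛ g) n = anti n (λ i j → f i * g j)

  const : C → ℕ → C
  const c zero    = c
  const c (suc _) = 0#

  const-⊛ : ∀ c f n → (const c ⊛ f) n ≈ c * f n
  const-⊛ c f zero    = refl
  const-⊛ c f (suc n) = begin
    c * f (suc n) + anti n (λ i j → 0# * f j) ≈⟨ +-congˡ (anti-cong n (λ _ _ _ → zeroˡ _)) ⟩
    c * f (suc n) + anti n (λ _ _ → 0#)       ≈⟨ +-congˡ (anti-0 n) ⟩
    c * f (suc n) + 0#                        ≈⟨ +-identityʳ _ ⟩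
    c * f (suc n) ∎

  ⊛-comm : ∀ f g → f ⊛ g ≋ g ⊛ f
  ⊛-comm f g n = trans (anti-swap n (λ i j → f i * g j)) (anti-cong n (λ _ _ _ → *-comm _ _))

  ⊛-assoc : ∀ f g h → (f ⊛ g) ⊛ h ≋ f ⊛ (g ⊛ h)
  ⊛-assoc f g h n = begin
    anti n (λ i j → anti i (λ a b → f a * g b) * h j)   ≈⟨ anti-cong n (λ i j _ → anti-*ʳ i (h j)) ⟨
    anti n (λ i j → anti i (λ a b → f a * g b * h j))   ≈⟨ anti-assoc n (λ a b j → f a * g b * h j) ⟩
    anti n (λ a k → anti k (λ b j → f a * g b * h j))
      ≈⟨ anti-cong n (λ a k _ → trans (anti-cong k (λ _ _ _ → *-assoc _ _ _)) (anti-*ˡ k (f a))) ⟩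
    anti n (λ a k → f a * anti k (λ b j → g b * h j)) ∎

  ⊛-identityˡ : ∀ f → const 1# ⊛ f ≋ f
  ⊛-identityˡ f n = trans (const-⊛ 1# f n) (*-identityˡ _)

  ⊛-distribˡ : ∀ f g h → f ⊛ (g ⊕ h) ≋ (f ⊛ g) ⊕ (f ⊛ h)
  ⊛-distribˡ f g h n = trans (anti-cong n (λ _ _ _ → distribˡ _ _ _)) (anti-+ n)

  ring⟦z⟧ : CommutativeRing 0ℓ 0ℓ
  ring⟦z⟧ = record
    { Carrier = ℕ → C ; _≈_ = _≋_ ; _+_ = _⊕_ ; _*_ = _⊛_
    ; -_ = λ f n → - f n ; 0# = λ _ → 0# ; 1# = const 1#
    ; isCommutativeRing = record
      { isRing = record
        { +-isAbelianGroup = record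
          { isGroup = record
            { isMonoid = record
              { isSemigroup = record
                { isMagma = record
                  { isEquivalence = record
                    { refl = λ _ → refl ; sym = λ p n → sym (p n) ; trans = λ p p′ n → trans (p n) (p′ n) }
                  ; ∙-cong = λ p p′ n → +-cong (p n) (p′ n) }
                ; assoc = λ _ _ _ _ → +-assoc _ _ _ }
              ; identity = (λ _ _ → +-identityˡ _) , (λ _ _ → +-identityʳ _) }
            ; inverse = (λ _ _ → -‿inverseˡ _) , (λ _ _ → -‿inverseʳ _)
            ; ⁻¹-cong = λ p n → -‿cong (p n) }
          ; comm = λ _ _ _ → +-comm _ _ }
        ; *-cong = λ p p′ n → anti-cong n (λ i j _ → *-cong (p i) (p′ j))
        ; *-assoc = ⊛-assoc
        ; *-identity = ⊛-identityˡ , (λ f n → trans (⊛-comm f (const 1#) n) (⊛-identityˡ f n))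
        ; distrib = ⊛-distribˡ , (λ f g h n → trans (⊛-comm (g ⊕ h) f n)
            (trans (⊛-distribˡ f g h n) (+-cong (⊛-comm f g n) (⊛-comm f h n)))) }
      ; *-comm = ⊛-comm } }

  z : ℕ → C
  z 1 = 1#
  z _ = 0#

  z⊛-0 : ∀ f → (z ⊛ f) 0 ≈ 0#
  z⊛-0 f = zeroˡ _

  z⊛-suc : ∀ f n → (z ⊛ f) (suc n) ≈ f n
  z⊛-suc f n = begin
    0# * f (suc n) + anti n (λ i j → z (suc i) * f j) ≈⟨ +-cong (zeroˡ _) (anti-cong n (λ { zero _ _ → refl ; (suc _) _ _ → refl })) ⟩
    0# + (const 1# ⊛ f) n                             ≈⟨ +-identityˡ _ ⟩
    (const 1# ⊛ f) n                                  ≈⟨ ⊛-identityˡ f n ⟩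
    f n ∎

  open Exp semiring using (_^_; ^-homo-*)

  scale : C → (ℕ → C) → ℕ → C
  scale q f n = q ^ n * f n

  scale-cong : ∀ q {f g} → f ≋ g → scale q f ≋ scale q g
  scale-cong q p n = *-congˡ (p n)

  scale-⊕ : ∀ q f g → scale q (f ⊕ g) ≋ scale q f ⊕ scale q g
  scale-⊕ q f g n = distribˡ _ _ _

  scale-⊛ : ∀ q f g → scale q (f ⊛ g) ≋ scale q f ⊛ scale q g
  scale-⊛ q f g n = trans (sym (anti-*ˡ n (q ^ n))) (anti-cong n step)
    where
    open CSG *-commutativeSemigroup using (interchange)
    step : ∀ i j → i ℕ.+ j ≡ n → q ^ n * (f i * g j) ≈ q ^ i * f i * (q ^ j * g j)
    step i j ≡.refl = trans (*-congʳ (^-homo-* q i j)) (interchange _ _ _ _)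

  scale-const : ∀ q c → scale q (const c) ≋ const c
  scale-const q c zero    = *-identityˡ c
  scale-const q c (suc n) = zeroʳ _

-- Coefficients of products of linear forms

module Forms (R : CommutativeRing 0ℓ 0ℓ) where
  open CommutativeRing R renaming (Carrier to C)
  open SetoidR setoid
  open CSG +-commutativeSemigroup using () renaming (interchange to +-interchange)
  open CSG *-commutativeSemigroup using () renaming (x∙yz≈y∙xz to x*yz≈y*xz)
  open Solver commutativeSemiring using (solve; _:=_; _:+_; _:*_; con)

  dec : ℕ → (ℕ → C) → C
  dec zero    k = 0#
  dec (suc u) k = k u

  dec-cong : ∀ u {k k′} → (∀ u′ → suc u′ ≡ u → k u′ ≈ k′ u′) → dec u k ≈ dec u k′
  dec-cong zero    h = refl
  dec-cong (suc u) h = h u ≡.refl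

  dec-+ : ∀ u {k k′} → dec u (λ u′ → k u′ + k′ u′) ≈ dec u k + dec u k′
  dec-+ zero    = sym (+-identityˡ _)
  dec-+ (suc u) = refl

  dec-* : ∀ u c {k} → dec u (λ u′ → c * k u′) ≈ c * dec u k
  dec-* zero    c = sym (zeroʳ c)
  dec-* (suc u) c = refl

  -- The sum over the columns a of f a * k (us - e_a), where e_a is the a-th unit
  -- vector and the terms with us - e_a not in ℕⁿ are omitted.
  dsum : (ℕ → C) → List ℕ → (List ℕ → C) → C
  dsum f []       k = 0#
  dsum f (u ∷ us) k = f 0 * dec u (λ u′ → k (u′ ∷ us)) + dsum (f ∘ suc) us (λ us′ → k (u ∷ us′))

  dsum-cong : ∀ us {f g k k′} → (∀ a → f a ≈ g a) →
    (∀ us′ → suc (sum us′) ≡ sum us → k us′ ≈ k′ us′) → dsum f us k ≈ dsum g us k′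
  dsum-cong []       p h = refl
  dsum-cong (u ∷ us) p h = +-cong
    (*-cong (p 0) (dec-cong u (λ u′ eq → h (u′ ∷ us) (≡.cong (ℕ._+ sum us) eq))))
    (dsum-cong us (p ∘ suc) (λ us′ eq → h (u ∷ us′) (≡.trans (≡.sym (ℕₚ.+-suc u _)) (≡.cong (u ℕ.+_) eq))))

  dsum-congʳ : ∀ us {f k k′} → (∀ us′ → k us′ ≈ k′ us′) → dsum f us k ≈ dsum f us k′
  dsum-congʳ us h = dsum-cong us (λ _ → refl) (λ us′ _ → h us′)

  dsum-+ : ∀ us {f k k′} → dsum f us (λ us′ → k us′ + k′ us′) ≈ dsum f us k + dsum f us k′
  dsum-+ []           = sym (+-identityˡ _)
  dsum-+ (u ∷ us) {f} = trans
    (+-cong (trans (*-congˡ (dec-+ u)) (distribˡ _ _ _)) (dsum-+ us)) (+-interchange _ _ _ _)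

  dsum-* : ∀ us c {f k} → dsum f us (λ us′ → c * k us′) ≈ c * dsum f us k
  dsum-* []       c = sym (zeroʳ c)
  dsum-* (u ∷ us) c = trans
    (+-cong (trans (*-congˡ (dec-* u c)) (x*yz≈y*xz _ _ _)) (dsum-* us c)) (sym (distribˡ _ _ _))

  dsum-0 : ∀ us {f} → dsum f us (λ _ → 0#) ≈ 0#
  dsum-0 us = trans (dsum-congʳ us (λ _ → sym (zeroˡ 0#))) (trans (dsum-* us 0#) (zeroˡ _))

  dsum-f+ : ∀ us {f g k} → dsum (λ a → f a + g a) us k ≈ dsum f us k + dsum g us k
  dsum-f+ []       = sym (+-identityˡ _)
  dsum-f+ (u ∷ us) = trans (+-cong (distribʳ _ _ _) (dsum-f+ us)) (+-interchange _ _ _ _)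

  dsum-f* : ∀ us c {f k} → dsum (λ a → c * f a) us k ≈ c * dsum f us k
  dsum-f* []       c = sym (zeroʳ c)
  dsum-f* (u ∷ us) c = trans (+-cong (*-assoc _ _ _) (dsum-f* us c)) (sym (distribˡ _ _ _))

  dsum-dec : ∀ us u {f} (k : ℕ → List ℕ → C) →
    dsum f us (λ us′ → dec u (λ u′ → k u′ us′)) ≈ dec u (λ u′ → dsum f us (k u′))
  dsum-dec us zero    k = dsum-0 us
  dsum-dec us (suc u) k = refl

  dsum-swap : ∀ us {f g k} →
    dsum f us (λ us′ → dsum g us′ k) ≈ dsum g us (λ us′ → dsum f us′ k)
  dsum-swap []                   = refl
  dsum-swap (u ∷ us) {f} {g} {k} = begin
    f 0 * dec u (λ u′ → g 0 * dec u′ (λ u″ → k (u″ ∷ us)) + G (k ∘ (u′ ∷_)))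
      + dsum f′ us (λ us′ → g 0 * dec u (λ u′ → k (u′ ∷ us′)) + dsum g′ us′ (k ∘ (u ∷_)))
      ≈⟨ +-cong (*-congˡ (trans (dec-+ u) (+-congʳ (dec-* u (g 0))))) 
           (trans (dsum-+ us) (+-congʳ (trans (dsum-* us (g 0)) (*-congˡ (dsum-dec us u (λ u′ us′ → k (u′ ∷ us′))))))) ⟩
    f 0 * (g 0 * K + decG) + (g 0 * decF + dsum f′ us (λ us′ → dsum g′ us′ (k ∘ (u ∷_))))
      ≈⟨ +-congˡ (+-congˡ (dsum-swap us)) ⟩
    f 0 * (g 0 * K + decG) + (g 0 * decF + dsum g′ us (λ us′ → dsum f′ us′ (k ∘ (u ∷_))))
      ≈⟨ solve 6 (λ f g K dF dG D → f :* (g :* K :+ dG) :+ (g :* dF :+ D)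
                                 := g :* (f :* K :+ dF) :+ (f :* dG :+ D)) refl (f 0) (g 0) K decF decG _ ⟩
    g 0 * (f 0 * K + decF) + (f 0 * decG + dsum g′ us (λ us′ → dsum f′ us′ (k ∘ (u ∷_))))
      ≈⟨ +-cong (*-congˡ (trans (dec-+ u) (+-congʳ (dec-* u (f 0))))) 
           (trans (dsum-+ us) (+-congʳ (trans (dsum-* us (f 0)) (*-congˡ (dsum-dec us u (λ u′ us′ → k (u′ ∷ us′))))))) ⟨
    g 0 * dec u (λ u′ → f 0 * dec u′ (λ u″ → k (u″ ∷ us)) + F (k ∘ (u′ ∷_)))
      + dsum g′ us (λ us′ → f 0 * dec u (λ u′ → k (u′ ∷ us′)) + dsum f′ us′ (k ∘ (u ∷_))) ∎
    where
    f′ = f ∘ suc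
    g′ = g ∘ suc
    F = dsum f′ us
    G = dsum g′ us
    K = dec u (λ u′ → dec u′ (λ u″ → k (u″ ∷ us)))
    decF = dec u (λ u′ → F (k ∘ (u′ ∷_)))
    decG = dec u (λ u′ → G (k ∘ (u′ ∷_)))

  δ₀ : List ℕ → C
  δ₀ []           = 1#
  δ₀ (zero ∷ us)  = δ₀ us
  δ₀ (suc _ ∷ us) = 0#

  -- A function ℕ → C is a linear form in variables x₀, x₁, …; M us fs is the
  -- coefficient of x^us in the product of the forms fs.
  M : List ℕ → List (ℕ → C) → C
  M us []       = δ₀ us
  M us (f ∷ fs) = dsum f us (λ us′ → M us′ fs)

  -- The same with x₀ set to 1: us collects the exponents of x₁, x₂, ….
  Mo : List ℕ → List (ℕ → C) → C
  Mo us []       = δ₀ us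
  Mo us (f ∷ fs) = f 0 * Mo us fs + dsum (f ∘ suc) us (λ us′ → Mo us′ fs)

  _≈F_ : (f g : ℕ → C) → Set
  f ≈F g = ∀ a → f a ≈ g a

  M-cong : ∀ us {fs gs} → Pointwise _≈F_ fs gs → M us fs ≈ M us gs
  M-cong us []       = refl
  M-cong us (p ∷ ps) = dsum-cong us p (λ us′ _ → M-cong us′ ps)

  Mo-head : ∀ us {f g} fs → f ≈F g → Mo us (f ∷ fs) ≈ Mo us (g ∷ fs)
  Mo-head us fs p = +-cong (*-congʳ (p 0)) (dsum-cong us (p ∘ suc) (λ _ _ → refl))

  Mo-↭ : ∀ {fs gs} → fs ↭ gs → ∀ us → Mo us fs ≈ Mo us gs
  Mo-↭ Perm.refl                              us = refl
  Mo-↭ (Perm.prep f p)                        us = +-cong (*-congˡ (Mo-↭ p us)) (dsum-congʳ us (Mo-↭ p))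
  Mo-↭ (Perm.trans p p′)                      us = trans (Mo-↭ p us) (Mo-↭ p′ us)
  Mo-↭ (Perm.swap {xs = fs} {ys = gs} f g p) us = begin
    f 0 * (g 0 * Mo us fs + dsum g′ us (λ v → Mo v fs)) + dsum f′ us (λ v → g 0 * Mo v fs + dsum g′ v (λ w → Mo w fs))
      ≈⟨ +-congˡ (trans (dsum-+ us) (+-cong (dsum-* us (g 0)) (dsum-swap us))) ⟩
    f 0 * (g 0 * Mo us fs + dsum g′ us (λ v → Mo v fs)) + (g 0 * dsum f′ us (λ v → Mo v fs) + dsum g′ us (λ v → dsum f′ v (λ w → Mo w fs)))
      ≈⟨ solve 6 (λ f g K dF dG D → f :* (g :* K :+ dG) :+ (g :* dF :+ D)
                                 := g :* (f :* K :+ dF) :+ (f :* dG :+ D)) refl (f 0) (g 0) _ _ _ _ ⟩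
    g 0 * (f 0 * Mo us fs + dsum f′ us (λ v → Mo v fs)) + (f 0 * dsum g′ us (λ v → Mo v fs) + dsum g′ us (λ v → dsum f′ v (λ w → Mo w fs)))
      ≈⟨ +-congˡ (trans (dsum-+ us) (+-congʳ (dsum-* us (f 0)))) ⟨
    g 0 * (f 0 * Mo us fs + dsum f′ us (λ v → Mo v fs)) + dsum g′ us (λ v → f 0 * Mo v fs + dsum f′ v (λ w → Mo w fs))
      ≈⟨ +-cong (*-congˡ (+-cong (*-congˡ (Mo-↭ p us)) (dsum-congʳ us (Mo-↭ p))))
                (dsum-congʳ us (λ v → +-cong (*-congˡ (Mo-↭ p v)) (dsum-congʳ v (Mo-↭ p)))) ⟩
    g 0 * (f 0 * Mo us gs + dsum f′ us (λ v → Mo v gs)) + dsum g′ us (λ v → f 0 * Mo v gs + dsum f′ v (λ w → Mo w gs)) ∎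
    where
    f′ = f ∘ suc
    g′ = g ∘ suc

  Mo-lin : ∀ us f c g fs → Mo us ((λ a → f a + c * g a) ∷ fs) ≈ Mo us (f ∷ fs) + c * Mo us (g ∷ fs)
  Mo-lin us f c g fs = begin
    (f 0 + c * g 0) * Mo us fs + dsum (λ a → f (suc a) + c * g (suc a)) us _
      ≈⟨ +-congˡ (trans (dsum-f+ us) (+-congˡ (dsum-f* us c))) ⟩
    (f 0 + c * g 0) * Mo us fs + (dsum (f ∘ suc) us _ + c * dsum (g ∘ suc) us _)
      ≈⟨ solve 6 (λ f c g m a b → (f :+ c :* g) :* m :+ (a :+ c :* b) := f :* m :+ a :+ c :* (g :* m :+ b))
           refl (f 0) c (g 0) _ _ _ ⟩
    Mo us (f ∷ fs) + c * Mo us (g ∷ fs) ∎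

  δ₀-> : ∀ us → 0 ℕ.< sum us → δ₀ us ≈ 0#
  δ₀-> (zero ∷ us)  p = δ₀-> us p
  δ₀-> (suc _ ∷ us) p = refl

  -- Each form lowers the total exponent by at most one.
  Mo-> : ∀ us fs → length fs ℕ.< sum us → Mo us fs ≈ 0#
  Mo-> us []       p = δ₀-> us p
  Mo-> us (f ∷ fs) p = begin
    f 0 * Mo us fs + dsum (f ∘ suc) us (λ us′ → Mo us′ fs)
      ≈⟨ +-cong (*-congˡ (Mo-> us fs (ℕₚ.<-trans (ℕₚ.n<1+n _) p)))
           (dsum-cong us (λ _ → refl) (λ us′ eq → Mo-> us′ fs (ℕ.s≤s⁻¹ (≡.subst (suc (length fs) ℕ.<_) (≡.sym eq) p)))) ⟩
    f 0 * 0# + dsum (f ∘ suc) us (λ _ → 0#) ≈⟨ +-cong (zeroʳ _) (dsum-0 us) ⟩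
    0# + 0#                                 ≈⟨ +-identityˡ 0# ⟩
    0# ∎

  -- With as many forms as the total exponent, every form has to supply a variable: after a constant
  -- term too few forms remain.
  Mo-const-irrelevant : ∀ us fs → length fs ≡ sum us → Mo us fs ≈ M us (map (_∘ suc) fs)
  Mo-const-irrelevant us []       eq = refl
  Mo-const-irrelevant us (f ∷ fs) eq = begin
    f 0 * Mo us fs + dsum (f ∘ suc) us (λ us′ → Mo us′ fs)
      ≈⟨ +-cong (*-congˡ (Mo-> us fs (ℕₚ.≤-reflexive eq)))
           (dsum-cong us (λ _ → refl) (λ us′ eq′ → Mo-const-irrelevant us′ fs (ℕₚ.suc-injective (≡.trans eq (≡.sym eq′))))) ⟩
    f 0 * 0# + M us (map (_∘ suc) (f ∷ fs)) ≈⟨ trans (+-congʳ (zeroʳ _)) (+-identityˡ _) ⟩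
    M us (map (_∘ suc) (f ∷ fs)) ∎

  -- The product is homogeneous of degree `length fs`, so the other exponents determine that of x₀
  -- and setting x₀ = 1 merges no two monomials.
  dehomogenize : ∀ m us fs → m ℕ.+ sum us ≡ length fs → M (m ∷ us) fs ≈ Mo us fs
  dehomogenize zero us []       eq = refl
  dehomogenize m    us (f ∷ fs) eq = +-cong (*-congˡ (first m eq))
    (dsum-cong us (λ _ → refl) (λ us′ eq′ → dehomogenize m us′ fs
      (ℕₚ.suc-injective (≡.trans (≡.sym (ℕₚ.+-suc m _)) (≡.trans (≡.cong (m ℕ.+_) eq′) eq)))))
    where
    first : ∀ m → m ℕ.+ sum us ≡ suc (length fs) → dec m (λ m′ → M (m′ ∷ us) fs) ≈ Mo us fs
    -- With the exponent of x₀ used up, the remaining forms are fewer than the remaining total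
    -- exponent, so the term with x₀ = 1 vanishes too.
    first zero    eq = sym (Mo-> us fs (ℕₚ.≤-reflexive (≡.sym eq)))
    first (suc m) eq = dehomogenize m us fs (ℕₚ.suc-injective eq)

  unit : ℕ → ℕ → C
  unit zero    zero    = 1#
  unit zero    (suc a) = 0#
  unit (suc b) zero    = 0#
  unit (suc b) (suc a) = unit b a

  col : ℕ → List ℕ → ℕ
  col a       []       = 0
  col zero    (u ∷ us) = u
  col (suc a) (u ∷ us) = col a us

  inc : ℕ → List ℕ → List ℕ
  inc a       []       = []
  inc zero    (u ∷ us) = suc u ∷ us
  inc (suc a) (u ∷ us) = u ∷ inc a us

  dsum-f0 : ∀ us {k} → dsum (λ _ → 0#) us k ≈ 0#
  dsum-f0 []       = refl
  dsum-f0 (u ∷ us) = trans (+-cong (zeroˡ _) (dsum-f0 us)) (+-identityˡ _)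

  dsum-unit-cong : ∀ a us {k k′} → (∀ us′ → inc a us′ ≡ us → length us′ ≡ length us → k us′ ≈ k′ us′) →
    dsum (unit a) us k ≈ dsum (unit a) us k′
  dsum-unit-cong a       []       h = refl
  dsum-unit-cong zero    (u ∷ us) h = +-cong
    (*-congˡ (dec-cong u (λ { u′ ≡.refl → h (u′ ∷ us) ≡.refl ≡.refl }))) (trans (dsum-f0 us) (sym (dsum-f0 us)))
  dsum-unit-cong (suc a) (u ∷ us) h = +-cong (trans (zeroˡ _) (sym (zeroˡ _)))
    (dsum-unit-cong a us (λ us′ eq l → h (u ∷ us′) (≡.cong (u ∷_) eq) (≡.cong suc l)))

  dsum-unit-0 : ∀ a us {k} → col a us ≡ 0 → dsum (unit a) us k ≈ 0#
  dsum-unit-0 a       []          eq = refl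
  dsum-unit-0 zero    (zero ∷ us) eq = trans (+-cong (zeroʳ _) (dsum-f0 us)) (+-identityˡ _)
  dsum-unit-0 (suc a) (u ∷ us)    eq = trans (+-cong (zeroˡ _) (dsum-unit-0 a us eq)) (+-identityˡ _)

  col-inc : ∀ a us → col a (inc a us) ≡ 1 → col a us ≡ 0
  col-inc a       []          eq = ≡.refl
  col-inc zero    (zero ∷ us) eq = ≡.refl
  col-inc (suc a) (u ∷ us)    eq = col-inc a us eq

  -- The square of the variable of column `a` does not divide a monomial in which this variable has
  -- exponent 1.
  dsum-unit-1 : ∀ a us {k} → col a us ≡ 1 → dsum (unit a) us (λ us′ → dsum (unit a) us′ k) ≈ 0#
  dsum-unit-1 a us eq = trans
    (dsum-unit-cong a us {k′ = λ _ → 0#} (λ { us′ ≡.refl _ → dsum-unit-0 a us′ (col-inc a us′ eq) })) (dsum-0 us)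

  Mo-unit : ∀ a us fs → Mo us (unit (suc a) ∷ fs) ≈ dsum (unit a) us (λ us′ → Mo us′ fs)
  Mo-unit a us fs = trans (+-congʳ (zeroˡ _)) (+-identityˡ _)

  -- The forms of the values of a block, and blocks whose size grows by one

  module Blocks (T y : C) where
    -- W b c is the form of a value lying in block b: the coefficient at a is the
    -- total weight of the letters of block a (counted from the right) that can
    -- take this value, and c is this weight for a = b.
    W : ℕ → C → ℕ → C
    W zero    c zero    = c
    W zero    c (suc a) = T + y
    W (suc b) c zero    = 1# + y
    W (suc b) c (suc a) = W b c a

    -- In a block without fixed points the least value is not taken by an excedance
    -- of the block, and the greatest value not by a non-excedance of color 0.
    P : ℕ → ℕ → List (ℕ → C)
    P b zero          = []
    P b (suc zero)    = W b y ∷ []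
    P b (suc (suc m)) = W b (T + y) ∷ (replicate m (W b (1# + (T + y))) ++ W b (1# + y) ∷ [])

    blocks : ℕ → List ℕ → List (ℕ → C)
    blocks b []       = []
    blocks b (u ∷ us) = P b u ++ blocks (suc b) us

    W-split : ∀ b c d a → W b (d + c) a ≈ W b d a + c * unit b a
    W-split zero    c d zero    = +-congˡ (sym (*-identityʳ c))
    W-split zero    c d (suc a) = sym (trans (+-congˡ (zeroʳ c)) (+-identityʳ _))
    W-split (suc b) c d zero    = sym (trans (+-congˡ (zeroʳ c)) (+-identityʳ _))
    W-split (suc b) c d (suc a) = W-split b c d a

    W-0 : ∀ b c a → W b c a ≈ W b 0# a + c * unit b a
    W-0 b c a = trans (reflexive′ b a) (W-split b c 0# a)
      where
      reflexive′ : ∀ b a → W b c a ≈ W b (0# + c) a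
      reflexive′ zero    zero    = sym (+-identityˡ c)
      reflexive′ zero    (suc a) = refl
      reflexive′ (suc b) zero    = refl
      reflexive′ (suc b) (suc a) = reflexive′ b a

    Mo-W : ∀ us a c fs → Mo us (W (suc a) c ∷ fs)
                       ≈ Mo us (W (suc a) 0# ∷ fs) + c * dsum (unit a) us (λ us′ → Mo us′ fs)
    Mo-W us a c fs = trans (Mo-head us fs (W-0 (suc a) c))
      (trans (Mo-lin us (W (suc a) 0#) c (unit (suc a)) fs) (+-congˡ (*-congˡ (Mo-unit a us fs))))

    -- The two forms differ by a multiple of the variable of column `a`, which has exponent 0 here.
    Mo-W-irrelevant : ∀ us a c d fs → col a us ≡ 0 → Mo us (W (suc a) c ∷ fs) ≈ Mo us (W (suc a) d ∷ fs)
    Mo-W-irrelevant us a c d fs eq = trans (drop c) (sym (drop d))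
      where
      drop : ∀ c → Mo us (W (suc a) c ∷ fs) ≈ Mo us (W (suc a) 0# ∷ fs)
      drop c = trans (Mo-W us a c fs)
        (trans (+-congˡ (trans (*-congˡ (dsum-unit-0 a us eq)) (zeroʳ c))) (+-identityʳ _))

    -- With x the variable of column `a`, the product (w + c x) (w + d x) is w² + (c + d) w x + c d
    -- x². For exponent 1 the last term drops out, so only c + d enters.
    Mo-WW : ∀ us a c d c′ d′ fs → col a us ≡ 1 → c + d ≈ c′ + d′ →
      Mo us (W (suc a) c ∷ W (suc a) d ∷ fs) ≈ Mo us (W (suc a) c′ ∷ W (suc a) d′ ∷ fs)
    Mo-WW us a c d c′ d′ fs eq sums = trans (expand c d) (trans (+-congˡ (*-congʳ sums)) (sym (expand c′ d′)))
      where
      w = W (suc a) 0#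
      B = dsum (unit a) us (λ us′ → Mo us′ (w ∷ fs))
      expand : ∀ c d → Mo us (W (suc a) c ∷ W (suc a) d ∷ fs) ≈ Mo us (w ∷ w ∷ fs) + (c + d) * B
      expand c d = begin
        Mo us (W (suc a) c ∷ W (suc a) d ∷ fs)
          ≈⟨ Mo-W us a c (W (suc a) d ∷ fs) ⟩
        Mo us (w ∷ W (suc a) d ∷ fs) + c * dsum (unit a) us (λ us′ → Mo us′ (W (suc a) d ∷ fs))
          ≈⟨ +-cong (Mo-↭ {w ∷ W (suc a) d ∷ fs} {W (suc a) d ∷ w ∷ fs} (Perm.swap w (W (suc a) d) Perm.refl) us)
               (*-congˡ (trans (dsum-congʳ us (λ us′ → Mo-W us′ a d fs)) (trans (dsum-+ us)
                 (+-congˡ (trans (dsum-* us d) (*-congˡ (dsum-unit-1 a us eq))))))) ⟩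
        Mo us (W (suc a) d ∷ w ∷ fs) + c * (B + d * 0#)
          ≈⟨ +-congʳ (Mo-W us a d (w ∷ fs)) ⟩
        Mo us (w ∷ w ∷ fs) + d * B + c * (B + d * 0#)
          ≈⟨ solve 4 (λ m d c b → m :+ d :* b :+ c :* (b :+ d :* con 0) := m :+ (c :+ d) :* b) refl _ d c B ⟩
        Mo us (w ∷ w ∷ fs) + (c + d) * B ∎

    -- By the old exponent m of the column. For m = 0 the own variable does not occur in the
    -- monomial. For m = 1 the own coefficients have the same sum on both sides, (T + y) + (1 + y) =
    -- (1 + T + y) + y. From m = 2 on the larger block is the smaller one with one more full form.
    grow-first : ∀ us a fs → Mo us (P (suc a) (suc (col a us)) ++ fs)
                           ≈ Mo us (W (suc a) (1# + (T + y)) ∷ P (suc a) (col a us) ++ fs)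
    grow-first us a fs with col a us in eq
    ... | zero = Mo-W-irrelevant us a _ _ fs eq
    ... | suc zero = Mo-WW us a _ _ _ _ fs eq
      (solve 2 (λ T y → (T :+ y) :+ (con 1 :+ y) := (con 1 :+ (T :+ y)) :+ y) refl T y)
    ... | suc (suc m) = Mo-↭ {W (suc a) (T + y) ∷ full ∷ gs} {full ∷ W (suc a) (T + y) ∷ gs} (Perm.swap _ _ Perm.refl) us
      where
      full = W (suc a) (1# + (T + y))
      gs = (replicate m full ++ W (suc a) (1# + y) ∷ []) ++ fs

    -- Raising the exponent of a column multiplies the product of the forms of
    -- its block by a full form; for exponents 0 and 1, where the block is
    -- irregular, the discrepancy is killed by the coefficient extraction.
    grow : ∀ b a us us₀ a₀ gs → suc a₀ ≡ b ℕ.+ a → col a₀ us₀ ≡ col a us → a ℕ.< length us →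
      Mo us₀ (gs ++ blocks b (inc a us)) ≈ Mo us₀ (W (suc a₀) (1# + (T + y)) ∷ gs ++ blocks b us)
    grow b zero (u ∷ us) us₀ a₀ gs eq ≡.refl _ rewrite ℕₚ.+-identityʳ b with eq
    ... | ≡.refl = begin
      Mo us₀ (gs ++ P b (suc u) ++ blocks (suc b) us) ≈⟨ Mo-↭ (Permₚ.shifts gs (P b (suc u))) us₀ ⟩
      Mo us₀ (P b (suc u) ++ gs ++ blocks (suc b) us) ≈⟨ grow-first us₀ a₀ (gs ++ blocks (suc b) us) ⟩
      Mo us₀ (W b (1# + (T + y)) ∷ P b u ++ gs ++ blocks (suc b) us)
        ≈⟨ Mo-↭ (Perm.prep (W b (1# + (T + y))) (Permₚ.shifts (P b u) gs)) us₀ ⟩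
      Mo us₀ (W b (1# + (T + y)) ∷ gs ++ P b u ++ blocks (suc b) us) ∎
    -- The forms of a block that has been passed move into `gs`. The exponents `us₀` of the whole
    -- coefficient stay fixed, which is why they are kept apart from the suffix `us`.
    grow b (suc a) (u ∷ us) us₀ a₀ gs eq col≡ (ℕ.s≤s a<) = begin
      Mo us₀ (gs ++ P b u ++ blocks (suc b) (inc a us))
        ≡⟨ ≡.cong (Mo us₀) (Listₚ.++-assoc gs (P b u) _) ⟨
      Mo us₀ ((gs ++ P b u) ++ blocks (suc b) (inc a us))
        ≈⟨ grow (suc b) a us us₀ a₀ (gs ++ P b u) (≡.trans eq (ℕₚ.+-suc b a)) col≡ a< ⟩
      Mo us₀ (W (suc a₀) (1# + (T + y)) ∷ (gs ++ P b u) ++ blocks (suc b) us)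
        ≡⟨ ≡.cong (λ fs → Mo us₀ (W (suc a₀) (1# + (T + y)) ∷ fs)) (Listₚ.++-assoc gs (P b u) _) ⟩
      Mo us₀ (W (suc a₀) (1# + (T + y)) ∷ gs ++ P b u ++ blocks (suc b) us) ∎

-- Eliminating the last block

module SeriesIdentities (A : CommutativeRing 0ℓ 0ℓ) where
  open CommutativeRing A
  open SetoidR setoid
  open Solver commutativeSemiring using (solve; _:=_; _:+_; _:*_; con)

  -- `K` sums the last blocks of size at least 2 and satisfies the recursion of a geometric series
  -- of ratio z λ′. Eliminating it leaves D′ (1 - z λ′) = D (1 - z) (1 - T z), written without
  -- subtraction.
  derangement-step : ∀ z T y τ D K D′ → let β = T + y ; λ′ = 1# + β + β * τ in
    D′ ≈ D + z * ((y + β * τ) * D + z * K) →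
    K ≈ (β + β * τ) * ((1# + y + β * τ) * D) + z * (λ′ * K) →
    D′ + (z + T * z) * D ≈ D + T * (z * z) * D + z * (λ′ * D′)
  derangement-step z T y τ D K D′ d k = let β = T + y ; λ′ = 1# + β + β * τ in begin
    D′ + (z + T * z) * D ≈⟨ +-congʳ (trans d (+-congˡ (*-congˡ (+-congˡ (*-congˡ k))))) ⟩
    D + z * ((y + β * τ) * D + z * ((β + β * τ) * ((1# + y + β * τ) * D) + z * (λ′ * K))) + (z + T * z) * D
      ≈⟨ solve 6 (λ z T y τ D K → let β = T :+ y ; L = con 1 :+ β :+ β :* τ in
           D :+ z :* ((y :+ β :* τ) :* D :+ z :* ((β :+ β :* τ) :* ((con 1 :+ y :+ β :* τ) :* D) :+ z :* (L :* K))) :+ (z :+ T :* z) :* D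
           := D :+ T :* (z :* z) :* D :+ z :* (L :* (D :+ z :* ((y :+ β :* τ) :* D :+ z :* K))))
           refl z T y τ D K ⟩
    D + T * (z * z) * D + z * (λ′ * (D + z * ((y + β * τ) * D + z * K))) ≈⟨ +-congˡ (*-congˡ (*-congˡ d)) ⟨
    D + T * (z * z) * D + z * (λ′ * D′) ∎

  -- The hypothesis on τ′ says 1 + τ′ = (1 + V) (1 + τ). Eliminating `V` leaves (1 + τ′) (1 - z λ′)
  -- = (1 + τ) (1 - T z).
  σ-step : ∀ z T y τ V τ′ → let β = T + y ; λ′ = 1# + β + β * τ in
    V ≈ z * (1# + y + ((1# + β) * V + β * ((1# + V) * τ))) →
    τ′ ≈ V + (1# + V) * τ →
    1# + τ′ + z * (T * (1# + τ)) ≈ 1# + τ + z * (λ′ * (1# + τ′))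
  σ-step z T y τ V τ′ v t = let β = T + y ; λ′ = 1# + β + β * τ ; V′ = z * (1# + y + ((1# + β) * V + β * ((1# + V) * τ))) in begin
    1# + τ′ + z * (T * (1# + τ)) ≈⟨ +-congʳ (+-congˡ (trans t (trans (lemma₁ V τ) (+-congˡ (*-congʳ v))))) ⟩
    1# + (τ + V′ * (1# + τ)) + z * (T * (1# + τ))
      ≈⟨ solve 5 (λ z T y τ V → let β = T :+ y ; L = con 1 :+ β :+ β :* τ in
           con 1 :+ (τ :+ z :* (con 1 :+ y :+ ((con 1 :+ β) :* V :+ β :* ((con 1 :+ V) :* τ))) :* (con 1 :+ τ)) :+ z :* (T :* (con 1 :+ τ))
           := con 1 :+ τ :+ z :* (L :* (con 1 :+ (V :+ (con 1 :+ V) :* τ)))) refl z T y τ V ⟩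
    1# + τ + z * (λ′ * (1# + (V + (1# + V) * τ))) ≈⟨ +-congˡ (*-congˡ (*-congˡ (+-congˡ t))) ⟨
    1# + τ + z * (λ′ * (1# + τ′)) ∎
    where
    lemma₁ : ∀ V τ → V + (1# + V) * τ ≈ τ + V * (1# + τ)
    lemma₁ = solve 2 (λ V τ → V :+ (con 1 :+ V) :* τ := τ :+ V :* (con 1 :+ τ)) refl

  module Cancel (+-cancelʳ : ∀ {x y} j → x + j ≈ y + j → x ≈ y) where
    -- The claim D′ = D (1 - T z + z β s′) holds after multiplication by 1 - z λ′, because z λ′ = z
    -- + z β (1 + τ); `unique` cancels this factor. The summand z β D (1 + τ) is added on both sides
    -- to complete the terms to which `s` and `d` apply.
    derangement-closed : ∀ z T β τ D D′ s′ → let λ′ = 1# + β + β * τ in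
      (∀ {x y} → x + z * (λ′ * y) ≈ y + z * (λ′ * x) → x ≈ y) →
      D′ + (z + T * z) * D ≈ D + T * (z * z) * D + z * (λ′ * D′) →
      s′ + z * (T * (1# + τ)) ≈ 1# + τ + z * (λ′ * s′) →
      D′ + z * (T * D) ≈ D + z * (β * (s′ * D))
    derangement-closed z T β τ D D′ s′ unique d s = let λ′ = 1# + β + β * τ in
      unique (+-cancelʳ (z * (β * (D * (1# + τ)))) (begin
        D′ + z * (T * D) + z * (λ′ * (D + z * (β * (s′ * D)))) + z * (β * (D * (1# + τ)))
          ≈⟨ solve 7 (λ z T b t D D′ s → let L = con 1 :+ b :+ b :* t in
               D′ :+ z :* (T :* D) :+ z :* (L :* (D :+ z :* (b :* (s :* D)))) :+ z :* (b :* (D :* (con 1 :+ t)))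
               := D′ :+ z :* (T :* D) :+ z :* (L :* D) :+ z :* (b :* (D :* (con 1 :+ t :+ z :* (L :* s)))))
               refl z T β τ D D′ s′ ⟩
        D′ + z * (T * D) + z * (λ′ * D) + z * (β * (D * (1# + τ + z * (λ′ * s′))))
          ≈⟨ +-congˡ (*-congˡ (*-congˡ (*-congˡ s))) ⟨
        D′ + z * (T * D) + z * (λ′ * D) + z * (β * (D * (s′ + z * (T * (1# + τ)))))
          ≈⟨ solve 7 (λ z T b t D D′ s → let L = con 1 :+ b :+ b :* t in
               D′ :+ z :* (T :* D) :+ z :* (L :* D) :+ z :* (b :* (D :* (s :+ z :* (T :* (con 1 :+ t)))))
               := (D′ :+ (z :+ T :* z) :* D) :+ (z :* ((b :+ b :* t) :* D) :+ z :* (b :* (D :* (s :+ z :* (T :* (con 1 :+ t)))))))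
               refl z T β τ D D′ s′ ⟩
        (D′ + (z + T * z) * D) + (z * ((β + β * τ) * D) + z * (β * (D * (s′ + z * (T * (1# + τ))))))
          ≈⟨ +-congʳ d ⟩
        (D + T * (z * z) * D + z * (λ′ * D′)) + (z * ((β + β * τ) * D) + z * (β * (D * (s′ + z * (T * (1# + τ))))))
          ≈⟨ solve 7 (λ z T b t D D′ s → let L = con 1 :+ b :+ b :* t in
               (D :+ T :* (z :* z) :* D :+ z :* (L :* D′)) :+ (z :* ((b :+ b :* t) :* D) :+ z :* (b :* (D :* (s :+ z :* (T :* (con 1 :+ t))))))
               := D :+ z :* (b :* (s :* D)) :+ z :* (L :* (D′ :+ z :* (T :* D))) :+ z :* (b :* (D :* (con 1 :+ t))))
               refl z T β τ D D′ s′ ⟩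
        D + z * (β * (s′ * D)) + z * (λ′ * (D′ + z * (T * D))) + z * (β * (D * (1# + τ))) ∎))

    fixed-points : ∀ z T β r D D′ s′ H H′ →
      D′ + z * (T * D) ≈ D + z * (β * (s′ * D)) → H′ ≈ H + r * z * H′ →
      H′ * D′ + z * (T * (H * D)) ≈ H * D + r * (z * (H′ * D′)) + z * (β * (s′ * (H * D)))
    fixed-points z T β r D D′ s′ H H′ d h = begin
      H′ * D′ + z * (T * (H * D)) ≈⟨ +-congʳ (*-congʳ h) ⟩
      (H + r * z * H′) * D′ + z * (T * (H * D))
        ≈⟨ solve 7 (λ z T r D D′ H H′ → (H :+ r :* z :* H′) :* D′ :+ z :* (T :* (H :* D))
             := H :* (D′ :+ z :* (T :* D)) :+ r :* (z :* (H′ :* D′))) refl z T r D D′ H H′ ⟩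
      H * (D′ + z * (T * D)) + r * (z * (H′ * D′)) ≈⟨ +-congʳ (*-congˡ d) ⟩
      H * (D + z * (β * (s′ * D))) + r * (z * (H′ * D′))
        ≈⟨ solve 8 (λ z b r D D′ s H H′ → H :* (D :+ z :* (b :* (s :* D))) :+ r :* (z :* (H′ :* D′))
             := H :* D :+ r :* (z :* (H′ :* D′)) :+ z :* (b :* (s :* (H :* D)))) refl z β r D D′ s′ H H′ ⟩
      H * D + r * (z * (H′ * D′)) + z * (β * (s′ * (H * D))) ∎

    -- Both H′ D′ and s′ solve X (1 - z λ′) = (1 + τ) (1 - T z): for r = 1 the geometric series 1 /
    -- (1 - z) of the fixed points cancels the factor 1 - z in the relation for D′. The auxiliary
    -- `w` is (1 + τ) / (1 - z).
    unit-fixed-points : ∀ z T β τ D D′ s′ H H′ → let λ′ = 1# + β + β * τ in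
      (∀ {x y} → x + z * (λ′ * y) ≈ y + z * (λ′ * x) → x ≈ y) →
      D′ + (z + T * z) * D ≈ D + T * (z * z) * D + z * (λ′ * D′) →
      s′ + z * (T * (1# + τ)) ≈ 1# + τ + z * (λ′ * s′) →
      H′ ≈ H + z * H′ → H * D ≈ 1# + τ → H′ * D′ ≈ s′
    unit-fixed-points z T β τ D D′ s′ H H′ unique d s h ih = let λ′ = 1# + β + β * τ in
      unique (+-cancelʳ (z * (T * (1# + τ))) (begin
        H′ * D′ + z * (λ′ * s′) + z * (T * (1# + τ))
          ≈⟨ solve 3 (λ a b c → a :+ b :+ c := a :+ c :+ b) refl _ _ _ ⟩
        H′ * D′ + z * (T * (1# + τ)) + z * (λ′ * s′) ≈⟨ +-congʳ closed ⟩
        1# + τ + z * (λ′ * (H′ * D′)) + z * (λ′ * s′)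
          ≈⟨ solve 3 (λ a b c → a :+ b :+ c := a :+ c :+ b) refl _ _ _ ⟩
        1# + τ + z * (λ′ * s′) + z * (λ′ * (H′ * D′)) ≈⟨ +-congʳ s ⟨
        s′ + z * (T * (1# + τ)) + z * (λ′ * (H′ * D′))
          ≈⟨ solve 3 (λ a b c → a :+ b :+ c := a :+ c :+ b) refl _ _ _ ⟩
        s′ + z * (λ′ * (H′ * D′)) + z * (T * (1# + τ)) ∎))
      where
      w = H′ * D
      w-eq : w ≈ 1# + τ + z * w
      w-eq = begin
        H′ * D               ≈⟨ *-congʳ h ⟩
        (H + z * H′) * D     ≈⟨ solve 4 (λ H z H′ D → (H :+ z :* H′) :* D := H :* D :+ z :* (H′ :* D)) refl H z H′ D ⟩
        H * D + z * (H′ * D) ≈⟨ +-congʳ ih ⟩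
        1# + τ + z * w ∎
      closed : H′ * D′ + z * (T * (1# + τ)) ≈ 1# + τ + z * ((1# + β + β * τ) * (H′ * D′))
      closed = let λ′ = 1# + β + β * τ in +-cancelʳ (z * w + T * (z * z) * w) (begin
        H′ * D′ + z * (T * (1# + τ)) + (z * w + T * (z * z) * w)
          ≈⟨ solve 5 (λ x z T t w → x :+ z :* (T :* (con 1 :+ t)) :+ (z :* w :+ T :* (z :* z) :* w)
               := x :+ (z :* w :+ T :* z :* (con 1 :+ t :+ z :* w))) refl (H′ * D′) z T τ w ⟩
        H′ * D′ + (z * w + T * z * (1# + τ + z * w)) ≈⟨ +-congˡ (+-congˡ (*-congˡ w-eq)) ⟨
        H′ * D′ + (z * w + T * z * w)
          ≈⟨ solve 5 (λ z T D D′ H′ → H′ :* D′ :+ (z :* (H′ :* D) :+ T :* z :* (H′ :* D)) := H′ :* (D′ :+ (z :+ T :* z) :* D)) refl z T D D′ H′ ⟩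
        H′ * (D′ + (z + T * z) * D) ≈⟨ *-congˡ d ⟩
        H′ * (D + T * (z * z) * D + z * (λ′ * D′))
          ≈⟨ solve 6 (λ z T L D D′ H′ → H′ :* (D :+ T :* (z :* z) :* D :+ z :* (L :* D′))
               := H′ :* D :+ (T :* (z :* z) :* (H′ :* D) :+ z :* (L :* (H′ :* D′)))) refl z T λ′ D D′ H′ ⟩
        w + (T * (z * z) * w + z * (λ′ * (H′ * D′))) ≈⟨ +-congʳ w-eq ⟩
        1# + τ + z * w + (T * (z * z) * w + z * (λ′ * (H′ * D′)))
          ≈⟨ solve 4 (λ a b c d → a :+ b :+ (c :+ d) := a :+ d :+ (b :+ c)) refl (1# + τ) (z * w) (T * (z * z) * w) _ ⟩
        1# + τ + z * (λ′ * (H′ * D′)) + (z * w + T * (z * z) * w) ∎)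

-- One factor for each form, and the relation between s + 1 and s blocks

module Path (R : CommutativeRing 0ℓ 0ℓ) (q T y : CommutativeRing.Carrier R) where
  open CommutativeRing R renaming (Carrier to C)
  open Series R
  open Forms R
  open Blocks T y
  open SetoidR setoid
  open CSG *-commutativeSemigroup using () renaming (x∙yz≈y∙xz to x*yz≈y*xz)
  open Exp semiring using (_^_)
  open Solver commutativeSemiring using (solve; _:=_; _:*_)
  module Z = CommutativeRing ring⟦z⟧

  Σ<-anti : ∀ s n {f : ℕ → ℕ → ℕ → C} →
    anti n (λ i j → Σ< s (λ a → f a i j)) ≈ Σ< s (λ a → anti n (f a))
  Σ<-anti zero    n = anti-0 n
  Σ<-anti (suc s) n = trans (anti-+ n) (+-congˡ (Σ<-anti s n))

  dsum-Σ : ∀ us {f} k → dsum f us k ≈ Σ< (length us) (λ a → f a * dsum (unit a) us k)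
  dsum-Σ []       k = refl
  dsum-Σ (u ∷ us) k = +-cong
    (*-congˡ (sym (trans (+-cong (*-identityˡ _) (dsum-f0 us)) (+-identityʳ _))))
    (trans (dsum-Σ us (λ us′ → k (u ∷ us′)))
      (Σ<-cong (length us) (λ a _ → *-congˡ (sym (trans (+-congʳ (zeroˡ _)) (+-identityˡ _))))))

  -- The series Σ z^m a_m for a sequence of series a_m.
  Γ : (ℕ → ℕ → C) → ℕ → C
  Γ a n = anti n a

  Γ-step : ∀ a → Γ a ≋ a 0 ⊕ z ⊛ Γ (a ∘ suc)
  Γ-step a zero    = sym (trans (+-congˡ (z⊛-0 (Γ (a ∘ suc)))) (+-identityʳ _))
  Γ-step a (suc n) = +-congˡ (sym (z⊛-suc (Γ (a ∘ suc)) n))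

  Γ-⊛ : ∀ x a → Γ (λ m → x ⊛ a m) ≋ x ⊛ Γ a
  Γ-⊛ x a n = begin
    anti n (λ m k → anti k (λ i j → x i * a m j))
      ≈⟨ anti-assoc n (λ m i j → x i * a m j) ⟨
    anti n (λ e j → anti e (λ m i → x i * a m j))
      ≈⟨ anti-cong n (λ e j _ → anti-swap e (λ m i → x i * a m j)) ⟩
    anti n (λ e j → anti e (λ i m → x i * a m j))
      ≈⟨ anti-assoc n (λ i m j → x i * a m j) ⟩
    anti n (λ i k → anti k (λ m j → x i * a m j))
      ≈⟨ anti-cong n (λ i k _ → anti-*ˡ k (x i)) ⟩
    anti n (λ i k → x i * anti k (λ m j → a m j)) ∎

  Γ-cong : ∀ {a b} → (∀ m → a m ≋ b m) → Γ a ≋ Γ b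
  Γ-cong p n = anti-cong n (λ i j _ → p i j)

  -- The sum over us ∈ ℕˢ of g us x₀^u₀ x₁^u₁ ⋯, specialized to x_i = z q^i.
  𝒮 : ℕ → (List ℕ → C) → ℕ → C
  𝒮 zero    g = const (g [])
  𝒮 (suc s) g = Γ (λ m → scale q (𝒮 s (λ us → g (m ∷ us))))

  𝒮-cong : ∀ s {g h} → (∀ us → length us ≡ s → g us ≈ h us) → 𝒮 s g ≋ 𝒮 s h
  𝒮-cong zero    p zero    = p [] ≡.refl
  𝒮-cong zero    p (suc n) = refl
  𝒮-cong (suc s) p n = anti-cong n (λ m k _ → *-congˡ (𝒮-cong s (λ us l → p (m ∷ us) (≡.cong suc l)) k))

  𝒮-0 : ∀ s n → 𝒮 s (λ _ → 0#) n ≈ 0#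
  𝒮-0 zero    zero    = refl
  𝒮-0 zero    (suc n) = refl
  𝒮-0 (suc s) n = trans (anti-cong n (λ m k _ → trans (*-congˡ (𝒮-0 s k)) (zeroʳ _))) (anti-0 n)

  𝒮-+ : ∀ s {g h} n → 𝒮 s (λ us → g us + h us) n ≈ 𝒮 s g n + 𝒮 s h n
  𝒮-+ zero    zero    = refl
  𝒮-+ zero    (suc n) = sym (+-identityˡ _)
  𝒮-+ (suc s) n = trans (anti-cong n (λ m k _ → trans (*-congˡ (𝒮-+ s k)) (distribˡ _ _ _))) (anti-+ n)

  𝒮-* : ∀ s c {g} n → 𝒮 s (λ us → c * g us) n ≈ c * 𝒮 s g n
  𝒮-* zero    c zero    = refl
  𝒮-* zero    c (suc n) = sym (zeroʳ c)
  𝒮-* (suc s) c n = trans (anti-cong n (λ m k _ → trans (*-congˡ (𝒮-* s c k)) (x*yz≈y*xz _ _ _))) (anti-*ˡ n c)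

  𝒮-Σ : ∀ s s′ (c : ℕ → C) (h : ℕ → List ℕ → C) n →
    𝒮 s (λ us → Σ< s′ (λ a → c a * h a us)) n ≈ Σ< s′ (λ a → c a * 𝒮 s (h a) n)
  𝒮-Σ s zero     c h n = 𝒮-0 s n
  𝒮-Σ s (suc s′) c h n = trans (𝒮-+ s n) (+-cong (𝒮-* s (c 0) n) (𝒮-Σ s s′ (c ∘ suc) (h ∘ suc) n))

  𝒮-unit-0 : ∀ s a g → 𝒮 s (λ us → dsum (unit a) us g) 0 ≈ 0#
  𝒮-unit-0 zero    a       g = refl
  𝒮-unit-0 (suc s) zero    g = trans (*-congˡ (trans
    (𝒮-cong s (λ us _ → trans (+-cong (zeroʳ _) (dsum-f0 us)) (+-identityˡ _)) 0) (𝒮-0 s 0))) (zeroʳ _)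
  𝒮-unit-0 (suc s) (suc a) g = trans (*-congˡ (trans
    (𝒮-cong s (λ us _ → trans (+-congʳ (zeroˡ _)) (+-identityˡ _)) 0) (𝒮-unit-0 s a (λ us → g (0 ∷ us))))) (zeroʳ _)

  -- The terms with exponent 0 in column `a` vanish, and the others are the terms of `g` multiplied
  -- by x_a = z q^a.
  𝒮-unit : ∀ s a g n → a ℕ.< s → 𝒮 s (λ us → dsum (unit a) us g) (suc n) ≈ q ^ a * 𝒮 s g n
  𝒮-unit (suc s) zero g n _ = begin
    q ^ suc n * 𝒮 s (λ us → 1# * 0# + dsum (λ _ → 0#) us _) (suc n)
      + anti n (λ m k → q ^ k * 𝒮 s (λ us → 1# * g (m ∷ us) + dsum (λ _ → 0#) us _) k)
      ≈⟨ +-cong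
           (trans (*-congˡ (trans (𝒮-cong s (λ us _ → trans (+-cong (zeroʳ _) (dsum-f0 us)) (+-identityˡ _)) (suc n)) (𝒮-0 s (suc n)))) (zeroʳ _))
           (anti-cong n (λ m k _ → *-congˡ (𝒮-cong s (λ us _ → trans (+-cong (*-identityˡ _) (dsum-f0 us)) (+-identityʳ _)) k))) ⟩
    0# + 𝒮 (suc s) g n ≈⟨ trans (+-identityˡ _) (sym (*-identityˡ _)) ⟩
    1# * 𝒮 (suc s) g n ∎
  𝒮-unit (suc s) (suc a) g n (ℕ.s≤s a<) = begin
    anti (suc n) (λ m k → q ^ k * 𝒮 s (λ us → 0# * dec m (λ m′ → g (m′ ∷ us)) + dsum (unit a) us (λ us′ → g (m ∷ us′))) k)
      ≈⟨ anti-cong (suc n) (λ m k _ → *-congˡ {q ^ k} (𝒮-cong s {h = λ us → dsum (unit a) us (λ us′ → g (m ∷ us′))} (λ us _ → trans (+-congʳ (zeroˡ (dec m (λ m′ → g (m′ ∷ us))))) (+-identityˡ _)) k)) ⟩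
    anti (suc n) (λ m k → q ^ k * 𝒮 s (λ us → dsum (unit a) us (λ us′ → g (m ∷ us′))) k)
      ≈⟨ anti-snoc n (λ m k → q ^ k * 𝒮 s (λ us → dsum (unit a) us (λ us′ → g (m ∷ us′))) k) ⟩
    anti n (λ m k → q ^ suc k * 𝒮 s (λ us → dsum (unit a) us (λ us′ → g (m ∷ us′))) (suc k))
      + 1# * 𝒮 s (λ us → dsum (unit a) us (λ us′ → g (suc n ∷ us′))) 0
      ≈⟨ +-cong (anti-cong n (λ m k _ → trans (*-congˡ (𝒮-unit s a (λ us → g (m ∷ us)) k a<))
                  (solve 4 (λ q k a s → (q :* k) :* (a :* s) := (q :* a) :* (k :* s)) refl q (q ^ k) (q ^ a) _)))
                (trans (*-congˡ (𝒮-unit-0 s a (λ us → g (suc n ∷ us)))) (zeroʳ _)) ⟩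
    anti n (λ m k → q ^ suc a * (q ^ k * 𝒮 s (λ us → g (m ∷ us)) k)) + 0#
      ≈⟨ trans (+-identityʳ _) (anti-*ˡ n (q ^ suc a)) ⟩
    q ^ suc a * 𝒮 (suc s) g n ∎

  full : ℕ → ℕ → C
  full b = W b (1# + (T + y))

  -- The variable x₀ = 1 stands for a block yet to be added and `gs` for the forms of its values;
  -- the s complete blocks are counted from 1.
  J : ℕ → List (ℕ → C) → ℕ → C
  J s gs = 𝒮 s (λ us → Mo us (gs ++ blocks 1 us))

  private
    column : ℕ → List (ℕ → C) → List ℕ → C
    column a gs us = dsum (unit a) us (λ us′ → Mo us′ (gs ++ blocks 1 us))

    𝒮-column : ∀ s a gs → a ℕ.< s →
      𝒮 s (column a gs) ≋ 𝒮 s (λ us → dsum (unit a) us (λ us′ → Mo us′ (full (suc a) ∷ gs ++ blocks 1 us′)))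
    𝒮-column s a gs a< = 𝒮-cong s (λ { us ≡.refl → dsum-unit-cong a us (λ { us′ ≡.refl l →
      grow 1 a us′ us′ a gs ≡.refl ≡.refl (≡.subst (a ℕ.<_) (≡.sym l) a<) }) })

    J-expand : ∀ s g gs n → J s (g ∷ gs) n ≈ g 0 * J s gs n + Σ< s (λ a → g (suc a) * 𝒮 s (column a gs) n)
    J-expand s g gs n = begin
      𝒮 s (λ us → g 0 * Mo us (gs ++ blocks 1 us) + dsum (g ∘ suc) us (λ us′ → Mo us′ (gs ++ blocks 1 us))) n
        ≈⟨ 𝒮-+ s n ⟩
      𝒮 s (λ us → g 0 * Mo us (gs ++ blocks 1 us)) n + 𝒮 s (λ us → dsum (g ∘ suc) us (λ us′ → Mo us′ (gs ++ blocks 1 us))) n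
        ≈⟨ +-cong (𝒮-* s (g 0) n) (trans (𝒮-cong s (λ { us ≡.refl → dsum-Σ us (λ us′ → Mo us′ (gs ++ blocks 1 us)) }) n) (𝒮-Σ s s (g ∘ suc) (λ a → column a gs) n)) ⟩
      g 0 * J s gs n + Σ< s (λ a → g (suc a) * 𝒮 s (column a gs) n) ∎

  J-0 : ∀ s g gs → J s (g ∷ gs) 0 ≈ g 0 * J s gs 0
  J-0 s g gs = begin
    J s (g ∷ gs) 0 ≈⟨ J-expand s g gs 0 ⟩
    g 0 * J s gs 0 + Σ< s (λ a → g (suc a) * 𝒮 s (column a gs) 0)
      ≈⟨ +-congˡ (Σ<-cong s (λ a a< → trans (*-congˡ (trans (𝒮-column s a gs a< 0) (𝒮-unit-0 s a _))) (trans (zeroʳ _) (sym (zeroˡ _))))) ⟩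
    g 0 * J s gs 0 + Σ< s (λ a → 0# * 0#) ≈⟨ +-congˡ (trans (Σ<-* s 0#) (zeroˡ _)) ⟩
    g 0 * J s gs 0 + 0# ≈⟨ +-identityʳ _ ⟩
    g 0 * J s gs 0 ∎

  -- Either `g` supplies x₀ = 1, or it supplies column `a`. The latter costs z q^a, and by `grow` it
  -- leaves the blocks of the lowered exponents and one full form of that column.
  J-suc : ∀ s g gs n → J s (g ∷ gs) (suc n)
    ≈ g 0 * J s gs (suc n) + Σ< s (λ a → g (suc a) * (q ^ a * J s (full (suc a) ∷ gs) n))
  J-suc s g gs n = trans (J-expand s g gs (suc n))
    (+-congˡ (Σ<-cong s (λ a a< → *-congˡ (trans (𝒮-column s a gs a< (suc n)) (𝒮-unit s a _ n a<)))))

  -- The solution ω of the linear system ω_a = (1 + y) + z Σ_b W a _ b q^b ω_b, by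
  -- coefficients; ev s g is the value of the form g at x₀ = 1, x_(a+1) = z q^a ω_a.
  ω : ℕ → ℕ → ℕ → C
  ω s a zero    = 1# + y
  ω s a (suc n) = Σ< s (λ b → full a b * (q ^ b * ω s b n))

  ev : ℕ → (ℕ → C) → ℕ → C
  ev s g zero    = g 0
  ev s g (suc n) = Σ< s (λ a → g (suc a) * (q ^ a * ω s a n))

  ev-full : ∀ s a → ω s a ≋ ev s (full (suc a))
  ev-full s a zero    = refl
  ev-full s a (suc n) = refl

  private
    Σ-⊛ : ∀ s n (c : ℕ → C) (d : ℕ → ℕ → C) x → anti n (λ i j → Σ< s (λ a → c a * (q ^ a * d a i)) * x j)
        ≈ Σ< s (λ a → c a * (q ^ a * (d a ⊛ x) n))
    Σ-⊛ s n c d x = begin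
      anti n (λ i j → Σ< s (λ a → c a * (q ^ a * d a i)) * x j)
        ≈⟨ anti-cong n (λ i j _ → trans (*-comm _ _) (trans (sym (Σ<-* s (x j)))
             (Σ<-cong s (λ a _ → solve 4 (λ x c p d → x :* (c :* (p :* d)) := (c :* p) :* (d :* x)) refl (x j) (c a) (q ^ a) (d a i))))) ⟩
      anti n (λ i j → Σ< s (λ a → c a * q ^ a * (d a i * x j)))
        ≈⟨ Σ<-anti s n ⟩
      Σ< s (λ a → anti n (λ i j → c a * q ^ a * (d a i * x j)))
        ≈⟨ Σ<-cong s (λ a _ → trans (anti-*ˡ n _) (*-assoc _ _ _)) ⟩
      Σ< s (λ a → c a * (q ^ a * (d a ⊛ x) n)) ∎

  -- Both sides satisfy the recursion `J-suc`. The induction is on the degree in z, for all forms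
  -- `g` at once, since a full form takes the place of `g` in the lower degree.
  J-ev : ∀ s g gs → J s (g ∷ gs) ≋ ev s g ⊛ J s gs
  J-ev s g gs zero    = J-0 s g gs
  J-ev s g gs (suc n) = trans (J-suc s g gs n) (+-congˡ (begin
    Σ< s (λ a → g (suc a) * (q ^ a * J s (full (suc a) ∷ gs) n))
      ≈⟨ Σ<-cong s (λ a _ → *-congˡ (*-congˡ (trans (J-ev s (full (suc a)) gs n)
           (anti-cong n (λ i j _ → *-congʳ (sym (ev-full s a i))))))) ⟩
    Σ< s (λ a → g (suc a) * (q ^ a * (ω s a ⊛ J s gs) n))
      ≈⟨ Σ-⊛ s n (g ∘ suc) (ω s) (J s gs) ⟨
    anti n (λ i j → ev s g (suc i) * J s gs j) ∎))

  positive : ℕ → C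
  positive zero    = 0#
  positive (suc _) = 1#

  -- The sum of all z q^a ω_a. The forms of a new block have the same coefficient T + y at all older
  -- columns, so the system enters them only through this sum. By `F₁-σ`, 1 + τ is the generating
  -- series for r = 1.
  τ : ℕ → ℕ → C
  τ s = ev s positive

  ev-W : ∀ s c → ev s (W 0 c) ≋ const c ⊕ const (T + y) ⊛ τ s
  ev-W s c zero    = sym (trans (+-congˡ (zeroʳ _)) (+-identityʳ _))
  ev-W s c (suc n) = begin
    Σ< s (λ a → (T + y) * (q ^ a * ω s a n))         ≈⟨ Σ<-* s (T + y) ⟩
    (T + y) * Σ< s (λ a → q ^ a * ω s a n)
      ≈⟨ *-congˡ (Σ<-cong s (λ a _ → *-identityˡ _)) ⟨
    (T + y) * Σ< s (λ a → 1# * (q ^ a * ω s a n))    ≈⟨ trans (+-identityˡ _) (const-⊛ _ (τ s) (suc n)) ⟨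
    0# + (const (T + y) ⊛ τ s) (suc n) ∎

  -- Adding a last block scales the old system by the single factor U.
  module _ (s : ℕ) where
    U : ℕ → C
    U = const 1# ⊕ z ⊛ ω (suc s) 0

    U-0 : U 0 ≈ 1#
    U-0 = trans (+-congˡ (z⊛-0 (ω (suc s) 0))) (+-identityʳ _)

    U-suc : ∀ n → U (suc n) ≈ ω (suc s) 0 n
    U-suc n = trans (+-identityˡ _) (z⊛-suc (ω (suc s) 0) n)

    scaled-sum : ∀ (c : ℕ → C) n → anti n (λ i j → q ^ suc i * Σ< s (λ a → c a * (q ^ a * ω s a i)) * U j)
      ≈ Σ< s (λ a → c a * (q ^ suc a * (scale q (ω s a) ⊛ U) n))
    scaled-sum c n = begin
      anti n (λ i j → q ^ suc i * Σ< s (λ a → c a * (q ^ a * ω s a i)) * U j)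
        ≈⟨ anti-cong n (λ i j _ → *-congʳ (trans (*-assoc _ _ _) (*-congˡ (trans (sym (Σ<-* s (q ^ i)))
             (Σ<-cong s (λ a _ → solve 4 (λ i c a w → i :* (c :* (a :* w)) := c :* (a :* (i :* w))) refl (q ^ i) (c a) (q ^ a) (ω s a i))))))) ⟩
      anti n (λ i j → q * Σ< s (λ a → c a * (q ^ a * scale q (ω s a) i)) * U j)
        ≈⟨ anti-cong n (λ i j _ → *-assoc _ _ _) ⟩
      anti n (λ i j → q * (Σ< s (λ a → c a * (q ^ a * scale q (ω s a) i)) * U j))
        ≈⟨ trans (anti-*ˡ n q) (*-congˡ (Σ-⊛ s n c (λ a → scale q (ω s a)) U)) ⟩
      q * Σ< s (λ a → c a * (q ^ a * (scale q (ω s a) ⊛ U) n))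
        ≈⟨ trans (sym (Σ<-* s q)) (Σ<-cong s (λ a _ → trans (x*yz≈y*xz _ _ _) (*-congˡ (sym (*-assoc _ _ _))))) ⟩
      Σ< s (λ a → c a * (q ^ suc a * (scale q (ω s a) ⊛ U) n)) ∎

    -- In the equation of an older column, the new column has the same coefficient 1 + y as the
    -- constant 1. It therefore only multiplies the constant term of the system by `U`, and the
    -- solution is multiplied likewise. The exponents of q in the older columns rise by one, hence
    -- `scale`.
    ω-suc : ∀ a → ω (suc s) (suc a) ≋ scale q (ω s a) ⊛ U
    ω-suc a zero    = sym (trans (*-cong (*-identityˡ _) U-0) (*-identityʳ _))
    ω-suc a (suc n) = begin
      (1# + y) * (1# * ω (suc s) 0 n) + Σ< s (λ b → full a b * (q ^ suc b * ω (suc s) (suc b) n))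
        ≈⟨ +-cong (trans (*-congˡ (trans (*-identityˡ _) (sym (U-suc n)))) (*-congʳ (sym (*-identityˡ _))))
             (Σ<-cong s (λ b _ → *-congˡ (*-congˡ (ω-suc b n)))) ⟩
      1# * (1# + y) * U (suc n) + Σ< s (λ b → full a b * (q ^ suc b * (scale q (ω s b) ⊛ U) n))
        ≈⟨ +-congˡ (scaled-sum (full a) n) ⟨
      (scale q (ω s a) ⊛ U) (suc n) ∎

    tail₀ : (ℕ → C) → ℕ → C
    tail₀ g zero    = 0#
    tail₀ g (suc a) = g (suc (suc a))

    ev-suc : ∀ g → ev (suc s) g ≋ const (g 0) ⊕ (const (g 1) ⊛ (z ⊛ ω (suc s) 0) ⊕ scale q (ev s (tail₀ g)) ⊛ U)
    ev-suc g zero = sym (trans (+-congˡ (trans (+-cong (trans (*-congˡ (z⊛-0 (ω (suc s) 0))) (zeroʳ _))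
      (trans (*-congʳ (zeroʳ _)) (zeroˡ _))) (+-identityˡ _))) (+-identityʳ _))
    ev-suc g (suc n) = begin
      g 1 * (1# * ω (suc s) 0 n) + Σ< s (λ b → g (suc (suc b)) * (q ^ suc b * ω (suc s) (suc b) n))
        ≈⟨ +-cong (*-congˡ (trans (*-identityˡ _) (sym (z⊛-suc (ω (suc s) 0) n))))
                  (Σ<-cong s (λ b _ → *-congˡ (*-congˡ (ω-suc b n)))) ⟩
      g 1 * (z ⊛ ω (suc s) 0) (suc n) + Σ< s (λ b → g (suc (suc b)) * (q ^ suc b * (scale q (ω s b) ⊛ U) n))
        ≈⟨ +-cong (const-⊛ (g 1) (z ⊛ ω (suc s) 0) (suc n)) (scaled-sum (λ b → g (suc (suc b))) n) ⟨
      (const (g 1) ⊛ (z ⊛ ω (suc s) 0)) (suc n) + anti n (λ i j → scale q (ev s (tail₀ g)) (suc i) * U j)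
        ≈⟨ +-congˡ (trans (+-congʳ (trans (*-congʳ (zeroʳ _)) (zeroˡ _))) (+-identityˡ _)) ⟨
      (const (g 1) ⊛ (z ⊛ ω (suc s) 0)) (suc n) + (scale q (ev s (tail₀ g)) ⊛ U) (suc n)
        ≈⟨ +-identityˡ _ ⟨
      0# + ((const (g 1) ⊛ (z ⊛ ω (suc s) 0)) (suc n) + (scale q (ev s (tail₀ g)) ⊛ U) (suc n)) ∎

  const-+ : ∀ a b → const (a + b) ≋ const a ⊕ const b
  const-+ a b zero    = refl
  const-+ a b (suc n) = sym (+-identityˡ _)

  β̂ : ℕ → C
  β̂ = const T ⊕ const y

  -- `λ̂ s` is the factor contributed by a full form of the new block, after the older system has
  -- been taken at q z.
  σ τ̃ λ̂ : ℕ → ℕ → C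
  σ s = Z.1# ⊕ τ s
  τ̃ s = scale q (τ s)
  λ̂ s = Z.1# ⊕ β̂ ⊕ β̂ ⊛ τ̃ s

  σ-rec : ∀ s → σ (suc s) ⊕ z ⊛ (const T ⊛ (Z.1# ⊕ τ̃ s)) ≋ Z.1# ⊕ τ̃ s ⊕ z ⊛ (λ̂ s ⊛ σ (suc s))
  σ-rec s = SeriesIdentities.σ-step ring⟦z⟧ z (const T) (const y) (τ̃ s) V (τ (suc s)) V-eq τ-eq
    where
    V = z ⊛ ω (suc s) 0
    V-eq : V ≋ z ⊛ (Z.1# ⊕ const y ⊕ ((Z.1# ⊕ β̂) ⊛ V ⊕ β̂ ⊛ ((Z.1# ⊕ V) ⊛ τ̃ s)))
    V-eq = Z.*-congˡ {z} (Z.trans (ev-full (suc s) 0) (Z.trans (ev-suc s (full 1))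
      (Z.+-cong (const-+ 1# y) (Z.+-cong
        (Z.*-congʳ {V} (Z.trans (const-+ 1# (T + y)) (Z.+-congˡ {Z.1#} (const-+ T y))))
        (Z.trans (Z.*-congʳ {U s} tail-eq) (Z.trans (Z.*-assoc (β̂) (τ̃ s) (U s)) (Z.*-congˡ {β̂} (Z.*-comm (τ̃ s) (U s)))))))))
      where
      tail-eq : scale q (ev s (tail₀ s (full 1))) ≋ β̂ ⊛ τ̃ s
      tail-eq = Z.trans (scale-cong q (λ { zero → sym (trans (const-⊛ (T + y) (τ s) 0) (zeroʳ _)) ; (suc n) → lem n }))
        (Z.trans (scale-⊛ q (const (T + y)) (τ s)) (Z.*-congʳ {τ̃ s} (Z.trans (scale-const q (T + y)) (const-+ T y))))
        where
        lem : ∀ n → ev s (tail₀ s (full 1)) (suc n) ≈ (const (T + y) ⊛ τ s) (suc n)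
        lem n = trans (ev-W s 0# (suc n)) (+-identityˡ _)
    τ-eq : τ (suc s) ≋ V ⊕ (Z.1# ⊕ V) ⊛ τ̃ s
    τ-eq = Z.trans (ev-suc s positive) (Z.trans (λ n → trans (+-congʳ (const0 n)) (+-identityˡ _)) (Z.+-cong (Z.*-identityˡ V)
      (Z.trans (Z.*-congʳ {U s} (scale-cong q tail-eq)) (Z.*-comm (τ̃ s) (U s)))))
      where
      const0 : ∀ n → const 0# n ≈ 0#
      const0 zero = refl
      const0 (suc n) = refl
      tail-eq : ev s (tail₀ s positive) ≋ τ s
      tail-eq zero    = refl
      tail-eq (suc n) = refl

  length-P : ∀ b m → length (P b m) ≡ m
  length-P b zero          = ≡.refl
  length-P b (suc zero)    = ≡.refl
  length-P b (suc (suc m)) = ≡.cong suc (≡.trans (Listₚ.length-++ (replicate m (full b)))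
    (≡.trans (≡.cong (ℕ._+ 1) (Listₚ.length-replicate m)) (ℕₚ.+-comm m 1)))

  length-blocks : ∀ b us → length (blocks b us) ≡ sum us
  length-blocks b []       = ≡.refl
  length-blocks b (u ∷ us) = ≡.trans (Listₚ.length-++ (P b u))
    (≡.cong₂ ℕ._+_ (length-P b u) (length-blocks (suc b) us))

  map-replicate-++ : ∀ {A B : Set} (f : A → B) m x xs →
    map f (replicate m x ++ xs) ≡ replicate m (f x) ++ map f xs
  map-replicate-++ f zero    x xs = ≡.refl
  map-replicate-++ f (suc m) x xs = ≡.cong (f x ∷_) (map-replicate-++ f m x xs)

  tail-P : ∀ b m → map (_∘ suc) (P (suc b) m) ≡ P b m
  tail-P b zero          = ≡.refl
  tail-P b (suc zero)    = ≡.refl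
  tail-P b (suc (suc m)) = ≡.cong (W b (T + y) ∷_) (map-replicate-++ (_∘ suc) m (full (suc b)) _)

  tail-blocks : ∀ b us → map (_∘ suc) (blocks (suc b) us) ≡ blocks b us
  tail-blocks b []       = ≡.refl
  tail-blocks b (u ∷ us) = ≡.trans (Listₚ.map-++ (_∘ suc) (P (suc b) u) _)
    (≡.cong₂ _++_ (tail-P b u) (tail-blocks (suc b) us))

  -- The generating series of fixed-point free words.
  D : ℕ → ℕ → C
  D s = 𝒮 s (λ us → M us (blocks 0 us))

  J-[] : ∀ s → J s [] ≋ D s
  J-[] s = 𝒮-cong s (λ us _ → trans (Mo-const-irrelevant us (blocks 1 us) (length-blocks 1 us))
    (reflexive (≡.cong (M us) (tail-blocks 0 us))))

  -- The exponent m of x₀ gives z^m, the remaining variables are those of s blocks at q z, and x₀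
  -- can be set to 1 by homogeneity.
  D-suc : ∀ s → D (suc s) ≋ Γ (λ m → scale q (J s (P 0 m)))
  D-suc s = Γ-cong (λ m → scale-cong q (𝒮-cong s (λ us _ → dehomogenize m us (P 0 m ++ blocks 1 us)
    (≡.sym (≡.trans (Listₚ.length-++ (P 0 m)) (≡.cong₂ ℕ._+_ (length-P 0 m) (length-blocks 1 us)))))))

  D-rec : ∀ s → D (suc s) ⊕ (z ⊕ const T ⊛ z) ⊛ scale q (D s)
    ≋ scale q (D s) ⊕ const T ⊛ (z ⊛ z) ⊛ scale q (D s) ⊕ z ⊛ (λ̂ s ⊛ D (suc s))
  D-rec s = SeriesIdentities.derangement-step ring⟦z⟧ z (const T) (const y) (τ̃ s) D̃ K (D (suc s)) D-eq K-eq
    where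
    D̃ = scale q (D s)
    -- In a block of size at least 2 the greatest value contributes `a`, the least value `b`, and
    -- each value in between `λ̂ s`.
    a b : ℕ → C
    a = β̂ ⊕ β̂ ⊛ τ̃ s
    b = Z.1# ⊕ const y ⊕ β̂ ⊛ τ̃ s
    X : ℕ → ℕ → C
    X m = scale q (J s (replicate m (full 0) ++ W 0 (1# + y) ∷ []))
    K = Γ (λ m → a ⊛ X m)
    ev-scaled : ∀ c g → scale q (J s (W 0 c ∷ g)) ≋ (const c ⊕ β̂ ⊛ τ̃ s) ⊛ scale q (J s g)
    ev-scaled c g = Z.trans (scale-cong q (J-ev s (W 0 c) g)) (Z.trans (scale-⊛ q _ _) (Z.*-congʳ {scale q (J s g)}
      (Z.trans (scale-cong q (ev-W s c)) (Z.trans (scale-⊕ q _ _) (Z.+-cong (scale-const q c)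
        (Z.trans (scale-⊛ q _ _) (Z.*-congʳ {τ̃ s} (Z.trans (scale-const q (T + y)) (const-+ T y)))))))))
    X-0 : X 0 ≋ b ⊛ D̃
    X-0 = Z.trans (ev-scaled (1# + y) []) (Z.*-cong (Z.+-congʳ {β̂ ⊛ τ̃ s} (const-+ 1# y)) (scale-cong q (J-[] s)))
    X-suc : ∀ m → X (suc m) ≋ λ̂ s ⊛ X m
    X-suc m = Z.trans (ev-scaled (1# + (T + y)) (replicate m (full 0) ++ W 0 (1# + y) ∷ []))
      (Z.*-congʳ {X m} (Z.+-congʳ {β̂ ⊛ τ̃ s} (Z.trans (const-+ 1# (T + y)) (Z.+-congˡ {Z.1#} (const-+ T y)))))
    P-2 : ∀ m → scale q (J s (P 0 (suc (suc m)))) ≋ a ⊛ X m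
    P-2 m = Z.trans (ev-scaled (T + y) (replicate m (full 0) ++ W 0 (1# + y) ∷ []))
      (Z.*-congʳ {X m} (Z.+-congʳ {β̂ ⊛ τ̃ s} (const-+ T y)))
    K-eq : K ≋ a ⊛ (b ⊛ D̃) ⊕ z ⊛ (λ̂ s ⊛ K)
    K-eq = Z.trans (Γ-step (λ m → a ⊛ X m)) (Z.+-cong (Z.*-congˡ {a} X-0) (Z.*-congˡ {z}
      (Z.trans (Γ-cong (λ m → Z.trans (Z.*-congˡ {a} (X-suc m)) (lcomm a (λ̂ s) (X m)))) (Γ-⊛ (λ̂ s) (λ m → a ⊛ X m)))))
      where open CSG Z.*-commutativeSemigroup using () renaming (x∙yz≈y∙xz to lcomm)
    D-eq : D (suc s) ≋ D̃ ⊕ z ⊛ ((const y ⊕ β̂ ⊛ τ̃ s) ⊛ D̃ ⊕ z ⊛ K)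
    D-eq = Z.trans (D-suc s) (Z.trans (Γ-step (λ m → scale q (J s (P 0 m)))) (Z.+-cong (scale-cong q (J-[] s)) (Z.*-congˡ {z}
      (Z.trans (Γ-step (λ m → scale q (J s (P 0 (suc m))))) (Z.+-cong
        (Z.trans (ev-scaled y []) (Z.*-congˡ {const y ⊕ β̂ ⊛ τ̃ s} (scale-cong q (J-[] s))))
        (Z.*-congˡ {z} (Γ-cong P-2)))))))

  -- The hypothesis says (f - g) (1 - z l) = 0, and 1 - z l has constant term 1. Coefficient m of
  -- the products with z involves only coefficients of f and g below m.
  z-unique : ∀ l {f g} → f ⊕ z ⊛ (l ⊛ g) ≋ g ⊕ z ⊛ (l ⊛ f) → f ≋ g
  z-unique l {f} {g} h n = below n n ℕₚ.≤-refl
    where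
    open GroupProps +-group using (∙-cancelʳ)
    below : ∀ n m → m ℕ.≤ n → f m ≈ g m
    below n       zero    _           = ∙-cancelʳ (z ⊛ (l ⊛ g) $ 0) _ _
      (trans (h 0) (+-congˡ (trans (z⊛-0 (l ⊛ f)) (sym (z⊛-0 (l ⊛ g))))))
    below (suc n) (suc m) (ℕ.s≤s m≤n) = ∙-cancelʳ (z ⊛ (l ⊛ g) $ suc m) _ _
      (trans (h (suc m)) (+-congˡ (trans (z⊛-suc (l ⊛ f) m) (trans
        (anti-cong m (λ i j eq → *-congˡ (below n j (ℕₚ.≤-trans (ℕₚ.m+n≤o⇒n≤o i (ℕₚ.≤-reflexive eq)) m≤n))))
        (sym (z⊛-suc (l ⊛ g) m))))))

  module FixedPoints (r : C) where
    geometric : ℕ → C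
    geometric n = r ^ n

    geometric-eq : geometric ≋ Z.1# ⊕ const r ⊛ z ⊛ geometric
    geometric-eq zero    = sym (trans (+-congˡ (trans (*-congʳ (zeroʳ _)) (zeroˡ _))) (+-identityʳ _))
    geometric-eq (suc n) = sym (trans (+-identityˡ _) (trans (Z.*-assoc (const r) z geometric (suc n))
      (trans (const-⊛ r (z ⊛ geometric) (suc n)) (*-congˡ (z⊛-suc geometric n)))))

    -- The product of 1 / (1 - r z q^i) over i < s: each block may end with any number of fixed
    -- points.
    H : ℕ → ℕ → C
    H zero    = Z.1#
    H (suc s) = geometric ⊛ scale q (H s)

    F : ℕ → ℕ → C
    F s = H s ⊛ D s

    H-eq : ∀ s → H (suc s) ≋ scale q (H s) ⊕ const r ⊛ z ⊛ H (suc s)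
    H-eq s = Z.trans (Z.*-congʳ {scale q (H s)} geometric-eq) (Z.trans (Z.distribʳ (scale q (H s)) Z.1# (const r ⊛ z ⊛ geometric))
      (Z.+-cong (Z.*-identityˡ (scale q (H s))) (Z.*-assoc (const r ⊛ z) geometric (scale q (H s)))))

    F-rec : ∀ s → let F̃ = scale q (F s) in
      F (suc s) ⊕ z ⊛ (const T ⊛ F̃)
        ≋ F̃ ⊕ const r ⊛ (z ⊛ F (suc s)) ⊕ z ⊛ (β̂ ⊛ (σ (suc s) ⊛ F̃))
    F-rec s = Z.trans (Z.+-congˡ {F (suc s)} (Z.*-congˡ {z} (Z.*-congˡ {const T} F̃-eq))) (Z.trans
      (fixed-points z (const T) (β̂) (const r) (scale q (D s)) (D (suc s)) (σ (suc s)) (scale q (H s)) (H (suc s))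
        (derangement-closed z (const T) (β̂) (τ̃ s) (scale q (D s)) (D (suc s)) (σ (suc s)) (z-unique (λ̂ s)) (D-rec s) (σ-rec s))
        (H-eq s))
      (Z.sym (Z.+-cong (Z.+-congʳ {const r ⊛ (z ⊛ F (suc s))} F̃-eq)
        (Z.*-congˡ {z} (Z.*-congˡ {β̂} (Z.*-congˡ {σ (suc s)} F̃-eq))))))
      where
      open SeriesIdentities.Cancel ring⟦z⟧ (λ j → GroupProps.∙-cancelʳ Z.+-group j _ _)
      F̃-eq : scale q (F s) ≋ scale q (H s) ⊛ scale q (D s)
      F̃-eq = scale-⊛ q (H s) (D s)

  open FixedPoints 1# renaming (F to F₁; H to H₁; H-eq to H₁-eq) using ()

  -- This identifies the solution of the linear system with a generating series of colored
  -- permutations, so that `F-rec` becomes a relation among generating series only.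
  F₁-σ : ∀ s → F₁ s ≋ σ s
  F₁-σ zero    = λ { zero → trans (*-identityˡ _) (sym (+-identityʳ _)) ; (suc n) →
    trans (Z.*-identityˡ (D 0) (suc n)) (sym (+-identityˡ _)) }
  F₁-σ (suc s) = unit-fixed-points z (const T) (β̂) (τ̃ s) (scale q (D s)) (D (suc s)) (σ (suc s)) (scale q (H₁ s)) (H₁ (suc s))
    (z-unique (λ̂ s)) (D-rec s) (σ-rec s)
    (Z.trans (H₁-eq s) (Z.+-congˡ {scale q (H₁ s)} (Z.*-congʳ {H₁ (suc s)} (Z.*-identityˡ z))))
    (Z.trans (Z.sym (scale-⊛ q (H₁ s) (D s))) (Z.trans (scale-cong q (F₁-σ s))
      (Z.trans (scale-⊕ q Z.1# (τ s)) (Z.+-congʳ {τ̃ s} (scale-const q 1#)))))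
    where open SeriesIdentities.Cancel ring⟦z⟧ (λ j → GroupProps.∙-cancelʳ Z.+-group j _ _)

-- Sums over sublists

<ᵇ-true : ∀ {a b} → a ℕ.< b → (a <ᵇ b) ≡ true
<ᵇ-true {a} {b} p with a <ᵇ b | ℕₚ.<⇒<ᵇ p
... | true | _ = ≡.refl

<ᵇ-false : ∀ {a b} → b ℕ.≤ a → (a <ᵇ b) ≡ false
<ᵇ-false {a} {b} p with a <ᵇ b in eq
... | false = ≡.refl
... | true  = ⊥-elim (ℕₚ.<-irrefl ≡.refl (ℕₚ.<-≤-trans (ℕₚ.<ᵇ⇒< a b (≡.subst Data.Bool.T (≡.sym eq) tt)) p))

≡ᵇ-refl : ∀ a → (a ≡ᵇ a) ≡ true
≡ᵇ-refl zero    = ≡.refl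
≡ᵇ-refl (suc a) = ≡ᵇ-refl a

≡ᵇ-false : ∀ {a b} → a ≢ b → (a ≡ᵇ b) ≡ false
≡ᵇ-false {zero}  {zero}  p = ⊥-elim (p ≡.refl)
≡ᵇ-false {zero}  {suc b} p = ≡.refl
≡ᵇ-false {suc a} {zero}  p = ≡.refl
≡ᵇ-false {suc a} {suc b} p = ≡ᵇ-false (p ∘ ≡.cong suc)

Desc : List ℕ → Set
Desc = AllPairs ℕ._>_

Desc-split : ∀ mid {v post} → Desc (mid ++ v ∷ post) →
  All (ℕ._> v) mid × All (λ w → All (w ℕ.>_) post) mid × All (v ℕ.>_) post × Desc post
Desc-split []        (v> ∷ d) = [] , [] , v> , d
Desc-split (w ∷ mid) (w> ∷ d) with Desc-split mid d | Allₚ.++⁻ʳ mid w>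
... | mid> , mid>post , v> , d′ | w>v ∷ w>post = w>v ∷ mid> , w>post ∷ mid>post , v> , d′

module Splits (R : CommutativeRing 0ℓ 0ℓ) where
  open CommutativeRing R renaming (Carrier to C)
  open SetoidR setoid
  open CSG +-commutativeSemigroup using () renaming (interchange to +-interchange)
  open Solver commutativeSemiring using (solve; _:=_; _:+_; _:*_)

  𝟙 : Bool → C
  𝟙 true  = 1#
  𝟙 false = 0#

  firstSum : List ℕ → (List ℕ → ℕ → List ℕ → C) → C
  firstSum []      k = 0#
  firstSum (v ∷ V) k = k [] v V + firstSum V (λ mid → k (v ∷ mid))

  splitSum : List ℕ → (List ℕ → List ℕ → C) → C
  splitSum []      k = k [] []
  splitSum (v ∷ V) k = splitSum V (λ S U → k (v ∷ S) U) + splitSum V (λ S U → k S (v ∷ U))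

  firstSum-cong : ∀ V {k k′} → (∀ mid v post → mid ++ v ∷ post ≡ V → k mid v post ≈ k′ mid v post) →
    firstSum V k ≈ firstSum V k′
  firstSum-cong []      h = refl
  firstSum-cong (v ∷ V) h =
    +-cong (h [] v V ≡.refl) (firstSum-cong V (λ mid u post eq → h (v ∷ mid) u post (≡.cong (v ∷_) eq)))

  firstSum-++ : ∀ U V k → firstSum (U ++ V) k
    ≈ firstSum U (λ mid v post → k mid v (post ++ V)) + firstSum V (λ mid → k (U ++ mid))
  firstSum-++ []      V k = sym (+-identityˡ _)
  firstSum-++ (u ∷ U) V k = trans (+-congˡ (firstSum-++ U V (λ mid → k (u ∷ mid)))) (sym (+-assoc _ _ _))

  firstSum-0 : ∀ V {k} → (∀ mid v post → mid ++ v ∷ post ≡ V → k mid v post ≈ 0#) → firstSum V k ≈ 0#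
  firstSum-0 []      h = refl
  firstSum-0 (v ∷ V) h = trans (+-cong (h [] v V ≡.refl)
    (firstSum-0 V (λ mid u post eq → h (v ∷ mid) u post (≡.cong (v ∷_) eq)))) (+-identityˡ _)

  firstSum-* : ∀ V c {k} → firstSum V (λ mid v post → c * k mid v post) ≈ c * firstSum V k
  firstSum-* []      c = sym (zeroʳ c)
  firstSum-* (v ∷ V) c = trans (+-congˡ (firstSum-* V c)) (sym (distribˡ _ _ _))

  firstSum-+ : ∀ V {k k′} → firstSum V (λ mid v post → k mid v post + k′ mid v post) ≈ firstSum V k + firstSum V k′
  firstSum-+ []      = sym (+-identityˡ _)
  firstSum-+ (v ∷ V) = trans (+-congˡ (firstSum-+ V)) (+-interchange _ _ _ _)

  splitSum-congʳ : ∀ V {k k′} → (∀ S U → k S U ≈ k′ S U) → splitSum V k ≈ splitSum V k′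
  splitSum-congʳ []      h = h [] []
  splitSum-congʳ (v ∷ V) h = +-cong (splitSum-congʳ V (λ S U → h (v ∷ S) U)) (splitSum-congʳ V (λ S U → h S (v ∷ U)))

  -- The field `all` is quantified over the predicate because the induction on V applies it to the
  -- comparison with each new head.
  record Split (V S U : List ℕ) : Set₁ where
    constructor split
    field
      desc₁   : Desc S
      desc₂   : Desc U
      lengths : length S ℕ.+ length U ≡ length V
      all     : ∀ {P : ℕ → Set} → All P V → All P S × All P U

  splitSum-cong : ∀ V {k k′} → Desc V → (∀ S U → Split V S U → k S U ≈ k′ S U) → splitSum V k ≈ splitSum V k′
  splitSum-cong []      _        h = h [] [] (split [] [] ≡.refl (λ _ → [] , []))
  splitSum-cong (v ∷ V) (v> ∷ d) h = +-cong
    (splitSum-cong V d (λ S U (split d₁ d₂ l all) → h (v ∷ S) U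
      (split (proj₁ (all v>) ∷ d₁) d₂ (≡.cong suc l) (λ { (p ∷ ps) → p ∷ proj₁ (all ps) , proj₂ (all ps) }))))
    (splitSum-cong V d (λ S U (split d₁ d₂ l all) → h S (v ∷ U)
      (split d₁ (proj₂ (all v>) ∷ d₂) (≡.trans (ℕₚ.+-suc _ _) (≡.cong suc l))
        (λ { (p ∷ ps) → proj₁ (all ps) , p ∷ proj₂ (all ps) }))))

  splitSum-+ : ∀ V {k k′} → splitSum V (λ S U → k S U + k′ S U) ≈ splitSum V k + splitSum V k′
  splitSum-+ []      = refl
  splitSum-+ (v ∷ V) = trans (+-cong (splitSum-+ V) (splitSum-+ V)) (+-interchange _ _ _ _)

  splitSum-* : ∀ V c {k} → splitSum V (λ S U → c * k S U) ≈ c * splitSum V k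
  splitSum-* []      c = refl
  splitSum-* (v ∷ V) c = trans (+-cong (splitSum-* V c) (splitSum-* V c)) (sym (distribˡ _ _ _))

  splitSum-0 : ∀ V → splitSum V (λ _ _ → 0#) ≈ 0#
  splitSum-0 V = trans (splitSum-congʳ V (λ _ _ → sym (zeroˡ 0#))) (trans (splitSum-* V 0#) (zeroˡ _))

  -- Grouped by the first element of `S`: all elements before it lie in `U`.
  splitSum-first : ∀ V F → splitSum V F
    ≈ F [] V + firstSum V (λ mid v post → splitSum post (λ S P → F (v ∷ S) (mid ++ P)))
  splitSum-first []      F = sym (+-identityʳ _)
  splitSum-first (v ∷ V) F = begin
    splitSum V (λ S U → F (v ∷ S) U) + splitSum V (λ S U → F S (v ∷ U))
      ≈⟨ +-congˡ (splitSum-first V (λ S U → F S (v ∷ U))) ⟩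
    splitSum V (λ S U → F (v ∷ S) U) + (F [] (v ∷ V) + firstSum V _)
      ≈⟨ solve 3 (λ a b c → a :+ (b :+ c) := b :+ (a :+ c)) refl _ _ _ ⟩
    F [] (v ∷ V) + (splitSum V (λ S U → F (v ∷ S) U) + firstSum V _) ∎

  prod : (ℕ → C) → List ℕ → C
  prod f []      = 1#
  prod f (v ∷ S) = f v * prod f S

  prod-cong : ∀ S {f g} → All (λ v → f v ≈ g v) S → prod f S ≈ prod g S
  prod-cong []      []       = refl
  prod-cong (v ∷ S) (p ∷ ps) = *-cong p (prod-cong S ps)

  -- Two successive selections are one selection whose elements are marked as first or second; the
  -- product of the sums f v + g U v expands into the choices of marks. The weight `g` may depend on
  -- the remainder, because the final remainder is the same on both sides.
  splitSum-merge : ∀ V f (g : List ℕ → ℕ → C) h →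
    splitSum V (λ S U → prod f S * splitSum U (λ S′ U′ → prod (g U′) S′ * h U′))
      ≈ splitSum V (λ S U → prod (λ v → f v + g U v) S * h U)
  splitSum-merge []      f g h = *-identityˡ _
  splitSum-merge (v ∷ V) f g h = begin
    splitSum V (λ S U → (f v * prod f S) * X h U)
      + splitSum V (λ S U → prod f S * (splitSum U (λ S′ U′ → (g U′ v * prod (g U′) S′) * h U′)
                                        + splitSum U (λ S′ U′ → prod (g (v ∷ U′)) S′ * h (v ∷ U′))))
      ≈⟨ +-cong (trans (splitSum-congʳ V (λ S U → *-assoc _ _ _)) (splitSum-* V (f v)))
           (trans (splitSum-congʳ V (λ S U → distribˡ _ _ _)) (splitSum-+ V)) ⟩
    f v * splitSum V (λ S U → prod f S * X h U)
      + (splitSum V (λ S U → prod f S * splitSum U (λ S′ U′ → (g U′ v * prod (g U′) S′) * h U′))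
         + splitSum V (λ S U → prod f S * splitSum U (λ S′ U′ → prod (g (v ∷ U′)) S′ * h (v ∷ U′))))
      ≈⟨ +-cong (*-congˡ (splitSum-merge V f g h)) (+-cong
           (trans (splitSum-congʳ V (λ S U → *-congˡ (splitSum-congʳ U (λ S′ U′ →
              solve 3 (λ a b c → (a :* b) :* c := b :* (a :* c)) refl (g U′ v) (prod (g U′) S′) (h U′)))))
            (splitSum-merge V f g (λ U′ → g U′ v * h U′)))
           (splitSum-merge V f (λ U′ → g (v ∷ U′)) (λ U′ → h (v ∷ U′)))) ⟩
    f v * splitSum V (λ S U → Y S U * h U) + (splitSum V (λ S U → Y S U * (g U v * h U)) + rest)
      ≈⟨ +-assoc _ _ _ ⟨
    f v * splitSum V (λ S U → Y S U * h U) + splitSum V (λ S U → Y S U * (g U v * h U)) + rest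
      ≈⟨ +-congʳ (trans (+-congʳ (sym (splitSum-* V (f v)))) (trans (sym (splitSum-+ V)) (splitSum-congʳ V (λ S U →
           solve 4 (λ f y g h → f :* (y :* h) :+ y :* (g :* h) := ((f :+ g) :* y) :* h) refl (f v) (Y S U) (g U v) (h U))))) ⟩
    splitSum V (λ S U → ((f v + g U v) * Y S U) * h U) + rest ∎
    where
    X : (List ℕ → C) → List ℕ → C
    X h U = splitSum U (λ S′ U′ → prod (g U′) S′ * h U′)
    Y : List ℕ → List ℕ → C
    Y S U = prod (λ v → f v + g U v) S
    rest = splitSum V (λ S U → prod (λ w → f w + g (v ∷ U) w) S * h (v ∷ U))

  open Forms R

  -- The two groups of variables belong to the fixed points and to the other letters of the blocks.
  M₂ : List ℕ → List ℕ → List ((ℕ → C) × (ℕ → C)) → C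
  M₂ is us []             = δ₀ is * δ₀ us
  M₂ is us ((f , g) ∷ fs) = dsum f is (λ is′ → M₂ is′ us fs) + dsum g us (λ us′ → M₂ is us′ fs)

  infixr 5 _◂_
  _◂_ : C → (ℕ → C) → ℕ → C
  (c ◂ f) zero    = c
  (c ◂ f) (suc a) = f a

  dsum-splitSum : ∀ V us {f} (k : List ℕ → List ℕ → List ℕ → C) →
    splitSum V (λ S U → dsum f us (λ us′ → k us′ S U)) ≈ dsum f us (λ us′ → splitSum V (k us′))
  dsum-splitSum []      us k = refl
  dsum-splitSum (v ∷ V) us k = trans
    (+-cong (dsum-splitSum V us (λ us′ S U → k us′ (v ∷ S) U)) (dsum-splitSum V us (λ us′ S U → k us′ S (v ∷ U))))
    (sym (dsum-+ us))

  -- `S` is the set of values whose forms supply the new variable, and `m` is the exponent of this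
  -- variable.
  split-M₂-right : ∀ m is us w (φ ψ : ℕ → ℕ → C) V →
    splitSum V (λ S U → 𝟙 (length S ≡ᵇ m) * (prod w S * M₂ is us (map (λ v → φ v , ψ v) U)))
      ≈ M₂ is (m ∷ us) (map (λ v → φ v , w v ◂ ψ v) V)
  split-M₂-right zero    is us w φ ψ [] = trans (*-identityˡ _) (*-identityˡ _)
  split-M₂-right (suc m) is us w φ ψ [] = trans (zeroˡ _) (sym (zeroʳ _))
  split-M₂-right m is us w φ ψ (v ∷ V) = begin
    splitSum V (λ S U → 𝟙 (suc (length S) ≡ᵇ m) * ((w v * prod w S) * N is us U))
      + splitSum V (λ S U → 𝟙 (length S ≡ᵇ m) * (prod w S * (dsum (φ v) is (λ is′ → N is′ us U) + dsum (ψ v) us (λ us′ → N is us′ U))))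
      ≈⟨ +-cong (first m) (trans (splitSum-congʳ V expand) (splitSum-+ V)) ⟩
    w v * dec m (λ m′ → M₂ is (m′ ∷ us) fs)
      + (splitSum V (λ S U → dsum (φ v) is (λ is′ → 𝟙 (length S ≡ᵇ m) * (prod w S * N is′ us U)))
         + splitSum V (λ S U → dsum (ψ v) us (λ us′ → 𝟙 (length S ≡ᵇ m) * (prod w S * N is us′ U))))
      ≈⟨ +-congˡ (+-cong
           (trans (dsum-splitSum V is (λ is′ S U → 𝟙 (length S ≡ᵇ m) * (prod w S * N is′ us U)))
             (dsum-congʳ is (λ is′ → split-M₂-right m is′ us w φ ψ V)))
           (trans (dsum-splitSum V us (λ us′ S U → 𝟙 (length S ≡ᵇ m) * (prod w S * N is us′ U)))
             (dsum-congʳ us (λ us′ → split-M₂-right m is us′ w φ ψ V)))) ⟩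
    w v * dec m (λ m′ → M₂ is (m′ ∷ us) fs)
      + (dsum (φ v) is (λ is′ → M₂ is′ (m ∷ us) fs) + dsum (ψ v) us (λ us′ → M₂ is (m ∷ us′) fs))
      ≈⟨ solve 3 (λ a b c → a :+ (b :+ c) := b :+ (a :+ c)) refl _ _ _ ⟩
    M₂ is (m ∷ us) (map (λ v → φ v , w v ◂ ψ v) (v ∷ V)) ∎
    where
    N : List ℕ → List ℕ → List ℕ → C
    N is us U = M₂ is us (map (λ v → φ v , ψ v) U)
    fs = map (λ v → φ v , w v ◂ ψ v) V
    first : ∀ m → splitSum V (λ S U → 𝟙 (suc (length S) ≡ᵇ m) * ((w v * prod w S) * N is us U))
                  ≈ w v * dec m (λ m′ → M₂ is (m′ ∷ us) fs)
    first zero    = trans (splitSum-congʳ V (λ S U → zeroˡ _)) (trans (splitSum-0 V) (sym (zeroʳ _)))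
    first (suc m) = trans (splitSum-congʳ V (λ S U → solve 4 (λ a b c d → a :* ((b :* c) :* d) := b :* (a :* (c :* d)))
      refl (𝟙 (length S ≡ᵇ m)) (w v) (prod w S) (N is us U)))
      (trans (splitSum-* V (w v)) (*-congˡ (split-M₂-right m is us w φ ψ V)))
    expand : ∀ S U → 𝟙 (length S ≡ᵇ m) * (prod w S * (dsum (φ v) is (λ is′ → N is′ us U) + dsum (ψ v) us (λ us′ → N is us′ U)))
      ≈ dsum (φ v) is (λ is′ → 𝟙 (length S ≡ᵇ m) * (prod w S * N is′ us U))
        + dsum (ψ v) us (λ us′ → 𝟙 (length S ≡ᵇ m) * (prod w S * N is us′ U))
    expand S U = trans (trans (*-congˡ (distribˡ _ _ _)) (distribˡ _ _ _)) (sym (+-cong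
      (trans (dsum-* is _) (*-congˡ (dsum-* is _))) (trans (dsum-* us _) (*-congˡ (dsum-* us _)))))

  M₂-swap : ∀ is us (φ ψ : ℕ → ℕ → C) V →
    M₂ is us (map (λ v → φ v , ψ v) V) ≈ M₂ us is (map (λ v → ψ v , φ v) V)
  M₂-swap is us φ ψ []      = *-comm _ _
  M₂-swap is us φ ψ (v ∷ V) = trans (+-comm _ _)
    (+-cong (dsum-congʳ us (λ us′ → M₂-swap is us′ φ ψ V)) (dsum-congʳ is (λ is′ → M₂-swap is′ us φ ψ V)))

  split-M₂-left : ∀ i is us w (φ ψ : ℕ → ℕ → C) V →
    splitSum V (λ S U → 𝟙 (length S ≡ᵇ i) * (prod w S * M₂ is us (map (λ v → φ v , ψ v) U)))
      ≈ M₂ (i ∷ is) us (map (λ v → w v ◂ φ v , ψ v) V)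
  split-M₂-left i is us w φ ψ V = begin
    splitSum V (λ S U → 𝟙 (length S ≡ᵇ i) * (prod w S * M₂ is us (map (λ v → φ v , ψ v) U)))
      ≈⟨ splitSum-congʳ V (λ S U → *-congˡ (*-congˡ (M₂-swap is us φ ψ U))) ⟩
    splitSum V (λ S U → 𝟙 (length S ≡ᵇ i) * (prod w S * M₂ us is (map (λ v → ψ v , φ v) U)))
      ≈⟨ split-M₂-right i us is w ψ φ V ⟩
    M₂ us (i ∷ is) (map (λ v → ψ v , w v ◂ φ v) V)
      ≈⟨ M₂-swap us (i ∷ is) ψ (λ v → w v ◂ φ v) V ⟩
    M₂ (i ∷ is) us (map (λ v → w v ◂ φ v , ψ v) V) ∎

  count : (ℕ → Bool) → List ℕ → ℕ
  count X []      = 0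
  count X (v ∷ V) = if X v then suc (count X V) else count X V

  remove : (ℕ → Bool) → List ℕ → List ℕ
  remove X []      = []
  remove X (v ∷ V) = if X v then remove X V else v ∷ remove X V

  count-≤ : ∀ X v V → count X V ℕ.≤ count X (v ∷ V)
  count-≤ X v V with X v
  ... | true  = ℕₚ.n≤1+n _
  ... | false = ℕₚ.≤-refl

  -- Only the values in `X` can supply the first variable.
  M₂-tooFew : ∀ (X : ℕ → Bool) r i is us (φ ψ : ℕ → ℕ → C) V → count X V ℕ.< i →
    M₂ (i ∷ is) us (map (λ v → (r * 𝟙 (X v)) ◂ φ v , ψ v) V) ≈ 0#
  M₂-tooFew X r (suc i) is us φ ψ []      p = zeroˡ _
  M₂-tooFew X r (suc i) is us φ ψ (v ∷ V) p = trans (+-cong (+-cong (head (X v) ≡.refl)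
      (trans (dsum-congʳ is (λ is′ → M₂-tooFew X r (suc i) is′ us φ ψ V p′)) (dsum-0 is)))
      (trans (dsum-congʳ us (λ us′ → M₂-tooFew X r (suc i) is us′ φ ψ V p′)) (dsum-0 us)))
    (trans (+-identityʳ _) (+-identityʳ _))
    where
    p′ = ℕₚ.≤-<-trans (count-≤ X v V) p
    head : ∀ b → X v ≡ b → r * 𝟙 b * M₂ (i ∷ is) us (map (λ v → (r * 𝟙 (X v)) ◂ φ v , ψ v) V) ≈ 0#
    head false eq = trans (*-congʳ (zeroʳ r)) (zeroˡ _)
    head true  eq = trans (*-congˡ (M₂-tooFew X r i is us φ ψ V (ℕ.s≤s⁻¹ (≡.subst (λ b → (if b then suc (count X V) else count X V) ℕ.< suc i) eq p)))) (zeroʳ _)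

  -- A column supported on exactly as many values as it must collect forces
  -- these values.
  M₂-forced : ∀ (X : ℕ → Bool) r i is us (φ ψ : ℕ → ℕ → C) V → count X V ≡ i →
    M₂ (i ∷ is) us (map (λ v → (r * 𝟙 (X v)) ◂ φ v , ψ v) V)
      ≈ prod (λ v → if X v then r else 1#) V * M₂ is us (map (λ v → φ v , ψ v) (remove X V))
  M₂-forced X r zero is us φ ψ [] eq = sym (*-identityˡ _)
  M₂-forced X r i is us φ ψ (v ∷ V) eq with X v in Xv
  M₂-forced X r (suc i) is us φ ψ (v ∷ V) ≡.refl | true = begin
    (r * 1#) * G (i ∷ is) us + dsum (φ v) is (λ is′ → G (suc i ∷ is′) us) + dsum (ψ v) us (λ us′ → G (suc i ∷ is) us′)
      ≈⟨ +-cong (+-cong (*-cong (*-identityʳ r) (M₂-forced X r i is us φ ψ V ≡.refl))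
           (trans (dsum-congʳ is (λ is′ → M₂-tooFew X r (suc i) is′ us φ ψ V ℕₚ.≤-refl)) (dsum-0 is)))
           (trans (dsum-congʳ us (λ us′ → M₂-tooFew X r (suc i) is us′ φ ψ V ℕₚ.≤-refl)) (dsum-0 us)) ⟩
    r * (prod (λ v → if X v then r else 1#) V * M₂ is us (map (λ v → φ v , ψ v) (remove X V))) + 0# + 0#
      ≈⟨ trans (+-identityʳ _) (trans (+-identityʳ _) (sym (*-assoc _ _ _))) ⟩
    r * prod (λ v → if X v then r else 1#) V * M₂ is us (map (λ v → φ v , ψ v) (remove X V)) ∎
    where
    G : List ℕ → List ℕ → C
    G is us = M₂ is us (map (λ v → (r * 𝟙 (X v)) ◂ φ v , ψ v) V)
  M₂-forced X r i is us φ ψ (v ∷ V) eq | false = begin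
    (r * 0#) * dec i (λ i′ → G (i′ ∷ is) us) + dsum (φ v) is (λ is′ → G (i ∷ is′) us) + dsum (ψ v) us (λ us′ → G (i ∷ is) us′)
      ≈⟨ +-cong (trans (+-congʳ (trans (*-congʳ (zeroʳ r)) (zeroˡ _))) (trans (+-identityˡ _)
             (trans (dsum-congʳ is (λ is′ → M₂-forced X r i is′ us φ ψ V eq)) (dsum-* is _))))
           (trans (dsum-congʳ us (λ us′ → M₂-forced X r i is us′ φ ψ V eq)) (dsum-* us _)) ⟩
    pr * dsum (φ v) is (λ is′ → G′ is′ us) + pr * dsum (ψ v) us (λ us′ → G′ is us′)
      ≈⟨ sym (distribˡ _ _ _) ⟩
    pr * (dsum (φ v) is (λ is′ → G′ is′ us) + dsum (ψ v) us (λ us′ → G′ is us′))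
      ≈⟨ *-congʳ (sym (*-identityˡ pr)) ⟩
    1# * pr * (dsum (φ v) is (λ is′ → G′ is′ us) + dsum (ψ v) us (λ us′ → G′ is us′)) ∎
    where
    pr = prod (λ v → if X v then r else 1#) V
    G G′ : List ℕ → List ℕ → C
    G is us = M₂ is us (map (λ v → (r * 𝟙 (X v)) ◂ φ v , ψ v) V)
    G′ is us = M₂ is us (map (λ v → φ v , ψ v) (remove X V))

  M₂-[] : ∀ us fs → M₂ [] us fs ≈ M us (map proj₂ fs)
  M₂-[] us []       = *-identityˡ _
  M₂-[] us (f ∷ fs) = trans (+-identityˡ _) (dsum-congʳ us (λ us′ → M₂-[] us′ fs))

-- Words and MacMahon's Verfahren

-- The type of a letter at a position: excedances 0, colors l-1, …, 1 in this
-- order, then non-excedances l of color 0, and fixed points l + 1.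
kind : ℕ → ℕ → Letter → ℕ
kind l pos (v , zero)  = if pos <ᵇ v then 0 else if v <ᵇ pos then l else suc l
kind l pos (v , suc c) = l ℕ.∸ suc c

below : Maybe ℕ → ℕ → Bool
below nothing  v = true
below (just b) v = v <ᵇ b

module Words (R : CommutativeRing 0ℓ 0ℓ) (l : ℕ)
  (T : CommutativeRing.Carrier R) (γ : ℕ → CommutativeRing.Carrier R) (r q : CommutativeRing.Carrier R) where
  open CommutativeRing R renaming (Carrier to C)
  open SetoidR setoid
  open Solver commutativeSemiring using (solve; _:=_; _:+_; _:*_)
  open Exp semiring using (_^_)
  open Series R
  open Forms R
  open Splits R

  letterWeight : ℕ → Letter → C
  letterWeight pos (v , zero)  = if pos <ᵇ v then T else if v <ᵇ pos then 1# else r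
  letterWeight pos (v , suc c) = γ (suc c)

  -- Words are reversed from here on: the first letter of a word of length n
  -- stands at position n.
  weightR : List Letter → C
  weightR []      = 1#
  weightR (x ∷ ρ) = letterWeight (suc (length ρ)) x * weightR ρ

  arrSum : ℕ → List ℕ → (List Letter → C) → C
  arrSum zero    V f = f []
  arrSum (suc n) V f = firstSum V (λ mid v post → Σ< l (λ c → arrSum n (mid ++ post) (λ ρ → f ((v , c) ∷ ρ))))

  arrSum-cong : ∀ n V {f g} → (∀ ρ → length ρ ≡ n → f ρ ≈ g ρ) → arrSum n V f ≈ arrSum n V g
  arrSum-cong zero    V h = h [] ≡.refl
  arrSum-cong (suc n) V h = firstSum-cong V (λ mid v post _ → Σ<-cong l (λ c _ →
    arrSum-cong n (mid ++ post) (λ ρ eq → h ((v , c) ∷ ρ) (≡.cong suc eq))))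

  arrSum-+ : ∀ n V {f g} → arrSum n V (λ ρ → f ρ + g ρ) ≈ arrSum n V f + arrSum n V g
  arrSum-+ zero    V = refl
  arrSum-+ (suc n) V = trans (firstSum-cong V (λ mid v post _ →
    trans (Σ<-cong l (λ c _ → arrSum-+ n (mid ++ post))) (Σ<-+ l))) (firstSum-+ V)

  arrSum-* : ∀ n V c {f} → arrSum n V (λ ρ → c * f ρ) ≈ c * arrSum n V f
  arrSum-* zero    V c = refl
  arrSum-* (suc n) V c = trans (firstSum-cong V (λ mid v post _ →
    trans (Σ<-cong l (λ _ _ → arrSum-* n (mid ++ post) c)) (Σ<-* l c))) (firstSum-* V c)

  wsum : ℕ → List ℕ → (List Letter → C) → C
  wsum n V g = arrSum n V (λ ρ → weightR ρ * g ρ)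

  -- Words are reversed, so a block is read from its end: types decrease from run to run, and within
  -- one type each value lies below the preceding one, `b`.
  run : ℕ → (List Letter → C) → Maybe ℕ → List Letter → C
  run κ g b []      = g []
  run κ g b (x ∷ ρ) = g (x ∷ ρ) +
    𝟙 (kind l (suc (length ρ)) x ≡ᵇ κ) * (𝟙 (below b (proj₁ x)) * run κ g (just (proj₁ x)) ρ)

  -- The sum of q^|ρ″| g ρ″ over the factorizations ρ = ρ′ ++ ρ″ such that the letters
  -- of ρ′ have types below κ and decrease in the order by type, then value.
  cells : ℕ → (List Letter → C) → List Letter → C
  cells zero    g ρ = q ^ length ρ * g ρ
  cells (suc κ) g ρ = run κ (cells κ g) nothing ρ

  -- MacMahon's Verfahren: E s ρ is the sum of q^(b₁ + ⋯ + bₙ) over all sequences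
  -- s > b₁ ≥ ⋯ ≥ bₙ ≥ 0 that decrease strictly at the descents of the word.
  E : ℕ → List Letter → C
  E zero    []      = 1#
  E zero    (_ ∷ _) = 0#
  E (suc s) ρ       = cells (suc (suc l)) (E s) ρ

  cw : ℕ → ℕ → ℕ → C
  cw κ pos v = Σ< l (λ c → 𝟙 (kind l pos (v , c) ≡ᵇ κ) * letterWeight pos (v , c))

  cws : ℕ → ℕ → List ℕ → C
  cws κ n []      = 1#
  cws κ n (v ∷ S) = cw κ n v * cws κ (ℕ.pred n) S

  run-step : ∀ κ g b n V → wsum (suc n) V (run κ g b) ≈ wsum (suc n) V g
    + firstSum V (λ mid v post → cw κ (suc n) v * (𝟙 (below b v) * wsum n (mid ++ post) (run κ g (just v))))
  run-step κ g b n V = trans (firstSum-cong V (λ mid v post _ → by-letter mid v post)) (firstSum-+ V)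
    where
    by-letter : ∀ mid v post →
      Σ< l (λ c → arrSum n (mid ++ post) (λ ρ → weightR ((v , c) ∷ ρ) * run κ g b ((v , c) ∷ ρ)))
      ≈ Σ< l (λ c → arrSum n (mid ++ post) (λ ρ → weightR ((v , c) ∷ ρ) * g ((v , c) ∷ ρ)))
        + cw κ (suc n) v * (𝟙 (below b v) * wsum n (mid ++ post) (run κ g (just v)))
    by-letter mid v post = begin
      Σ< l (λ c → arrSum n W (λ ρ → weightR ((v , c) ∷ ρ) * run κ g b ((v , c) ∷ ρ)))
        ≈⟨ Σ<-cong l (λ c _ → trans (arrSum-cong n W (λ { ρ ≡.refl →
             solve 6 (λ lw w a k b x → (lw :* w) :* (a :+ k :* (b :* x)) := (lw :* w) :* a :+ (k :* lw :* b) :* (w :* x)) refl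
               (letterWeight (suc n) (v , c)) (weightR ρ) (g ((v , c) ∷ ρ)) (𝟙 (kind l (suc n) (v , c) ≡ᵇ κ)) (𝟙 (below b v)) (run κ g (just v) ρ) }))
             (trans (arrSum-+ n W) (+-congˡ (trans (arrSum-* n W _) (*-assoc _ _ _))))) ⟩
      Σ< l (λ c → arrSum n W (λ ρ → weightR ((v , c) ∷ ρ) * g ((v , c) ∷ ρ))
                  + (𝟙 (kind l (suc n) (v , c) ≡ᵇ κ) * letterWeight (suc n) (v , c)) * (𝟙 (below b v) * wsum n W (run κ g (just v))))
        ≈⟨ trans (Σ<-+ l) (+-congˡ (Σ<-*ʳ l _)) ⟩
      Σ< l (λ c → arrSum n W (λ ρ → weightR ((v , c) ∷ ρ) * g ((v , c) ∷ ρ)))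
        + cw κ (suc n) v * (𝟙 (below b v) * wsum n W (run κ g (just v))) ∎
      where W = mid ++ post

  Ω : (List Letter → C) → List ℕ → C
  Ω g V = wsum (length V) V g

  -- `U` holds the values passed over so far. They exceed the last letter of the run, so only the
  -- values in `W` can continue it, and the run selects a sublist of `W`.
  run-split : ∀ n κ g b U W → length (U ++ W) ≡ n →
    All (λ u → below b u ≡ false) U → All (λ w → below b w ≡ true) W → All (λ u → All (u ℕ.>_) W) U → Desc W →
    wsum n (U ++ W) (run κ g b) ≈ splitSum W (λ S P → cws κ n S * Ω g (U ++ P))
  run-split zero    κ g b []      []      _   _   _   _   _ = sym (*-identityˡ _)
  run-split (suc n) κ g b U W len U≮ W< U>W d = begin
    wsum (suc n) (U ++ W) (run κ g b)
      ≈⟨ run-step κ g b n (U ++ W) ⟩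
    wsum (suc n) (U ++ W) g + firstSum (U ++ W) K
      ≈⟨ +-cong (trans (reflexive (≡.cong (λ k → wsum k (U ++ W) g) (≡.sym len))) (sym (*-identityˡ _)))
           (trans (firstSum-++ U W K) (trans (+-cong (firstSum-0 U K-U) (firstSum-cong W K-W)) (+-identityˡ _))) ⟩
    1# * Ω g (U ++ W) + firstSum W (λ mid v post → splitSum post (λ S P → cws κ (suc n) (v ∷ S) * Ω g (U ++ (mid ++ P))))
      ≈⟨ splitSum-first W (λ S P → cws κ (suc n) S * Ω g (U ++ P)) ⟨
    splitSum W (λ S P → cws κ (suc n) S * Ω g (U ++ P)) ∎
    where
    K : List ℕ → ℕ → List ℕ → C
    K mid v post = cw κ (suc n) v * (𝟙 (below b v) * wsum n (mid ++ post) (run κ g (just v)))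
    K-U : ∀ mid v post → mid ++ v ∷ post ≡ U → K mid v (post ++ W) ≈ 0#
    K-U mid v post ≡.refl with Allₚ.++⁻ʳ mid U≮
    ... | v≮ ∷ _ rewrite v≮ = trans (*-congˡ (zeroˡ _)) (zeroʳ _)
    K-W : ∀ mid v post → mid ++ v ∷ post ≡ W →
      K (U ++ mid) v post ≈ splitSum post (λ S P → cws κ (suc n) (v ∷ S) * Ω g (U ++ (mid ++ P)))
    K-W mid v post ≡.refl with Allₚ.++⁻ʳ mid W< | Desc-split mid d
    ... | v< ∷ _ | mid> , mid>post , v>post , d-post rewrite v< = begin
      cw κ (suc n) v * (1# * wsum n ((U ++ mid) ++ post) (run κ g (just v)))
        ≈⟨ *-congˡ (trans (*-identityˡ _) (run-split n κ g (just v) (U ++ mid) post len′ U≮′ W<′ U>W′ d-post)) ⟩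
      cw κ (suc n) v * splitSum post (λ S P → cws κ n S * Ω g ((U ++ mid) ++ P))
        ≈⟨ trans (sym (splitSum-* post _)) (splitSum-congʳ post (λ S P → trans (sym (*-assoc _ _ _))
             (*-congˡ (reflexive (≡.cong (Ω g) (Listₚ.++-assoc U mid P)))))) ⟩
      splitSum post (λ S P → cws κ (suc n) (v ∷ S) * Ω g (U ++ (mid ++ P))) ∎
      where
      len′ : length ((U ++ mid) ++ post) ≡ n
      len′ = ℕₚ.suc-injective (≡.trans (≡.trans (≡.sym (Listₚ.length-++-sucʳ (U ++ mid) v post))
        (≡.cong length (Listₚ.++-assoc U mid (v ∷ post)))) len)
      U≮′ : All (λ u → below (just v) u ≡ false) (U ++ mid)
      U≮′ = Allₚ.++⁺ (All.map (λ u> → <ᵇ-false (ℕₚ.<⇒≤ (All.head (Allₚ.++⁻ʳ mid u>)))) U>W)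
                     (All.map (<ᵇ-false ∘ ℕₚ.<⇒≤) mid>)
      W<′ : All (λ w → below (just v) w ≡ true) post
      W<′ = All.map <ᵇ-true v>post
      U>W′ : All (λ u → All (u ℕ.>_) post) (U ++ mid)
      U>W′ = Allₚ.++⁺ (All.map (λ u> → All.tail (Allₚ.++⁻ʳ mid u>)) U>W) mid>post

  Ω-run : ∀ κ g V → Desc V → Ω (run κ g nothing) V ≈ splitSum V (λ S U → cws κ (length V) S * Ω g U)
  Ω-run κ g V d = run-split (length V) κ g nothing [] V ≡.refl [] (All.universal (λ _ → ≡.refl) V) [] d

-- The letters of each type in a block

module Colors (R : CommutativeRing 0ℓ 0ℓ) (l′ : ℕ) (γ : ℕ → CommutativeRing.Carrier R) where
  open CommutativeRing R renaming (Carrier to C)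

  colors : ℕ → C
  colors zero    = 0#
  colors (suc j) = γ (suc l′ ℕ.∸ suc j) + colors j

  y : C
  y = colors l′

module Types (R : CommutativeRing 0ℓ 0ℓ) (l′ : ℕ)
  (T : CommutativeRing.Carrier R) (γ : ℕ → CommutativeRing.Carrier R) (r q : CommutativeRing.Carrier R) where
  open CommutativeRing R renaming (Carrier to C)
  open SetoidR setoid
  open CSG *-commutativeSemigroup using () renaming (x∙yz≈y∙xz to x*yz≈y*xz)
  open Exp semiring using (_^_)
  open Series R
  open Forms R
  open Splits R
  open Words R (suc l′) T γ r q
  open Colors R l′ γ

  l : ℕ
  l = suc l′


  private
    𝟙-select : ∀ n k (f : ℕ → C) → k ℕ.< n → Σ< n (λ a → 𝟙 (a ≡ᵇ k) * f a) ≈ f k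
    𝟙-select (suc n) zero    f _       = trans (+-cong (*-identityˡ _) (Σ<-0 n (λ a _ → zeroˡ _))) (+-identityʳ _)
    𝟙-select (suc n) (suc k) f (ℕ.s≤s k<n) = trans (+-cong (zeroˡ _) (𝟙-select n k (f ∘ suc) k<n)) (+-identityˡ _)

    colored-0 : ∀ κ → (∀ c → c ℕ.< l′ → l ℕ.∸ suc c ≢ κ) →
      Σ< l′ (λ c → 𝟙 (l ℕ.∸ suc c ≡ᵇ κ) * γ (suc c)) ≈ 0#
    colored-0 κ h = Σ<-0 l′ (λ c c< → trans (*-congʳ (reflexive (≡.cong 𝟙 (≡ᵇ-false (h c c<))))) (zeroˡ _))

  cw-bar : ∀ pos v → cw 0 pos v ≈ T * 𝟙 (pos <ᵇ v)
  cw-bar pos v = trans (+-cong (first (pos <ᵇ v) (v <ᵇ pos)) (colored-0 0 (λ c c< → ℕₚ.>⇒≢ (ℕₚ.m<n⇒0<n∸m c<)))) (+-identityʳ _)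
    where
    first : ∀ b b′ → 𝟙 ((if b then 0 else if b′ then l else suc l) ≡ᵇ 0) * (if b then T else if b′ then 1# else r) ≈ T * 𝟙 b
    first true  b′    = *-comm _ _
    first false true  = trans (zeroˡ _) (sym (zeroʳ _))
    first false false = trans (zeroˡ _) (sym (zeroʳ _))

  cw-color : ∀ j pos v → suc j ℕ.≤ l′ → cw (suc j) pos v ≈ γ (l ℕ.∸ suc j)
  cw-color j pos v j≤ = trans (+-cong (trans (*-congʳ (first (pos <ᵇ v) (v <ᵇ pos))) (zeroˡ _)) colored) (+-identityˡ _)
    where
    first : ∀ b b′ → 𝟙 ((if b then 0 else if b′ then l else suc l) ≡ᵇ suc j) ≈ 0#
    first true  b′    = refl
    first false true  = reflexive (≡.cong 𝟙 (≡ᵇ-false {l} {suc j} (ℕₚ.>⇒≢ (ℕ.s≤s j≤))))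
    first false false = reflexive (≡.cong 𝟙 (≡ᵇ-false {suc l} {suc j} (ℕₚ.>⇒≢ (ℕ.s≤s (ℕₚ.m<n⇒m<1+n j≤)))))
    shift : l′ ℕ.∸ j ≡ suc (l′ ℕ.∸ suc j)
    shift = ≡.trans (≡.sym (ℕₚ.suc-pred (l′ ℕ.∸ j) {{ℕ.>-nonZero (ℕₚ.m<n⇒0<n∸m j≤)}})) (≡.cong suc (ℕₚ.pred[m∸n]≡m∸[1+n] l′ j))
    index : ∀ c → c ℕ.< l′ → (l′ ℕ.∸ c ≡ᵇ suc j) ≡ (c ≡ᵇ l′ ℕ.∸ suc j)
    index c c< with c ℕ.≟ l′ ℕ.∸ suc j
    ... | yes ≡.refl rewrite ℕₚ.m∸[m∸n]≡n {l′} {suc j} j≤ | ≡ᵇ-refl (l′ ℕ.∸ suc j) = ≡ᵇ-refl j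
    ... | no  c≢ = ≡.trans (≡ᵇ-false {l′ ℕ.∸ c} {suc j} λ eq → c≢ (≡.trans (≡.sym (ℕₚ.m∸[m∸n]≡n {l′} {c} (ℕₚ.<⇒≤ c<))) (≡.cong (l′ ℕ.∸_) eq)))
                           (≡.sym (≡ᵇ-false c≢))
    colored : Σ< l′ (λ c → 𝟙 (l′ ℕ.∸ c ≡ᵇ suc j) * γ (suc c)) ≈ γ (l′ ℕ.∸ j)
    colored = begin
      Σ< l′ (λ c → 𝟙 (l′ ℕ.∸ c ≡ᵇ suc j) * γ (suc c))
        ≈⟨ Σ<-cong l′ (λ c c< → *-congʳ (reflexive (≡.cong 𝟙 (index c c<)))) ⟩
      Σ< l′ (λ c → 𝟙 (c ≡ᵇ l′ ℕ.∸ suc j) * γ (suc c))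
        ≈⟨ 𝟙-select l′ (l′ ℕ.∸ suc j) (γ ∘ suc) (ℕₚ.∸-monoʳ-< {l′} {suc j} {0} (ℕ.s≤s ℕ.z≤n) j≤) ⟩
      γ (suc (l′ ℕ.∸ suc j)) ≡⟨ ≡.cong γ shift ⟨
      γ (l′ ℕ.∸ j) ∎

  cw-plain : ∀ pos v → cw l pos v ≈ 𝟙 (v <ᵇ pos)
  cw-plain pos v = trans (+-cong (first (pos <ᵇ v) ≡.refl (v <ᵇ pos) ≡.refl)
    (colored-0 l (λ c c< → ℕₚ.<⇒≢ (ℕ.s≤s (ℕₚ.m∸n≤m l′ c))))) (+-identityʳ _)
    where
    first : ∀ b → (pos <ᵇ v) ≡ b → ∀ b′ → (v <ᵇ pos) ≡ b′ →
      𝟙 ((if b then 0 else if b′ then l else suc l) ≡ᵇ l) * (if b then T else if b′ then 1# else r) ≈ 𝟙 b′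
    first true  p true  p′ = ⊥-elim (contra (≡.trans (≡.sym p′) (<ᵇ-false (ℕₚ.<⇒≤ (ℕₚ.<ᵇ⇒< pos v (≡.subst Data.Bool.T (≡.sym p) _))))))
      where
      contra : true ≢ false
      contra ()
    first true  p false p′ = zeroˡ _
    first false p true  p′ = trans (*-identityʳ _) (reflexive (≡.cong 𝟙 (≡ᵇ-refl l′)))
    first false p false p′ = trans (*-congʳ (reflexive (≡.cong 𝟙 (≡ᵇ-false {l} {l′} ℕₚ.1+n≢n)))) (zeroˡ _)

  cw-fixed : ∀ pos v → cw (suc l) pos v ≈ r * 𝟙 (pos ≡ᵇ v)
  cw-fixed pos v = trans (+-cong first (colored-0 (suc l) (λ c c< → ℕₚ.<⇒≢ (ℕₚ.m<n⇒m<1+n (ℕ.s≤s (ℕₚ.m∸n≤m l′ c)))))) (+-identityʳ _)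
    where
    first : 𝟙 ((if pos <ᵇ v then 0 else if v <ᵇ pos then l else suc l) ≡ᵇ suc l) * (if pos <ᵇ v then T else if v <ᵇ pos then 1# else r)
            ≈ r * 𝟙 (pos ≡ᵇ v)
    first with ℕₚ.<-cmp pos v
    ... | tri< p ≢ _ rewrite <ᵇ-true p | ≡ᵇ-false ≢ = trans (zeroˡ _) (sym (zeroʳ r))
    ... | tri≈ _ ≡.refl _ rewrite <ᵇ-false (ℕₚ.≤-refl {pos}) | ≡ᵇ-refl l′ | ≡ᵇ-refl pos = *-comm _ _
    ... | tri> _ ≢ p rewrite <ᵇ-false (ℕₚ.<⇒≤ p) | <ᵇ-true p | ≡ᵇ-false ≢ | ≡ᵇ-false {l′} {l} (ℕₚ.<⇒≢ ℕₚ.≤-refl) = trans (zeroˡ _) (sym (zeroʳ r))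

  𝟙< : ∀ {a b} → a ℕ.< b → 𝟙 (a <ᵇ b) ≈ 1#
  𝟙< p = reflexive (≡.cong 𝟙 (<ᵇ-true p))

  𝟙≮ : ∀ {a b} → b ℕ.≤ a → 𝟙 (a <ᵇ b) ≈ 0#
  𝟙≮ p = reflexive (≡.cong 𝟙 (<ᵇ-false p))

  -- For a decreasing list of values at consecutive positions, the conditions on
  -- all the letters reduce to a condition that does not mention positions.
  cws-bar : ∀ p S → Desc S → cws 0 (length S ℕ.+ p) S ≈ prod (λ v → T * 𝟙 (suc p <ᵇ v)) S
  cws-bar p []          _                   = refl
  cws-bar p (v ∷ [])    _                   = *-congʳ (cw-bar (suc p) v)
  cws-bar p (v ∷ w ∷ S) ((v>w ∷ _) ∷ d) with suc (suc (length S) ℕ.+ p) ℕ.<? v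
  ... | yes n<v = *-cong (trans (cw-bar _ v) (*-congˡ (trans (𝟙< n<v)
                    (sym (𝟙< (ℕₚ.≤-trans (ℕ.s≤s (ℕ.s≤s (ℕₚ.m≤n+m p (suc (length S))))) n<v)))))) (cws-bar p (w ∷ S) d)
  -- Here v does not exceed its position. Then w < v does not exceed the next lower position either,
  -- and by induction the product over the tail vanishes on the right as well.
  ... | no  n≮v = trans (trans (*-congʳ (trans (cw-bar _ v) (trans (*-congˡ (𝟙≮ v≤n)) (zeroʳ T)))) (zeroˡ _))
                    (sym (trans (*-congˡ (trans (sym (cws-bar p (w ∷ S) d)) (trans (*-congʳ (trans (cw-bar _ w)
                      (trans (*-congˡ (𝟙≮ w≤n)) (zeroʳ T)))) (zeroˡ _)))) (zeroʳ _)))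
    where
    v≤n = ℕₚ.≮⇒≥ n≮v
    w≤n : w ℕ.≤ suc (length S) ℕ.+ p
    w≤n = ℕ.s≤s⁻¹ (ℕₚ.≤-trans v>w v≤n)

  -- Only the first letter matters: from letter to letter the position drops by one and the value by
  -- at least one.
  cws-plain : ∀ n S → Desc S → cws (suc l′) n S ≈ prod (λ v → 𝟙 (v <ᵇ n)) S
  cws-plain n []      _        = refl
  cws-plain n (v ∷ S) (v> ∷ d) with v ℕ.<? n
  ... | no  v≮n = trans (trans (*-congʳ (trans (cw-plain n v) (𝟙≮ (ℕₚ.≮⇒≥ v≮n)))) (zeroˡ _))
                    (sym (trans (*-congʳ (𝟙≮ (ℕₚ.≮⇒≥ v≮n))) (zeroˡ _)))
  cws-plain (suc n) (v ∷ S) (v> ∷ d) | yes (ℕ.s≤s v≤n) = *-cong (cw-plain (suc n) v) (trans (cws-plain n S d)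
    (prod-cong S (All.map (λ w<v → let w<n = ℕₚ.<-≤-trans w<v v≤n in trans (𝟙< w<n) (sym (𝟙< (ℕₚ.m<n⇒m<1+n w<n)))) v>)))

  cws-color : ∀ j n S → suc j ℕ.≤ l′ → cws (suc j) n S ≈ prod (λ _ → γ (suc l′ ℕ.∸ suc j)) S
  cws-color j n []      j≤ = refl
  cws-color j n (v ∷ S) j≤ = *-cong (cw-color j n v j≤) (cws-color j (ℕ.pred n) S j≤)

  -- The condition n - i < v ≤ n, written without truncated subtraction.
  isFixed : ℕ → ℕ → ℕ → Bool
  isFixed n i v = (n <ᵇ v ℕ.+ i) ∧ (v <ᵇ suc n)

  fixedWeight : ℕ → ℕ → ℕ → C
  fixedWeight n i v = r * 𝟙 (isFixed n i v)

  -- There is no room for i decreasing values in an interval of length less than i.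
  pigeonhole : ∀ n i v S → Desc (v ∷ S) → v ℕ.+ i ℕ.≤ n ℕ.+ length S → prod (fixedWeight n i) (v ∷ S) ≈ 0#
  pigeonhole n i v [] _ p = trans (*-congʳ (trans (*-congˡ (reflexive (≡.cong (λ b → 𝟙 (b ∧ (v <ᵇ suc n)))
    (<ᵇ-false (≡.subst (v ℕ.+ i ℕ.≤_) (ℕₚ.+-identityʳ n) p))))) (zeroʳ r))) (zeroˡ _)
  pigeonhole n i v (w ∷ S) ((v>w ∷ _) ∷ d) p = trans (*-congˡ (pigeonhole n i w S d
    (ℕ.s≤s⁻¹ (ℕₚ.≤-trans (ℕₚ.+-monoˡ-≤ i v>w) (≡.subst (v ℕ.+ i ℕ.≤_) (ℕₚ.+-suc n (length S)) p))))) (zeroʳ _)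

  cw-unfixed : ∀ n v → n ≢ v → cw (suc (suc l′)) n v ≈ 0#
  cw-unfixed n v ≢ = trans (cw-fixed n v) (trans (*-congˡ (reflexive (≡.cong 𝟙 (≡ᵇ-false ≢)))) (zeroʳ r))

  -- The right side only asks that the values lie in an interval with as many elements as the list.
  -- A decreasing list must then run through the interval, so each letter equals its position.
  cws-fixed : ∀ n S → Desc S → cws (suc (suc l′)) n S ≈ prod (fixedWeight n (length S)) S
  cws-fixed n []      _ = refl
  cws-fixed n (v ∷ S) (v> ∷ d) with ℕₚ.<-cmp v n
  ... | tri< v<n v≢n _ = trans (trans (*-congʳ (cw-unfixed n v (v≢n ∘ ≡.sym))) (zeroˡ _))
        (sym (pigeonhole n (suc (length S)) v S (v> ∷ d) (≡.subst (ℕ._≤ n ℕ.+ length S) (≡.sym (ℕₚ.+-suc v _)) (ℕₚ.+-monoˡ-≤ (length S) v<n))))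
  ... | tri> _ v≢n n<v = trans (trans (*-congʳ (cw-unfixed n v (v≢n ∘ ≡.sym))) (zeroˡ _))
        (sym (trans (*-congʳ (trans (*-congˡ (reflexive (≡.cong 𝟙 too-big))) (zeroʳ r))) (zeroˡ _)))
    where
    too-big : isFixed n (suc (length S)) v ≡ false
    too-big = ≡.trans (≡.cong ((n <ᵇ v ℕ.+ suc (length S)) ∧_) (<ᵇ-false n<v)) (Boolₚ.∧-zeroʳ _)
  cws-fixed zero (v ∷ S) (v> ∷ d) | tri≈ _ ≡.refl _ with S | v>
  ... | []    | _      = *-congʳ (cw-fixed 0 0)
  ... | _ ∷ _ | () ∷ _
  cws-fixed (suc n) (v ∷ S) (v> ∷ d) | tri≈ _ ≡.refl _ = *-cong
    (trans (cw-fixed (suc n) (suc n)) (*-congˡ (reflexive (≡.cong 𝟙 (≡.trans (≡ᵇ-refl n) (≡.sym v-fixed))))))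
    (trans (cws-fixed n S d) (prod-cong S (All.map (λ w<v → *-congˡ (reflexive (≡.cong 𝟙 (same w<v)))) v>)))
    where
    v-fixed : isFixed (suc n) (suc (length S)) (suc n) ≡ true
    v-fixed = ≡.cong₂ _∧_ (<ᵇ-true (ℕ.s≤s (ℕₚ.m<m+n n {suc (length S)} (ℕ.s≤s ℕ.z≤n)))) (<ᵇ-true (ℕₚ.≤-refl {suc (suc n)}))
    same : ∀ {w} → w ℕ.< suc n → isFixed n (length S) w ≡ isFixed (suc n) (suc (length S)) w
    same {w} w< = ≡.cong₂ _∧_ (≡.cong (suc n <ᵇ_) (≡.sym (ℕₚ.+-suc w (length S))))
      (≡.trans (<ᵇ-true w<) (≡.sym (<ᵇ-true (ℕₚ.m<n⇒m<1+n w<))))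

  -- The total weight of the value v over the types 0, ..., j, where p letters stand before the
  -- block.
  partialWeight : ℕ → ℕ → ℕ → C
  partialWeight zero    p v = T * 𝟙 (suc p <ᵇ v)
  partialWeight (suc j) p v = γ (suc l′ ℕ.∸ suc j) + partialWeight j p v

  -- Each type selects a sublist. The selections merge into one, because their conditions refer to
  -- positions only through the size of the final remainder.
  Ω-colors : ∀ j g V → j ℕ.≤ l′ → Desc V →
    Ω (cells (suc j) g) V ≈ splitSum V (λ S U → prod (partialWeight j (length U)) S * Ω (cells 0 g) U)
  Ω-colors zero g V _ d = trans (Ω-run 0 (cells 0 g) V d) (splitSum-cong V d λ S U s → *-congʳ
    (trans (reflexive (≡.cong (λ n → cws 0 n S) (≡.sym (Split.lengths s)))) (cws-bar (length U) S (Split.desc₁ s))))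
  Ω-colors (suc j) g V j≤ d = begin
    Ω (cells (suc (suc j)) g) V
      ≈⟨ Ω-run (suc j) (cells (suc j) g) V d ⟩
    splitSum V (λ S U → cws (suc j) (length V) S * Ω (cells (suc j) g) U)
      ≈⟨ splitSum-cong V d (λ S U s → *-cong (cws-color j (length V) S j≤)
           (Ω-colors j g U (ℕₚ.<⇒≤ j≤) (Split.desc₂ s))) ⟩
    splitSum V (λ S U → prod (λ _ → γ (suc l′ ℕ.∸ suc j)) S
                        * splitSum U (λ S′ U′ → prod (partialWeight j (length U′)) S′ * Ω (cells 0 g) U′))
      ≈⟨ splitSum-merge V _ (λ U′ → partialWeight j (length U′)) (Ω (cells 0 g)) ⟩
    splitSum V (λ S U → prod (partialWeight (suc j) (length U)) S * Ω (cells 0 g) U) ∎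

  Ω-plain : ∀ g V → Desc V → Ω (cells (suc (suc l′)) g) V ≈ splitSum V (λ S U →
    prod (λ v → 𝟙 (v <ᵇ length V) + partialWeight l′ (length U) v) S * (q ^ length U * Ω g U))
  Ω-plain g V d = begin
    Ω (cells (suc (suc l′)) g) V
      ≈⟨ Ω-run (suc l′) (cells (suc l′) g) V d ⟩
    splitSum V (λ S U → cws (suc l′) (length V) S * Ω (cells (suc l′) g) U)
      ≈⟨ splitSum-cong V d (λ S U s → *-cong (cws-plain (length V) S (Split.desc₁ s))
           (Ω-colors l′ g U ℕₚ.≤-refl (Split.desc₂ s))) ⟩
    splitSum V (λ S U → prod (λ v → 𝟙 (v <ᵇ length V)) S
                        * splitSum U (λ S′ U′ → prod (partialWeight l′ (length U′)) S′ * Ω (cells 0 g) U′))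
      ≈⟨ splitSum-merge V _ (λ U′ → partialWeight l′ (length U′)) (Ω (cells 0 g)) ⟩
    splitSum V (λ S U → prod (λ v → 𝟙 (v <ᵇ length V) + partialWeight l′ (length U) v) S * Ω (cells 0 g) U)
      ≈⟨ splitSum-congʳ V (λ S U → *-congˡ (end U)) ⟩
    splitSum V (λ S U → prod (λ v → 𝟙 (v <ᵇ length V) + partialWeight l′ (length U) v) S * (q ^ length U * Ω g U)) ∎
    where
    end : ∀ U → Ω (cells 0 g) U ≈ q ^ length U * Ω g U
    end U = trans (arrSum-cong (length U) U (λ ρ len → trans (*-congˡ (*-congʳ (reflexive (≡.cong (q ^_) len)))) (x*yz≈y*xz _ _ _)))
      (arrSum-* (length U) U (q ^ length U))

  Ω-block : ∀ s V → Desc V → Ω (E (suc s)) V ≈ splitSum V (λ S U →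
    prod (fixedWeight (length V) (length S)) S * splitSum U (λ S′ U′ →
      prod (λ v → 𝟙 (v <ᵇ length U) + partialWeight l′ (length U′) v) S′ * (q ^ length U′ * Ω (E s) U′)))
  Ω-block s V d = trans (Ω-run (suc (suc l′)) (cells (suc (suc l′)) (E s)) V d) (splitSum-cong V d λ S U s′ →
    *-cong (cws-fixed (length V) S (Split.desc₁ s′)) (Ω-plain (E s) U (Split.desc₂ s′)))

-- Words with prescribed block sizes

segment : ℕ → ℕ → List ℕ
segment p zero    = []
segment p (suc m) = suc (m ℕ.+ p) ∷ segment p m

segment-++ : ∀ p m k → segment p (k ℕ.+ m) ≡ segment (m ℕ.+ p) k ++ segment p m
segment-++ p m zero    = ≡.refl
segment-++ p m (suc k) = ≡.cong₂ _∷_ (≡.cong suc (ℕₚ.+-assoc k m p)) (segment-++ p m k)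

segment-> : ∀ p m → All (p ℕ.<_) (segment p m)
segment-> p zero    = []
segment-> p (suc m) = ℕ.s≤s (ℕₚ.m≤n+m p m) ∷ segment-> p m

segment-≤ : ∀ p m → All (ℕ._≤ m ℕ.+ p) (segment p m)
segment-≤ p zero    = []
segment-≤ p (suc m) = ℕₚ.≤-refl ∷ All.map ℕₚ.m≤n⇒m≤1+n (segment-≤ p m)

segment-desc : ∀ p m → Desc (segment p m)
segment-desc p zero    = []
segment-desc p (suc m) = All.map ℕ.s≤s (segment-≤ p m) ∷ segment-desc p m

length-segment : ∀ p m → length (segment p m) ≡ m
length-segment p zero    = ≡.refl
length-segment p (suc m) = ≡.cong suc (length-segment p m)

module Shapes (R : CommutativeRing 0ℓ 0ℓ) (l′ : ℕ)
  (T : CommutativeRing.Carrier R) (γ : ℕ → CommutativeRing.Carrier R) (r q : CommutativeRing.Carrier R) where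
  open CommutativeRing R renaming (Carrier to C)
  open SetoidR setoid
  open CSG *-commutativeSemigroup using () renaming (x∙yz≈y∙xz to x*yz≈y*xz)
  open Solver commutativeSemiring using (solve; _:=_; _:+_; _:*_; con)
  open Exp semiring using (_^_; ^-homo-*)
  open Series R
  open Forms R
  open Splits R
  open Words R (suc l′) T γ r q
  open Types R l′ T γ r q
  open Colors R l′ γ
  open Blocks T y
  open Path R q T y
  open FixedPoints r

  splitSum-anti : ∀ V n {f : ℕ → ℕ → List ℕ → List ℕ → C} →
    splitSum V (λ S U → anti n (λ i k → f i k S U)) ≈ anti n (λ i k → splitSum V (f i k))
  splitSum-anti []      n = refl
  splitSum-anti (v ∷ V) n {f} = trans (+-cong (splitSum-anti V n {λ i k S U → f i k (v ∷ S) U})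
    (splitSum-anti V n {λ i k S U → f i k S (v ∷ U)})) (sym (anti-+ n))

  anti-select : ∀ n a {x} (f : ℕ → ℕ → C) → a ℕ.≤ n → (∀ i k → i ℕ.+ k ≡ n → a ≡ i → x ≈ f i k) →
    x ≈ anti n (λ i k → 𝟙 (a ≡ᵇ i) * f i k)
  anti-select zero    zero    f _ h = trans (h 0 0 ≡.refl ≡.refl) (sym (*-identityˡ _))
  anti-select (suc n) zero    f _ h = trans (h 0 (suc n) ≡.refl ≡.refl) (sym (trans
    (+-cong (*-identityˡ _) (trans (anti-cong n (λ _ _ _ → zeroˡ _)) (anti-0 n))) (+-identityʳ _)))
  anti-select (suc n) (suc a) f (ℕ.s≤s a≤n) h = trans
    (anti-select n a (λ i k → f (suc i) k) a≤n (λ i k eq eq′ → h (suc i) k (≡.cong suc eq) (≡.cong suc eq′)))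
    (sym (trans (+-congʳ (zeroˡ _)) (+-identityˡ _)))

  -- The sum over the shapes of a word with s blocks: a block contains i fixed
  -- points and m other letters.
  shapeSum : ℕ → (List ℕ → List ℕ → C) → ℕ → C
  shapeSum zero    g = const (g [] [])
  shapeSum (suc s) g n = anti n (λ i k → anti k (λ m p → q ^ p * shapeSum s (λ is us → g (i ∷ is) (m ∷ us)) p))

  total : List ℕ → List ℕ → ℕ
  total is us = sum is ℕ.+ sum us

  total-∷ : ∀ i m is us → total (i ∷ is) (m ∷ us) ≡ i ℕ.+ (m ℕ.+ total is us)
  total-∷ i m is us = ≡.trans (ℕₚ.+-assoc i _ _) (≡.cong (i ℕ.+_) (≡.trans (≡.sym (ℕₚ.+-assoc (sum is) m _))
    (≡.trans (≡.cong (ℕ._+ sum us) (ℕₚ.+-comm (sum is) m)) (ℕₚ.+-assoc m _ _))))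

  shapeSum-cong : ∀ s n {f g} →
    (∀ is us → length is ≡ length us → total is us ≡ n → f is us ≈ g is us) → shapeSum s f n ≈ shapeSum s g n
  shapeSum-cong zero    zero    h = h [] [] ≡.refl ≡.refl
  shapeSum-cong zero    (suc n) h = refl
  shapeSum-cong (suc s) n       h = anti-cong n (λ { i k ≡.refl → anti-cong k (λ { m p ≡.refl → *-congˡ
    (shapeSum-cong s p (λ is us len tot → h (i ∷ is) (m ∷ us) (≡.cong suc len)
      (≡.trans (total-∷ i m is us) (≡.cong (λ p → i ℕ.+ (m ℕ.+ p)) tot)))) }) })

  shapeSum-* : ∀ s n c {g} → shapeSum s (λ is us → c * g is us) n ≈ c * shapeSum s g n
  shapeSum-* zero    zero    c = refl
  shapeSum-* zero    (suc n) c = sym (zeroʳ c)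
  shapeSum-* (suc s) n       c = trans (anti-cong n (λ i k _ → trans (anti-cong k (λ m p _ →
    trans (*-congˡ (shapeSum-* s p c)) (x*yz≈y*xz _ _ _))) (anti-*ˡ k c))) (anti-*ˡ n c)

  shapeSum-splitSum : ∀ s n V {g : List ℕ → List ℕ → List ℕ → List ℕ → C} →
    splitSum V (λ S U → shapeSum s (g S U) n) ≈ shapeSum s (λ is us → splitSum V (λ S U → g S U is us)) n
  shapeSum-splitSum zero    zero    V = refl
  shapeSum-splitSum zero    (suc n) V = splitSum-0 V
  shapeSum-splitSum (suc s) n       V = trans (splitSum-anti V n) (anti-cong n (λ i k _ →
    trans (splitSum-anti V k) (anti-cong k (λ m p _ → trans (splitSum-* V (q ^ p)) (*-congˡ
      (shapeSum-splitSum s p V))))))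

  block : List ℕ → ℕ → (ℕ → C) → (List ℕ → C) → C
  block V i w X = splitSum V (λ S U → 𝟙 (length S ≡ᵇ i) * (prod w S * X U))

  block-shapeSum : ∀ s n c V i w {g : List ℕ → List ℕ → List ℕ → C} →
    block V i w (λ U → c * shapeSum s (g U) n) ≈ c * shapeSum s (λ is us → block V i w (λ U → g U is us)) n
  block-shapeSum s n c V i w {g} = begin
    splitSum V (λ S U → 𝟙 (length S ≡ᵇ i) * (prod w S * (c * shapeSum s (g U) n)))
      ≈⟨ splitSum-congʳ V (λ S U → trans (solve 4 (λ a b c d → a :* (b :* (c :* d)) := c :* ((a :* b) :* d)) refl
           (𝟙 (length S ≡ᵇ i)) (prod w S) c (shapeSum s (g U) n)) (*-congˡ (sym (shapeSum-* s n _)))) ⟩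
    splitSum V (λ S U → c * shapeSum s (λ is us → 𝟙 (length S ≡ᵇ i) * prod w S * g U is us) n)
      ≈⟨ trans (splitSum-* V c) (*-congˡ (shapeSum-splitSum s n V)) ⟩
    c * shapeSum s (λ is us → splitSum V (λ S U → 𝟙 (length S ≡ᵇ i) * prod w S * g U is us)) n
      ≈⟨ *-congˡ (shapeSum-cong s n (λ is us _ _ → splitSum-congʳ V (λ S U → *-assoc _ _ _))) ⟩
    c * shapeSum s (λ is us → block V i w (λ U → g U is us)) n ∎

  block-anti : ∀ n V i w {x : ℕ → ℕ → List ℕ → C} →
    block V i w (λ U → anti n (λ a b → x a b U)) ≈ anti n (λ a b → block V i w (x a b))
  block-anti n V i w = trans (splitSum-congʳ V (λ S U → trans (*-congˡ (sym (anti-*ˡ n _))) (sym (anti-*ˡ n _))))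
    (splitSum-anti V n)

  -- The weight of the value v in a block of m unfixed letters at positions
  -- p + 1, …, p + m. The second disjuncts matter only for m = 0, where they extend
  -- the formulas for the values below and above the block.
  unfixedWeight : ℕ → ℕ → ℕ → C
  unfixedWeight p m v = T * 𝟙 ((suc p <ᵇ v) ∨ (m ℕ.+ p <ᵇ v)) + (y + 𝟙 ((v <ᵇ m ℕ.+ p) ∨ (v <ᵇ suc p)))

  partialWeight-y : ∀ p v → partialWeight l′ p v ≈ T * 𝟙 (suc p <ᵇ v) + y
  partialWeight-y p v = go l′
    where
    go : ∀ j → partialWeight j p v ≈ T * 𝟙 (suc p <ᵇ v) + colors j
    go zero    = sym (+-identityʳ _)
    go (suc j) = trans (+-congˡ (go j)) (solve 3 (λ a b c → a :+ (b :+ c) := b :+ (a :+ c)) refl _ _ _)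

  unfixedWeight-prod : ∀ p S → prod (λ v → 𝟙 (v <ᵇ length S ℕ.+ p) + partialWeight l′ p v) S
    ≈ prod (unfixedWeight p (length S)) S
  unfixedWeight-prod p []        = refl
  unfixedWeight-prod p S@(_ ∷ S′) = prod-cong S (All.universal same S)
    where
    n = suc (length S′ ℕ.+ p)
    or₁ : ∀ v → (suc p <ᵇ v) ∨ (n <ᵇ v) ≡ (suc p <ᵇ v)
    or₁ v with n ℕ.<? v
    ... | yes n<v rewrite <ᵇ-true n<v | <ᵇ-true (ℕₚ.≤-trans (ℕ.s≤s (ℕ.s≤s (ℕₚ.m≤n+m p (length S′)))) n<v) = ≡.refl
    ... | no  n≮v rewrite <ᵇ-false (ℕₚ.≮⇒≥ n≮v) = Boolₚ.∨-identityʳ _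
    or₂ : ∀ v → (v <ᵇ n) ∨ (v <ᵇ suc p) ≡ (v <ᵇ n)
    or₂ v with v ℕ.<? suc p
    ... | yes v<p rewrite <ᵇ-true v<p | <ᵇ-true (ℕₚ.<-≤-trans v<p (ℕ.s≤s (ℕₚ.m≤n+m p (length S′)))) = ≡.refl
    ... | no  v≮p rewrite <ᵇ-false (ℕₚ.≮⇒≥ v≮p) = Boolₚ.∨-identityʳ _
    same : ∀ v → 𝟙 (v <ᵇ n) + partialWeight l′ p v ≈ unfixedWeight p (suc (length S′)) v
    same v rewrite or₁ v | or₂ v = trans (+-congˡ (partialWeight-y p v))
      (solve 3 (λ a b c → a :+ (b :+ c) := b :+ (c :+ a)) refl _ _ _)

  fixedForm unfixedForm : List ℕ → List ℕ → ℕ → ℕ → C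
  fixedForm (i ∷ is) (m ∷ us) v = fixedWeight (total (i ∷ is) (m ∷ us)) i v ◂ fixedForm is us v
  fixedForm _        _        v = λ _ → 0#
  unfixedForm (i ∷ is) (m ∷ us) v = unfixedWeight (total is us) m v ◂ unfixedForm is us v
  -- The default is the weight of a value above all blocks, so `unfixedForm-above` holds at every
  -- index, also beyond the last column.
  unfixedForm _        _        v = λ _ → T + y

  forms : List ℕ → List ℕ → List ℕ → List ((ℕ → C) × (ℕ → C))
  forms is us = map (λ v → fixedForm is us v , unfixedForm is us v)

  -- A block selects one sublist of values for its fixed points and one for its other letters. The
  -- two split lemmas turn these selections into one new column in each group of variables, the
  -- unfixed letters first.
  Ω-shapes : ∀ s V → Desc V → Ω (E s) V ≈ shapeSum s (λ is us → M₂ is us (forms is us V)) (length V)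
  Ω-shapes zero    []      _ = refl
  Ω-shapes zero    (v ∷ V) _ = trans (arrSum-cong (suc (length V)) (v ∷ V) {λ ρ → weightR ρ * E 0 ρ} {λ _ → 0# * 0#} (λ { (x ∷ ρ) _ → trans (zeroʳ _) (sym (zeroˡ 0#)) }))
    (trans (arrSum-* (suc (length V)) (v ∷ V) 0# {λ _ → 0#}) (zeroˡ _))
  Ω-shapes (suc s) V d = begin
    Ω (E (suc s)) V
      ≈⟨ Ω-block s V d ⟩
    splitSum V (λ S U → prod (fixedWeight n (length S)) S * splitSum U (λ S′ U′ →
      prod (λ v → 𝟙 (v <ᵇ length U) + partialWeight l′ (length U′) v) S′ * (q ^ length U′ * Ω (E s) U′)))
      ≈⟨ splitSum-cong V d (λ S U sp → trans (*-congˡ (inner U (Split.desc₂ sp)))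
           (anti-select n (length S) (λ i k → prod (fixedWeight n i) S * rest k U)
             (≡.subst (length S ℕ.≤_) (Split.lengths sp) (ℕₚ.m≤m+n _ _))
             (λ { i k eq ≡.refl → *-congˡ (reflexive (≡.cong (λ k → rest k U)
               (ℕₚ.+-cancelˡ-≡ (length S) _ _ (≡.trans (Split.lengths sp) (≡.sym eq))))) }))) ⟩
    splitSum V (λ S U → anti n (λ i k → 𝟙 (length S ≡ᵇ i) * (prod (fixedWeight n i) S * rest k U)))
      ≈⟨ splitSum-anti V n ⟩
    anti n (λ i k → block V i (fixedWeight n i) (rest k))
      ≈⟨ anti-cong n (λ i k i+k → trans (block-anti k V i (fixedWeight n i)) (anti-cong k (λ m p m+p →
           trans (splitSum-congʳ V (λ S U → *-congˡ (*-congˡ (rest-term m p U))))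
           (trans (block-shapeSum s p (q ^ p) V i (fixedWeight n i)) (*-congˡ (shapeSum-cong s p (λ is us len tot →
             column i k m p i+k m+p is us tot))))))) ⟩
    shapeSum (suc s) (λ is us → M₂ is us (forms is us V)) n ∎
    where
    n = length V
    term : ℕ → ℕ → List ℕ → C
    term m p U = block U m (unfixedWeight p m) (λ U′ → q ^ p * shapeSum s (λ is us → M₂ is us (forms is us U′)) p)
    rest : ℕ → List ℕ → C
    rest k U = anti k (λ m p → term m p U)
    inner : ∀ U → Desc U → splitSum U (λ S′ U′ →
      prod (λ v → 𝟙 (v <ᵇ length U) + partialWeight l′ (length U′) v) S′ * (q ^ length U′ * Ω (E s) U′)) ≈ rest (length U) U
    inner U dU = trans (splitSum-cong U dU (λ S U′ sp →
      trans (*-cong (trans (reflexive (≡.cong (λ n → prod (λ v → 𝟙 (v <ᵇ n) + partialWeight l′ (length U′) v) S) (≡.sym (Split.lengths sp))))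
                           (unfixedWeight-prod (length U′) S))
                    (*-congˡ (Ω-shapes s U′ (Split.desc₂ sp))))
        (anti-select (length U) (length S)
          (λ m p → prod (unfixedWeight p m) S * (q ^ p * shapeSum s (λ is us → M₂ is us (forms is us U′)) p))
          (≡.subst (length S ℕ.≤_) (Split.lengths sp) (ℕₚ.m≤m+n _ _))
          (λ { m p eq ≡.refl → reflexive (≡.cong (λ p → prod (unfixedWeight p m) S * (q ^ p * shapeSum s (λ is us → M₂ is us (forms is us U′)) p))
            (ℕₚ.+-cancelˡ-≡ (length S) _ _ (≡.trans (Split.lengths sp) (≡.sym eq)))) }))))
      (splitSum-anti U (length U))
    rest-term : ∀ m p U → term m p U ≈ q ^ p * shapeSum s (λ is us →
      M₂ is (m ∷ us) (map (λ v → fixedForm is us v , unfixedWeight p m v ◂ unfixedForm is us v) U)) p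
    rest-term m p U = trans (block-shapeSum s p (q ^ p) U m (unfixedWeight p m))
      (*-congˡ (shapeSum-cong s p (λ is us _ _ → split-M₂-right m is us (unfixedWeight p m) (fixedForm is us) (unfixedForm is us) U)))
    column : ∀ i k m p → i ℕ.+ k ≡ n → m ℕ.+ p ≡ k → ∀ is us → total is us ≡ p →
      block V i (fixedWeight n i) (λ U → M₂ is (m ∷ us) (map (λ v → fixedForm is us v , unfixedWeight p m v ◂ unfixedForm is us v) U))
        ≈ M₂ (i ∷ is) (m ∷ us) (forms (i ∷ is) (m ∷ us) V)
    column i k m p i+k m+p is us ≡.refl = trans
      (split-M₂-left i is (m ∷ us) (fixedWeight n i) (fixedForm is us) (λ v → unfixedWeight p m v ◂ unfixedForm is us v) V)
      (reflexive (≡.cong (λ n → M₂ (i ∷ is) (m ∷ us) (map (λ v → fixedWeight n i v ◂ fixedForm is us v , unfixedForm (i ∷ is) (m ∷ us) v) V))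
        (≡.trans (≡.sym i+k) (≡.trans (≡.cong (i ℕ.+_) (≡.sym m+p)) (≡.sym (total-∷ i m is us))))))

  count-++ : ∀ X A B → count X (A ++ B) ≡ count X A ℕ.+ count X B
  count-++ X []      B = ≡.refl
  count-++ X (v ∷ A) B with X v
  ... | true  = ≡.cong suc (count-++ X A B)
  ... | false = count-++ X A B

  remove-++ : ∀ X A B → remove X (A ++ B) ≡ remove X A ++ remove X B
  remove-++ X []      B = ≡.refl
  remove-++ X (v ∷ A) B with X v
  ... | true  = remove-++ X A B
  ... | false = ≡.cong (v ∷_) (remove-++ X A B)

  prod-++ : ∀ f A B → prod f (A ++ B) ≈ prod f A * prod f B
  prod-++ f []      B = sym (*-identityˡ _)
  prod-++ f (v ∷ A) B = trans (*-congˡ (prod-++ f A B)) (sym (*-assoc _ _ _))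

  record Unaffected (X : ℕ → Bool) (A : List ℕ) : Set where
    field
      count≡  : count X A ≡ 0
      remove≡ : remove X A ≡ A
      prod≈   : prod (λ v → if X v then r else 1#) A ≈ 1#

  unaffected : ∀ X A → All (λ v → X v ≡ false) A → Unaffected X A
  unaffected X []      []       = record { count≡ = ≡.refl ; remove≡ = ≡.refl ; prod≈ = refl }
  unaffected X (v ∷ A) (p ∷ ps) = record { count≡ = c ; remove≡ = rm ; prod≈ = pr }
    where
    open Unaffected (unaffected X A ps)
    c : count X (v ∷ A) ≡ 0
    c rewrite p = count≡
    rm : remove X (v ∷ A) ≡ v ∷ A
    rm rewrite p = ≡.cong (v ∷_) remove≡
    pr : prod (λ v → if X v then r else 1#) (v ∷ A) ≈ 1#
    pr rewrite p = trans (*-identityˡ _) prod≈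

  record Affected (X : ℕ → Bool) (A : List ℕ) : Set where
    field
      count≡  : count X A ≡ length A
      remove≡ : remove X A ≡ []
      prod≈   : prod (λ v → if X v then r else 1#) A ≈ r ^ length A

  affected : ∀ X A → All (λ v → X v ≡ true) A → Affected X A
  affected X []      []       = record { count≡ = ≡.refl ; remove≡ = ≡.refl ; prod≈ = refl }
  affected X (v ∷ A) (p ∷ ps) = record { count≡ = c ; remove≡ = rm ; prod≈ = pr }
    where
    open Affected (affected X A ps)
    c : count X (v ∷ A) ≡ suc (length A)
    c rewrite p = ≡.cong suc count≡
    rm : remove X (v ∷ A) ≡ []
    rm rewrite p = remove≡
    pr : prod (λ v → if X v then r else 1#) (v ∷ A) ≈ r * r ^ length A
    pr rewrite p = *-congˡ prod≈

  unfixed : List ℕ → List ℕ → List ℕ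
  unfixed (i ∷ is) (m ∷ us) = segment (total is us) m ++ unfixed is us
  unfixed _        _        = []

  segment₀-++ : ∀ k m → segment 0 (k ℕ.+ m) ≡ segment m k ++ segment 0 m
  segment₀-++ k m = ≡.trans (segment-++ 0 m k) (≡.cong (λ p → segment p k ++ segment 0 m) (ℕₚ.+-identityʳ m))

  -- The fixed points of the first block in the list must be the `i` greatest values up to the
  -- total, so `M₂-forced` removes them with weight r^i. `A` collects the unfixed values of blocks
  -- already treated, which are too large to be fixed points of the remaining blocks.
  M₂-fixed : ∀ is us₀ us ψ A → length is ≡ length us₀ → All (total is us₀ ℕ.<_) A →
    M₂ is us (map (λ v → fixedForm is us₀ v , ψ v) (A ++ segment 0 (total is us₀)))
      ≈ r ^ sum is * M us (map ψ (A ++ unfixed is us₀))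
  M₂-fixed [] [] us ψ A _ _ = trans
    (M₂-[] us (map (λ v → fixedForm [] [] v , ψ v) (A ++ []))) (trans
    (reflexive (≡.cong (M us) (≡.sym (Listₚ.map-∘ {g = proj₂} {f = λ v → fixedForm [] [] v , ψ v} (A ++ []))))) (sym (*-identityˡ _)))
  M₂-fixed (i ∷ is) (m ∷ us₀) us ψ A len A> = begin
    M₂ (i ∷ is) us (map form (A ++ segment 0 n))
      ≡⟨ ≡.cong (λ S → M₂ (i ∷ is) us (map form (A ++ S))) n-split ⟩
    M₂ (i ∷ is) us (map form (A ++ (B ++ D₀)))
      ≈⟨ M₂-forced X r i is us (fixedForm is us₀) ψ (A ++ (B ++ D₀)) count-eq ⟩
    prod (λ v → if X v then r else 1#) (A ++ (B ++ D₀)) * M₂ is us (map form′ (remove X (A ++ (B ++ D₀))))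
      ≈⟨ *-cong prod-eq (reflexive (≡.cong (λ S → M₂ is us (map form′ S)) remove-eq)) ⟩
    r ^ i * M₂ is us (map form′ ((A ++ segment p m) ++ segment 0 p))
      ≈⟨ *-congˡ (M₂-fixed is us₀ us ψ (A ++ segment p m) (ℕₚ.suc-injective len) (Allₚ.++⁺ (All.map (ℕₚ.≤-<-trans p≤n) A>) (segment-> p m))) ⟩
    r ^ i * (r ^ sum is * M us (map ψ ((A ++ segment p m) ++ unfixed is us₀)))
      ≈⟨ sym (*-assoc _ _ _) ⟩
    r ^ i * r ^ sum is * M us (map ψ ((A ++ segment p m) ++ unfixed is us₀))
      ≈⟨ *-cong (sym (^-homo-* r i (sum is))) (reflexive (≡.cong (λ S → M us (map ψ S)) (Listₚ.++-assoc A _ _))) ⟩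
    r ^ sum (i ∷ is) * M us (map ψ (A ++ unfixed (i ∷ is) (m ∷ us₀))) ∎
    where
    n = total (i ∷ is) (m ∷ us₀)
    p = total is us₀
    n≡ : n ≡ i ℕ.+ (m ℕ.+ p)
    n≡ = total-∷ i m is us₀
    p≤n : p ℕ.≤ n
    p≤n = ≡.subst (p ℕ.≤_) (≡.sym n≡) (ℕₚ.≤-trans (ℕₚ.m≤n+m p m) (ℕₚ.m≤n+m (m ℕ.+ p) i))
    X = isFixed n i
    B = segment (m ℕ.+ p) i
    D₀ = segment 0 (m ℕ.+ p)
    form form′ : ℕ → (ℕ → C) × (ℕ → C)
    form v = fixedForm (i ∷ is) (m ∷ us₀) v , ψ v
    form′ v = fixedForm is us₀ v , ψ v
    n-split : segment 0 n ≡ B ++ D₀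
    n-split = ≡.trans (≡.cong (segment 0) n≡) (segment₀-++ i (m ℕ.+ p))
    uA : Unaffected X A
    uA = unaffected X A (All.map (λ {v} n<v → ≡.trans (≡.cong ((n <ᵇ v ℕ.+ i) ∧_) (<ᵇ-false n<v)) (Boolₚ.∧-zeroʳ (n <ᵇ v ℕ.+ i))) A>)
    uB : Affected X B
    uB = affected X B (All.zipWith (λ { {v} (v> , v≤) → ≡.cong₂ _∧_
      (<ᵇ-true (≡.subst (ℕ._< v ℕ.+ i) (≡.sym n≡) (≡.subst (i ℕ.+ (m ℕ.+ p) ℕ.<_) (ℕₚ.+-comm i v) (ℕₚ.+-monoʳ-< i v>))))
      (<ᵇ-true (ℕ.s≤s (≡.subst (v ℕ.≤_) (≡.sym n≡) v≤))) }) (segment-> (m ℕ.+ p) i , segment-≤ (m ℕ.+ p) i))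
    uD : Unaffected X D₀
    uD = unaffected X D₀ (All.map (λ {v} v≤ → ≡.cong (_∧ (v <ᵇ suc n)) (<ᵇ-false (≡.subst (v ℕ.+ i ℕ.≤_) (≡.sym n≡)
      (≡.subst (v ℕ.+ i ℕ.≤_) (ℕₚ.+-comm (m ℕ.+ p) i) (ℕₚ.+-monoˡ-≤ i (≡.subst (v ℕ.≤_) (ℕₚ.+-identityʳ _) v≤)))))) (segment-≤ 0 (m ℕ.+ p)))
    count-eq : count X (A ++ (B ++ D₀)) ≡ i
    count-eq = ≡.trans (count-++ X A _) (≡.trans (≡.cong₂ ℕ._+_ (Unaffected.count≡ uA) (≡.trans (count-++ X B D₀)
      (≡.cong₂ ℕ._+_ (≡.trans (Affected.count≡ uB) (length-segment _ i)) (Unaffected.count≡ uD)))) (ℕₚ.+-identityʳ i))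
    remove-eq : remove X (A ++ (B ++ D₀)) ≡ (A ++ segment p m) ++ segment 0 p
    remove-eq = ≡.trans (remove-++ X A _) (≡.trans (≡.cong₂ _++_ (Unaffected.remove≡ uA) (≡.trans (remove-++ X B D₀)
      (≡.cong₂ _++_ (Affected.remove≡ uB) (≡.trans (Unaffected.remove≡ uD) (segment₀-++ m p))))) (≡.sym (Listₚ.++-assoc A _ _)))
    prod-eq : prod (λ v → if X v then r else 1#) (A ++ (B ++ D₀)) ≈ r ^ i
    prod-eq = trans (prod-++ _ A _) (trans (*-cong (Unaffected.prod≈ uA) (trans (prod-++ _ B D₀)
      (*-cong (trans (Affected.prod≈ uB) (reflexive (≡.cong (r ^_) (length-segment _ i)))) (Unaffected.prod≈ uD))))
      (trans (*-identityˡ _) (*-identityʳ _)))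

  unfixedWeight-above : ∀ p m v → m ℕ.+ p ℕ.< v → unfixedWeight p m v ≈ T + y
  unfixedWeight-above p m v v>
    rewrite <ᵇ-true v> | <ᵇ-false (ℕₚ.<⇒≤ v>) | <ᵇ-false (ℕₚ.≤-<-trans (ℕₚ.m≤n+m p m) v>) | Boolₚ.∨-zeroʳ (suc p <ᵇ v)
    = +-cong (*-identityʳ T) (+-identityʳ y)

  unfixedWeight-below : ∀ p m v → v ℕ.≤ p → unfixedWeight p m v ≈ 1# + y
  unfixedWeight-below p m v v≤
    rewrite <ᵇ-false (ℕₚ.≤-trans v≤ (ℕₚ.n≤1+n p)) | <ᵇ-false (ℕₚ.≤-trans v≤ (ℕₚ.m≤n+m p m)) | <ᵇ-true (ℕ.s≤s v≤) | Boolₚ.∨-zeroʳ (v <ᵇ m ℕ.+ p)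
    = trans (+-cong (zeroʳ T) (+-comm y 1#)) (+-identityˡ _)

  unfixedWeight-first : ∀ p m → unfixedWeight p (suc (suc m)) (suc p) ≈ 1# + y
  unfixedWeight-first p m
    rewrite <ᵇ-false (ℕₚ.≤-refl {suc p}) | <ᵇ-false (ℕₚ.m≤n+m p (suc m))
          | <ᵇ-true {suc p} {suc (suc (m ℕ.+ p))} (ℕ.s≤s (ℕ.s≤s (ℕₚ.m≤n+m p m)))
    = trans (+-cong (zeroʳ T) (+-comm y 1#)) (+-identityˡ _)

  unfixedWeight-inner : ∀ p m v → suc p ℕ.< v → v ℕ.< m ℕ.+ p → unfixedWeight p m v ≈ 1# + (T + y)
  unfixedWeight-inner p m v v> v<
    rewrite <ᵇ-true v> | <ᵇ-true v<
    = solve 2 (λ T y → T :* con 1 :+ (y :+ con 1) := con 1 :+ (T :+ y)) refl T y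

  unfixedWeight-last : ∀ p m → unfixedWeight p (suc (suc m)) (suc (suc m) ℕ.+ p) ≈ T + y
  unfixedWeight-last p m
    rewrite <ᵇ-true {p} {suc (m ℕ.+ p)} (ℕ.s≤s (ℕₚ.m≤n+m p m)) | <ᵇ-false (ℕₚ.≤-refl {m ℕ.+ p}) | <ᵇ-false (ℕₚ.≤-trans (ℕₚ.m≤n+m p m) (ℕₚ.n≤1+n _))
    = +-cong (*-identityʳ T) (+-identityʳ y)

  unfixedWeight-single : ∀ p → unfixedWeight p 1 (suc p) ≈ y
  unfixedWeight-single p
    rewrite <ᵇ-false (ℕₚ.≤-refl {p}) = trans (+-cong (zeroʳ T) (+-identityʳ y)) (+-identityˡ y)

  ◂-cong : ∀ {c d f g} → c ≈ d → (∀ a → f a ≈ g a) → (c ◂ f) ≈F (d ◂ g)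
  ◂-cong p h zero    = p
  ◂-cong p h (suc a) = h a

  W-◂ : ∀ c → W 0 c ≈F (c ◂ (λ _ → T + y))
  W-◂ c zero    = refl
  W-◂ c (suc a) = refl

  unfixedForm-above : ∀ is us v → total is us ℕ.< v → ∀ a → unfixedForm is us v a ≈ T + y
  unfixedForm-above []       us       v v> a = refl
  unfixedForm-above (i ∷ is) []       v v> a = refl
  unfixedForm-above (i ∷ is) (m ∷ us) v v> a = go a
    where
    m+p≤ : m ℕ.+ total is us ℕ.≤ total (i ∷ is) (m ∷ us)
    m+p≤ = ≡.subst (m ℕ.+ total is us ℕ.≤_) (≡.sym (total-∷ i m is us)) (ℕₚ.m≤n+m _ i)
    go : ∀ a → unfixedForm (i ∷ is) (m ∷ us) v a ≈ T + y
    go zero    = unfixedWeight-above (total is us) m v (ℕₚ.≤-<-trans m+p≤ v>)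
    go (suc a) = unfixedForm-above is us v (ℕₚ.≤-<-trans (ℕₚ.≤-trans (ℕₚ.m≤n+m _ m) m+p≤) v>) a

  segment-forms : ∀ p m (ψ : ℕ → ℕ → C) → (∀ v → p ℕ.< v → ∀ a → ψ v a ≈ T + y) →
    Pointwise _≈F_ (map (λ v → unfixedWeight p m v ◂ ψ v) (segment p m)) (P 0 m)
  segment-forms p zero          ψ h = []
  segment-forms p (suc zero)    ψ h =
    (λ a → trans (◂-cong (unfixedWeight-single p) (h (suc p) ℕₚ.≤-refl) a) (sym (W-◂ y a))) ∷ []
  segment-forms p (suc (suc m)) ψ h =
    form (unfixedWeight-last p m) (ℕ.s≤s (ℕₚ.m≤n+m p (suc m))) ∷ inner m ℕₚ.≤-refl
    where
    form : ∀ {v c} → unfixedWeight p (suc (suc m)) v ≈ c → p ℕ.< v → (unfixedWeight p (suc (suc m)) v ◂ ψ v) ≈F W 0 c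
    form eq v> a = trans (◂-cong eq (h _ v>) a) (sym (W-◂ _ a))
    inner : ∀ j → j ℕ.≤ m → Pointwise _≈F_ (map (λ v → unfixedWeight p (suc (suc m)) v ◂ ψ v) (segment p (suc j)))
      (replicate j (full 0) ++ W 0 (1# + y) ∷ [])
    inner zero    _   = form (unfixedWeight-first p m) ℕₚ.≤-refl ∷ []
    inner (suc j) j<m = form (unfixedWeight-inner p (suc (suc m)) (suc (suc (j ℕ.+ p))) (ℕ.s≤s (ℕ.s≤s (ℕₚ.m≤n+m p j)))
      (ℕ.s≤s (ℕ.s≤s (ℕₚ.+-monoˡ-≤ p j<m)))) (ℕ.s≤s (ℕₚ.m≤n+m p (suc j))) ∷ inner j (ℕₚ.<⇒≤ j<m)

  blocks-heads : ∀ b us → All (λ f → f 0 ≈ 1# + y) (blocks (suc b) us)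
  blocks-heads b []       = []
  blocks-heads b (u ∷ us) = Allₚ.++⁺ (heads u) (blocks-heads (suc b) us)
    where
    heads : ∀ m → All (λ f → f 0 ≈ 1# + y) (P (suc b) m)
    heads zero          = []
    heads (suc zero)    = refl ∷ []
    heads (suc (suc m)) = refl ∷ Allₚ.++⁺ (Allₚ.replicate⁺ m refl) (refl ∷ [])

  add-heads : ∀ (c : ℕ → C) (ψ : ℕ → ℕ → C) V Fs → Pointwise _≈F_ (map ψ V) (map (_∘ suc) Fs) →
    All (λ f → f 0 ≈ 1# + y) Fs → All (λ v → c v ≈ 1# + y) V → Pointwise _≈F_ (map (λ v → c v ◂ ψ v) V) Fs
  add-heads c ψ []      []       []       []       []       = []
  add-heads c ψ (v ∷ V) (f ∷ Fs) (e ∷ es) (h ∷ hs) (d ∷ ds) =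
    (λ { zero → trans d (sym h) ; (suc a) → e a }) ∷ add-heads c ψ V Fs es hs ds

  unfixed-≤ : ∀ is us → All (ℕ._≤ total is us) (unfixed is us)
  unfixed-≤ []       us       = []
  unfixed-≤ (i ∷ is) []       = []
  unfixed-≤ (i ∷ is) (m ∷ us) = Allₚ.++⁺ (All.map (λ v≤ → ℕₚ.≤-trans v≤ m+p≤) (segment-≤ (total is us) m))
    (All.map (λ v≤ → ℕₚ.≤-trans v≤ (ℕₚ.≤-trans (ℕₚ.m≤n+m _ m) m+p≤)) (unfixed-≤ is us))
    where
    m+p≤ : m ℕ.+ total is us ℕ.≤ total (i ∷ is) (m ∷ us)
    m+p≤ = ≡.subst (m ℕ.+ total is us ℕ.≤_) (≡.sym (total-∷ i m is us)) (ℕₚ.m≤n+m _ i)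

  -- To the letters of a block, values below it have weight 1 + y and values above it T + y. These
  -- are the two constants of `W`, and within the block the exceptions at the two ends are those of
  -- `P`.
  unfixed-forms : ∀ is us → length is ≡ length us →
    Pointwise _≈F_ (map (unfixedForm is us) (unfixed is us)) (blocks 0 us)
  unfixed-forms []       []       _   = []
  unfixed-forms (i ∷ is) (m ∷ us) len = ≡.subst (λ fs → Pointwise _≈F_ fs (P 0 m ++ blocks 1 us))
    (≡.sym (Listₚ.map-++ (unfixedForm (i ∷ is) (m ∷ us)) (segment p m) (unfixed is us)))
    (PW.++⁺ (segment-forms p m (unfixedForm is us) (unfixedForm-above is us))
      (add-heads (unfixedWeight p m) (unfixedForm is us) (unfixed is us) (blocks 1 us)
        (≡.subst (Pointwise _≈F_ _) (≡.sym (tail-blocks 0 us)) (unfixed-forms is us (ℕₚ.suc-injective len)))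
        (blocks-heads 0 us) (All.map (unfixedWeight-below p m _) (unfixed-≤ is us))))
    where p = total is us

  -- Fixed points and other letters of a block carry the same variable z q^b, and the summand is a
  -- product of a function of `is` and one of `us`; hence a product of series.
  shapeSum-product : ∀ s g → shapeSum s (λ is us → r ^ sum is * g us) ≋ H s ⊛ 𝒮 s g
  shapeSum-product zero    g zero    = refl
  shapeSum-product zero    g (suc n) = sym (Z.*-identityˡ (const (g [])) (suc n))
  shapeSum-product (suc s) g n = begin
    anti n (λ i k → anti k (λ m p → q ^ p * shapeSum s (λ is us → r ^ (i ℕ.+ sum is) * g (m ∷ us)) p))
      ≈⟨ anti-cong n (λ i k _ → trans (anti-cong k (λ m p _ → trans (*-congˡ (trans (shapeSum-cong s p (λ is us _ _ →
           trans (*-congʳ (^-homo-* r i (sum is))) (*-assoc _ _ _))) (trans (shapeSum-* s p (r ^ i))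
             (*-congˡ (shapeSum-product s (λ us → g (m ∷ us)) p))))) (x*yz≈y*xz _ _ _))) (anti-*ˡ k (r ^ i))) ⟩
    (geometric ⊛ Γ (λ m → scale q (H s ⊛ 𝒮 s (λ us → g (m ∷ us))))) n
      ≈⟨ Z.*-congˡ {geometric} (Z.trans (Γ-cong (λ m → scale-⊛ q (H s) (𝒮 s (λ us → g (m ∷ us)))))
           (Γ-⊛ (scale q (H s)) (λ m → scale q (𝒮 s (λ us → g (m ∷ us)))))) n ⟩
    (geometric ⊛ (scale q (H s) ⊛ 𝒮 (suc s) g)) n
      ≈⟨ Z.*-assoc geometric (scale q (H s)) (𝒮 (suc s) g) n ⟨
    (H (suc s) ⊛ 𝒮 (suc s) g) n ∎

  Ω-F : ∀ s n → wsum n (segment 0 n) (E s) ≈ F s n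
  Ω-F s n = begin
    wsum n (segment 0 n) (E s)
      ≡⟨ ≡.cong (λ k → wsum k (segment 0 n) (E s)) (length-segment 0 n) ⟨
    Ω (E s) (segment 0 n)
      ≈⟨ Ω-shapes s (segment 0 n) (segment-desc 0 n) ⟩
    shapeSum s (λ is us → M₂ is us (forms is us (segment 0 n))) (length (segment 0 n))
      ≡⟨ ≡.cong (shapeSum s (λ is us → M₂ is us (forms is us (segment 0 n)))) (length-segment 0 n) ⟩
    shapeSum s (λ is us → M₂ is us (forms is us (segment 0 n))) n
      ≈⟨ shapeSum-cong s n (λ { is us len ≡.refl → trans (M₂-fixed is us us (unfixedForm is us) [] len [])
           (*-congˡ (M-cong us (unfixed-forms is us len))) }) ⟩
    shapeSum s (λ is us → r ^ sum is * M us (blocks 0 us)) n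
      ≈⟨ shapeSum-product s (λ us → M us (blocks 0 us)) n ⟩
    F s n ∎

-- The limit of infinitely many blocks

-- The exact negation of the condition under which a block may continue from one letter of the
-- reversed word to the next.
descent : ℕ → ℕ → ℕ → ℕ → Bool
descent κ v κ′ v′ = (κ <ᵇ κ′) ∨ ((κ ≡ᵇ κ′) ∧ not (v′ <ᵇ v))

-- The major index of a reversed word for the order by type, then value.
majR : ℕ → List Letter → ℕ
majR l []          = 0
majR l (x ∷ [])    = 0
majR l (x ∷ y ∷ ρ) =
  (if descent (kind l (suc (suc (length ρ))) x) (proj₁ x) (kind l (suc (length ρ)) y) (proj₁ y)
   then suc (length ρ) else 0) ℕ.+ majR l (y ∷ ρ)

kind-< : ∀ l pos x → kind l pos x ℕ.< suc (suc l)
kind-< l pos (v , suc c) = ℕ.s≤s (ℕₚ.≤-trans (ℕₚ.m∸n≤m l (suc c)) (ℕₚ.n≤1+n l))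
kind-< l pos (v , zero) with pos <ᵇ v | v <ᵇ pos
... | true  | _     = ℕ.s≤s ℕ.z≤n
... | false | true  = ℕₚ.n≤1+n (suc l)
... | false | false = ℕₚ.≤-refl

module Limit (R : CommutativeRing 0ℓ 0ℓ) (q : CommutativeRing.Carrier R) where
  open CommutativeRing R renaming (Carrier to C)
  open SetoidR setoid
  open Exp semiring using (_^_)
  open Solver commutativeSemiring using (solve; _:=_; _:+_; _:*_)
  open Series R
  open Splits R

  infix 4 _~[_]_
  -- Congruence modulo q^s.
  record _~[_]_ (x : C) (s : ℕ) (y : C) : Set where
    constructor _,_
    field
      quotient : C
      equality : x ≈ y + q ^ s * quotient

  ≈⇒~ : ∀ s {x y} → x ≈ y → x ~[ s ] y
  ≈⇒~ s p = 0# , trans p (sym (trans (+-congˡ (zeroʳ _)) (+-identityʳ _)))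

  ~-trans-≈ : ∀ {s x y w} → x ~[ s ] y → y ≈ w → x ~[ s ] w
  ~-trans-≈ (c , p) e = c , trans p (+-congʳ e)

  ≈-trans-~ : ∀ {s x y w} → x ≈ y → y ~[ s ] w → x ~[ s ] w
  ≈-trans-~ e (c , p) = c , trans e p

  ~-0 : ∀ x y → x ~[ 0 ] y
  ~-0 x y = - y + x , sym (trans (+-congˡ (*-identityˡ _)) (trans (sym (+-assoc _ _ _)) (trans (+-congʳ (-‿inverseʳ y)) (+-identityˡ x))))

  ~-+ : ∀ {s x y x′ y′} → x ~[ s ] y → x′ ~[ s ] y′ → x + x′ ~[ s ] y + y′
  ~-+ {s} {x} {y} {x′} {y′} (c , p) (c′ , p′) = c + c′ , trans (+-cong p p′)
    (solve 5 (λ y y′ q c c′ → (y :+ q :* c) :+ (y′ :+ q :* c′) := (y :+ y′) :+ q :* (c :+ c′)) refl y y′ (q ^ s) c c′)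

  ~-* : ∀ {s x y x′ y′} → x ~[ s ] y → x′ ~[ s ] y′ → x * x′ ~[ s ] y * y′
  ~-* {s} {x} {y} {x′} {y′} (c , p) (c′ , p′) = c * y′ + (y * c′ + q ^ s * (c * c′)) , trans (*-cong p p′)
    (solve 5 (λ y y′ q c c′ → (y :+ q :* c) :* (y′ :+ q :* c′) := y :* y′ :+ q :* (c :* y′ :+ (y :* c′ :+ q :* (c :* c′)))) refl y y′ (q ^ s) c c′)

  ~-*ˡ : ∀ {s x y} w → x ~[ s ] y → w * x ~[ s ] w * y
  ~-*ˡ {s} w = ~-* (≈⇒~ s refl)

  -- A nonempty remainder of the word brings a positive power of q; this is how one more level
  -- yields one more power of q in the congruence.
  ~-raise : ∀ k {s x y} → x ~[ s ] y → q ^ suc k * x ~[ suc s ] q ^ suc k * y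
  ~-raise k {s} {x} {y} (c , p) = q ^ k * c , trans (*-congˡ p)
    (solve 5 (λ Q k s y c → (Q :* k) :* (y :+ s :* c) := (Q :* k) :* y :+ (Q :* s) :* (k :* c)) refl q (q ^ k) (q ^ s) y c)

  ~-Σ : ∀ {s} n {f g} → (∀ a → f a ~[ s ] g a) → Σ< n f ~[ s ] Σ< n g
  ~-Σ {s} zero    h = ≈⇒~ s refl
  ~-Σ {s} (suc n) h = ~-+ (h 0) (~-Σ n (h ∘ suc))

  ~-anti : ∀ {s} n {f g} → (∀ i j → f i j ~[ s ] g i j) → anti n f ~[ s ] anti n g
  ~-anti zero    h = h 0 0
  ~-anti (suc n) h = ~-+ (h 0 (suc n)) (~-anti n (λ i j → h (suc i) j))

  ~-first : ∀ {s} V {f g} → (∀ mid v post → f mid v post ~[ s ] g mid v post) → firstSum V f ~[ s ] firstSum V g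
  ~-first {s} []      h = ≈⇒~ s refl
  ~-first {s} (v ∷ V) h = ~-+ (h [] v V) (~-first V (λ mid → h (v ∷ mid)))

module Verfahren (R : CommutativeRing 0ℓ 0ℓ) (l : ℕ)
  (T : CommutativeRing.Carrier R) (γ : ℕ → CommutativeRing.Carrier R) (r q : CommutativeRing.Carrier R)
  (e : ℕ → CommutativeRing.Carrier R) where
  open CommutativeRing R renaming (Carrier to C)
  open SetoidR setoid
  open Exp semiring using (_^_; ^-homo-*)
  open Solver commutativeSemiring using (solve; _:=_; _:+_; _:*_)
  open Series R
  open Splits R
  open Words R l T γ r q
  open Limit R q

  -- With e n = 1 / (q;q)_n, the value of MacMahon's sum for unboundedly many levels.
  E∞ : List Letter → C
  E∞ ρ = q ^ majR l ρ * e (length ρ)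

  ~-arrSum : ∀ {s} n V {f g} → (∀ ρ → f ρ ~[ s ] g ρ) → arrSum n V f ~[ s ] arrSum n V g
  ~-arrSum zero    V h = h []
  ~-arrSum (suc n) V h = ~-first V (λ mid v post → ~-Σ l (λ c → ~-arrSum n (mid ++ post) (λ ρ → h ((v , c) ∷ ρ))))

  -- The limit of cells κ (E s).
  cells∞ : ℕ → List Letter → C
  cells∞ κ []      = 1#
  cells∞ κ (x ∷ ρ) = (if kind l (suc (length ρ)) x <ᵇ κ then 1# else q ^ suc (length ρ)) * E∞ (x ∷ ρ)

  a : ℕ → C
  a n = wsum n (segment 0 n) (λ ρ → q ^ majR l ρ)

  module _ (e-0 : e 0 ≈ 1#) (e-suc : ∀ n → e (suc n) ≈ e n + q ^ suc n * e (suc n)) where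

    E-[] : ∀ s → E s [] ≈ 1#
    E-[] zero    = refl
    E-[] (suc s) = go (suc (suc l))
      where
      go : ∀ κ → cells κ (E s) [] ≈ 1#
      go zero    = trans (*-identityˡ _) (E-[] s)
      go (suc κ) = go κ

    -- The sequences b are divided by their last and least entry: if it is positive, 1 can be
    -- subtracted from all n + 1 entries; if it is 0, it is deleted.
    E∞-next : ∀ n m → q ^ suc n * (q ^ m * e (suc n)) + q ^ m * e n ≈ q ^ m * e (suc n)
    E∞-next n m = begin
      q ^ suc n * (q ^ m * e (suc n)) + q ^ m * e n
        ≈⟨ solve 4 (λ Q m e e′ → Q :* (m :* e) :+ m :* e′ := m :* (e′ :+ Q :* e)) refl (q ^ suc n) (q ^ m) (e (suc n)) (e n) ⟩
      q ^ m * (e n + q ^ suc n * e (suc n)) ≈⟨ *-congˡ (e-suc n) ⟨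
      q ^ m * e (suc n) ∎

    -- The letter x has been put on level 0. The next letter may stay on this level unless there is
    -- a descent, and in that case all remaining levels are positive; the resulting power of q is
    -- the contribution of this descent to `majR`.
    ~-run : ∀ s κ g → (∀ ρ → g ρ ~[ s ] cells∞ κ ρ) → ∀ x ρ → kind l (suc (length ρ)) x ≡ κ →
      run κ g (just (proj₁ x)) ρ ~[ s ] q ^ majR l (x ∷ ρ) * e (length ρ)
    ~-run s κ g h x [] eq = ~-trans-≈ (h []) (sym (trans (*-identityˡ _) e-0))
    ~-run s κ g h x (y ∷ ρ) ≡.refl with ℕₚ.<-cmp (kind l (suc (length ρ)) y) κ | h (y ∷ ρ) | ~-run s κ g h y ρ
    ... | tri< κ′<κ κ′≢κ _ | hy | _
      rewrite <ᵇ-true κ′<κ | ≡ᵇ-false κ′≢κ | <ᵇ-false (ℕₚ.<⇒≤ κ′<κ) | ≡ᵇ-false (κ′≢κ ∘ ≡.sym)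
      = ~-trans-≈ (~-+ hy (≈⇒~ s (zeroˡ _))) (trans (+-identityʳ _) (*-identityˡ _))
    ... | tri> _ κ′≢κ κ<κ′ | hy | _
      rewrite <ᵇ-false (ℕₚ.<⇒≤ κ<κ′) | ≡ᵇ-false κ′≢κ | <ᵇ-true κ<κ′
      = ~-trans-≈ (~-+ hy (≈⇒~ s (zeroˡ _))) (trans (+-identityʳ _)
          (trans (sym (*-assoc _ _ _)) (*-congʳ (sym (^-homo-* q (suc (length ρ)) (majR l (y ∷ ρ)))))))
    ... | tri≈ _ κ′≡κ _ | hy | ih
      rewrite κ′≡κ | <ᵇ-false (ℕₚ.≤-refl {κ}) | ≡ᵇ-refl κ with proj₁ y <ᵇ proj₁ x
    ... | true  = ~-trans-≈ (~-+ hy (≈-trans-~ (trans (*-identityˡ _) (*-identityˡ _)) (ih ≡.refl)))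
                    (E∞-next (length ρ) (majR l (y ∷ ρ)))
    ... | false = ~-trans-≈ (~-+ hy (≈⇒~ s (trans (*-identityˡ _) (zeroˡ _)))) (trans (+-identityʳ _)
          (trans (sym (*-assoc _ _ _)) (*-congʳ (sym (^-homo-* q (suc (length ρ)) (majR l (y ∷ ρ)))))))

    ~-cells : ∀ s → (∀ ρ → E s ρ ~[ s ] E∞ ρ) → ∀ κ ρ → cells κ (E s) ρ ~[ suc s ] cells∞ κ ρ
    ~-cells s h zero    []      = ≈⇒~ (suc s) (trans (*-identityˡ _) (E-[] s))
    ~-cells s h zero    (x ∷ ρ) = ~-raise (length ρ) (h (x ∷ ρ))
    ~-cells s h (suc κ) []      = ~-cells s h κ []
    ~-cells s h (suc κ) (x ∷ ρ) with ℕₚ.<-cmp (kind l (suc (length ρ)) x) κ | ~-cells s h κ (x ∷ ρ)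
      | ~-run (suc s) κ (cells κ (E s)) (~-cells s h κ) x ρ
    ... | tri< κ′<κ κ′≢κ _ | hx | _
      rewrite <ᵇ-true κ′<κ | ≡ᵇ-false κ′≢κ | <ᵇ-true (ℕₚ.m<n⇒m<1+n κ′<κ)
      = ~-trans-≈ (~-+ hx (≈⇒~ (suc s) (zeroˡ _))) (+-identityʳ _)
    ... | tri> _ κ′≢κ κ<κ′ | hx | _
      rewrite <ᵇ-false (ℕₚ.<⇒≤ κ<κ′) | ≡ᵇ-false κ′≢κ | <ᵇ-false κ<κ′
      = ~-trans-≈ (~-+ hx (≈⇒~ (suc s) (zeroˡ _))) (+-identityʳ _)
    ... | tri≈ _ ≡.refl _ | hx | hr
      rewrite <ᵇ-false (ℕₚ.≤-refl {κ}) | ≡ᵇ-refl κ | <ᵇ-true (ℕₚ.n<1+n κ)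
      = ~-trans-≈ (~-+ hx (≈-trans-~ (trans (*-identityˡ _) (*-identityˡ _)) (hr ≡.refl)))
          (trans (E∞-next (length ρ) (majR l (x ∷ ρ))) (sym (*-identityˡ _)))

    E~E∞ : ∀ s ρ → E s ρ ~[ s ] E∞ ρ
    E~E∞ zero    ρ       = ~-0 _ _
    E~E∞ (suc s) []      = ≈⇒~ (suc s) (trans (E-[] (suc s)) (sym (trans (*-identityˡ _) e-0)))
    E~E∞ (suc s) (x ∷ ρ) = ~-trans-≈ (~-cells s (E~E∞ s) (suc (suc l)) (x ∷ ρ))
      (trans (*-congʳ (reflexive (≡.cong (λ b → if b then 1# else q ^ suc (length ρ)) (<ᵇ-true (kind-< l (suc (length ρ)) x))))) (*-identityˡ _))

    wsum~a : ∀ s n → wsum n (segment 0 n) (E s) ~[ s ] e n * a n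
    wsum~a s n = ~-trans-≈ (~-arrSum n (segment 0 n) (λ ρ → ~-*ˡ (weightR ρ) (E~E∞ s ρ)))
      (trans (arrSum-cong n (segment 0 n) (λ { ρ ≡.refl → solve 3 (λ w m e → w :* (m :* e) := e :* (w :* m)) refl
        (weightR ρ) (q ^ majR l ρ) (e (length ρ)) })) (arrSum-* n (segment 0 n) (e n)))

-- From infinitely many blocks to the recurrence

module Recurrence (R : CommutativeRing 0ℓ 0ℓ) (l′ : ℕ)
  (T : CommutativeRing.Carrier R) (γ : ℕ → CommutativeRing.Carrier R) (r q : CommutativeRing.Carrier R)
  (e : ℕ → CommutativeRing.Carrier R) where
  open CommutativeRing R renaming (Carrier to C)
  open SetoidR setoid
  open Exp semiring using (_^_; ^-homo-*)
  open Solver commutativeSemiring using (solve; _:=_; _:+_; _:*_; con)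
  open GroupProps +-group using () renaming (∙-cancelʳ to +-cancelʳ)
  open RingProps ring using (-‿distribʳ-*)
  open Series R
  open Limit R q
  open Colors R l′ γ
  open Path R q T y using (σ; F₁-σ; β̂; const-+)

  1-q^ : ℕ → C
  1-q^ n = 1# + - (q ^ n)

  qfactorial : ℕ → C
  qfactorial zero    = 1#
  qfactorial (suc n) = qfactorial n * 1-q^ (suc n)

  binomial : ℕ → ℕ → C
  binomial n       zero    = 1#
  binomial zero    (suc k) = 0#
  binomial (suc n) (suc k) = binomial n k + q ^ suc k * binomial n (suc k)

  binomial-> : ∀ n k → n ℕ.< k → binomial n k ≈ 0#
  binomial-> zero    (suc k) _         = refl
  binomial-> (suc n) (suc k) (ℕ.s≤s p) = trans (+-cong (binomial-> n k p)
    (trans (*-congˡ (binomial-> n (suc k) (ℕₚ.m<n⇒m<1+n p))) (zeroʳ _))) (+-identityˡ _)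

  1-q^-+ : ∀ k j → 1-q^ k + q ^ k * 1-q^ j ≈ 1-q^ (k ℕ.+ j)
  1-q^-+ k j = begin
    1# + - Q + Q * (1# + - (q ^ j))     ≈⟨ +-congˡ (trans (distribˡ Q 1# (- (q ^ j))) (+-congʳ (*-identityʳ Q))) ⟩
    1# + - Q + (Q + Q * - (q ^ j))      ≈⟨ solve 4 (λ a b c d → a :+ b :+ (c :+ d) := a :+ (b :+ c) :+ d) refl 1# (- Q) Q (Q * - (q ^ j)) ⟩
    1# + (- Q + Q) + Q * - (q ^ j)      ≈⟨ +-cong (trans (+-congˡ (-‿inverseˡ Q)) (+-identityʳ 1#)) (sym (-‿distribʳ-* Q (q ^ j))) ⟩
    1# + - (Q * q ^ j)                  ≈⟨ +-congˡ (-‿cong (sym (^-homo-* q k j))) ⟩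
    1-q^ (k ℕ.+ j) ∎
    where Q = q ^ k

  -- The Pascal recursion of the binomials combined with (1 - q^k) + q^k (1 - q^j) = 1 - q^(k + j).
  binomial-factorial : ∀ k j → binomial (k ℕ.+ j) k * (qfactorial k * qfactorial j) ≈ qfactorial (k ℕ.+ j)
  binomial-factorial zero    j       = trans (*-identityˡ _) (*-identityˡ _)
  binomial-factorial (suc k) zero    = begin
    (binomial (k ℕ.+ 0) k + q ^ suc k * binomial (k ℕ.+ 0) (suc k)) * (qfactorial k * 1-q^ (suc k) * 1#)
      ≈⟨ *-congʳ (+-congˡ (trans (*-congˡ (binomial-> (k ℕ.+ 0) (suc k) (ℕ.s≤s (ℕₚ.≤-reflexive (ℕₚ.+-identityʳ k))))) (zeroʳ _))) ⟩
    (binomial (k ℕ.+ 0) k + 0#) * (qfactorial k * 1-q^ (suc k) * 1#)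
      ≈⟨ solve 3 (λ b f d → (b :+ con 0) :* (f :* d :* con 1) := b :* (f :* con 1) :* d) refl (binomial (k ℕ.+ 0) k) (qfactorial k) (1-q^ (suc k)) ⟩
    binomial (k ℕ.+ 0) k * (qfactorial k * qfactorial 0) * 1-q^ (suc k)
      ≈⟨ *-cong (binomial-factorial k 0) (reflexive (≡.cong 1-q^ (≡.cong suc (≡.sym (ℕₚ.+-identityʳ k))))) ⟩
    qfactorial (suc k ℕ.+ 0) ∎
  binomial-factorial (suc k) (suc j) = begin
    (B + Q * B′) * (fk * dk * (fj * dj))
      ≈⟨ solve 7 (λ B Q B′ fk dk fj dj → (B :+ Q :* B′) :* (fk :* dk :* (fj :* dj))
           := B :* (fk :* (fj :* dj)) :* dk :+ Q :* (B′ :* (fk :* dk :* fj) :* dj)) refl B Q B′ fk dk fj dj ⟩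
    B * (fk * (fj * dj)) * dk + Q * (B′ * (fk * dk * fj) * dj)
      ≈⟨ +-cong (*-congʳ (binomial-factorial k (suc j))) (*-congˡ (*-congʳ (trans
           (*-congʳ (reflexive (≡.cong (λ n → binomial n (suc k)) (ℕₚ.+-suc k j)))) (trans (binomial-factorial (suc k) j)
             (reflexive (≡.cong qfactorial (≡.sym (ℕₚ.+-suc k j)))))))) ⟩
    f * dk + Q * (f * dj)
      ≈⟨ solve 4 (λ f dk Q dj → f :* dk :+ Q :* (f :* dj) := f :* (dk :+ Q :* dj)) refl f dk Q dj ⟩
    f * (dk + Q * dj) ≈⟨ *-congˡ (1-q^-+ (suc k) (suc j)) ⟩
    qfactorial (suc k ℕ.+ suc j) ∎
    where
    B = binomial (k ℕ.+ suc j) k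
    B′ = binomial (k ℕ.+ suc j) (suc k)
    Q = q ^ suc k
    fk = qfactorial k
    fj = qfactorial j
    dk = 1-q^ (suc k)
    dj = 1-q^ (suc j)
    f = qfactorial (k ℕ.+ suc j)

  anti-Σ : ∀ n (f : ℕ → ℕ → C) → anti n f ≈ Σ< n (λ k → f k (n ℕ.∸ k)) + f n 0
  anti-Σ zero    f = sym (+-identityˡ _)
  anti-Σ (suc n) f = trans (+-congˡ (anti-Σ n (λ i → f (suc i)))) (sym (+-assoc _ _ _))

  module _ (inverse : ∀ n → qfactorial n * e n ≈ 1#)
    (separated : ∀ {x y} → (∀ s → Σ[ w ∈ C ] w ~[ s ] x × w ~[ s ] y) → x ≈ y) where

    e-0 : e 0 ≈ 1#
    e-0 = trans (sym (*-identityˡ _)) (inverse 0)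

    e-suc : ∀ n → e (suc n) ≈ e n + q ^ suc n * e (suc n)
    e-suc n = sym (begin
      e n + Q * e (suc n)                              ≈⟨ +-congʳ e-n ⟩
      1-q^ (suc n) * e (suc n) + Q * e (suc n)         ≈⟨ sym (distribʳ _ _ _) ⟩
      (1# + - Q + Q) * e (suc n)                       ≈⟨ *-congʳ (trans (+-assoc _ _ _) (trans (+-congˡ (-‿inverseˡ Q)) (+-identityʳ 1#))) ⟩
      1# * e (suc n)                                   ≈⟨ *-identityˡ _ ⟩
      e (suc n) ∎)
      where
      Q = q ^ suc n
      e-n : e n ≈ 1-q^ (suc n) * e (suc n)
      e-n = begin
        e n                                                ≈⟨ trans (sym (*-identityʳ _)) (*-congˡ (sym (inverse (suc n)))) ⟩
        e n * (qfactorial n * 1-q^ (suc n) * e (suc n))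
          ≈⟨ solve 4 (λ e f d e′ → e :* (f :* d :* e′) := (f :* e) :* (d :* e′)) refl (e n) (qfactorial n) (1-q^ (suc n)) (e (suc n)) ⟩
        qfactorial n * e n * (1-q^ (suc n) * e (suc n))    ≈⟨ trans (*-congʳ (inverse n)) (*-identityˡ _) ⟩
        1-q^ (suc n) * e (suc n) ∎

    open Verfahren R (suc l′) T γ r q e using (a; wsum~a)
    open Verfahren R (suc l′) T γ 1# q e using () renaming (a to a₁; wsum~a to wsum~a₁)
    open Path.FixedPoints R q T y r using (F; F-rec)
    open Path.FixedPoints R q T y 1# using () renaming (F to F₁)

    F~a : ∀ s n → F s n ~[ s ] e n * a n
    F~a s n = ≈-trans-~ (sym (Shapes.Ω-F R l′ T γ r q s n)) (wsum~a e-0 e-suc s n)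

    F₁~a : ∀ s n → F₁ s n ~[ s ] e n * a₁ n
    F₁~a s n = ≈-trans-~ (sym (Shapes.Ω-F R l′ T γ 1# q s n)) (wsum~a₁ e-0 e-suc s n)

    weaken : ∀ {s x y} → x ~[ suc s ] y → x ~[ s ] y
    weaken {s} (c , p) = q * c , trans p (+-congˡ (solve 3 (λ q s c → (q :* s) :* c := s :* (q :* c)) refl q (q ^ s) c))

    F-coefficient : ∀ s n → F (suc s) (suc n) + T * (q ^ n * F s n)
      ≈ q ^ suc n * F s (suc n) + r * F (suc s) n + (T + y) * anti n (λ k j → q ^ k * F s k * F₁ (suc s) j)
    F-coefficient s n = begin
      F (suc s) (suc n) + T * (q ^ n * F s n)
        ≈⟨ +-congˡ (sym (trans (z⊛-suc (const T ⊛ F̃) n) (const-⊛ T F̃ n))) ⟩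
      F (suc s) (suc n) + (z ⊛ (const T ⊛ F̃)) (suc n)
        ≈⟨ F-rec s (suc n) ⟩
      F̃ (suc n) + (const r ⊛ (z ⊛ F (suc s))) (suc n) + (z ⊛ (β̂ ⊛ (σ (suc s) ⊛ F̃))) (suc n)
        ≈⟨ +-cong (+-congˡ (trans (const-⊛ r (z ⊛ F (suc s)) (suc n)) (*-congˡ (z⊛-suc (F (suc s)) n))))
             (trans (z⊛-suc (β̂ ⊛ (σ (suc s) ⊛ F̃)) n) (trans (Z.*-congʳ {σ (suc s) ⊛ F̃} (λ i → sym (const-+ T y i)) n)
               (trans (const-⊛ (T + y) (σ (suc s) ⊛ F̃) n) (*-congˡ (trans (Z.*-congʳ {F̃} (λ i → sym (F₁-σ (suc s) i)) n)
                 (⊛-comm (F₁ (suc s)) F̃ n)))))) ⟩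
      q ^ suc n * F s (suc n) + r * F (suc s) n + (T + y) * anti n (λ k j → q ^ k * F s k * F₁ (suc s) j) ∎
      where
      F̃ = scale q (F s)
      module Z = CommutativeRing ring⟦z⟧

    -- For every s the coefficients of `F` turn the relation between s + 1 and s blocks into a
    -- congruence modulo q^s between the two sides, so `separated` makes them equal.
    e-recurrence : ∀ n → e (suc n) * a (suc n) + T * (q ^ n * (e n * a n))
      ≈ q ^ suc n * (e (suc n) * a (suc n)) + r * (e n * a n)
        + (T + y) * anti n (λ k j → q ^ k * (e k * a k) * (e j * a₁ j))
    e-recurrence n = separated λ s → _ , ~-+ (weaken (F~a (suc s) (suc n))) (~-*ˡ T (~-*ˡ (q ^ n) (F~a s n))) ,
      ≈-trans-~ (F-coefficient s n) (~-+ (~-+ (~-*ˡ (q ^ suc n) (F~a s (suc n))) (~-*ˡ r (weaken (F~a (suc s) n))))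
        (~-*ˡ (T + y) (~-anti n (λ k j → ~-* (~-*ˡ (q ^ k) (F~a s k)) (weaken (F₁~a (suc s) j))))))

    a₁-0 : a₁ 0 ≈ 1#
    a₁-0 = *-identityˡ 1#

    recurrence : ∀ n → a (suc n) ≈ (r + y * q ^ n) * a n
      + (T + y) * Σ< n (λ k → binomial n k * (q ^ k * (a k * a₁ (n ℕ.∸ k))))
    recurrence n = begin
      a (suc n)                                  ≈⟨ scale-back (a (suc n)) ⟨
      qfactorial n * (e n * a (suc n))           ≈⟨ *-congˡ scaled ⟩
      qfactorial n * (e n * ((r + y * q ^ n) * a n + (T + y) * S)) ≈⟨ scale-back _ ⟩
      (r + y * q ^ n) * a n + (T + y) * S ∎
      where
      S = Σ< n (λ k → binomial n k * (q ^ k * (a k * a₁ (n ℕ.∸ k))))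
      X = Σ< n (λ k → q ^ k * (e k * a k) * (e (n ℕ.∸ k) * a₁ (n ℕ.∸ k)))
      scale-back : ∀ x → qfactorial n * (e n * x) ≈ x
      scale-back x = trans (sym (*-assoc _ _ _)) (trans (*-congʳ (inverse n)) (*-identityˡ x))
      e-binomial : ∀ k j → e k * e j ≈ e (k ℕ.+ j) * binomial (k ℕ.+ j) k
      e-binomial k j = begin
        e k * e j
          ≈⟨ trans (sym (*-identityˡ _)) (*-congʳ (sym (inverse (k ℕ.+ j)))) ⟩
        qfactorial (k ℕ.+ j) * e (k ℕ.+ j) * (e k * e j)
          ≈⟨ *-congʳ (*-congʳ (sym (binomial-factorial k j))) ⟩
        binomial (k ℕ.+ j) k * (qfactorial k * qfactorial j) * e (k ℕ.+ j) * (e k * e j)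
          ≈⟨ solve 6 (λ b fk fj e ek ej → b :* (fk :* fj) :* e :* (ek :* ej) := e :* b :* ((fk :* ek) :* (fj :* ej)))
               refl (binomial (k ℕ.+ j) k) (qfactorial k) (qfactorial j) (e (k ℕ.+ j)) (e k) (e j) ⟩
        e (k ℕ.+ j) * binomial (k ℕ.+ j) k * ((qfactorial k * e k) * (qfactorial j * e j))
          ≈⟨ trans (*-congˡ (trans (*-cong (inverse k) (inverse j)) (*-identityˡ 1#))) (*-identityʳ _) ⟩
        e (k ℕ.+ j) * binomial (k ℕ.+ j) k ∎
      X≈ : X ≈ e n * S
      X≈ = trans (Σ<-cong n (λ k k<n → begin
        q ^ k * (e k * a k) * (e (n ℕ.∸ k) * a₁ (n ℕ.∸ k))
          ≈⟨ solve 5 (λ Q e a e′ a′ → Q :* (e :* a) :* (e′ :* a′) := (e :* e′) :* (Q :* (a :* a′))) refl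
               (q ^ k) (e k) (a k) (e (n ℕ.∸ k)) (a₁ (n ℕ.∸ k)) ⟩
        e k * e (n ℕ.∸ k) * (q ^ k * (a k * a₁ (n ℕ.∸ k)))
          ≈⟨ *-congʳ (trans (e-binomial k (n ℕ.∸ k)) (reflexive (≡.cong (λ m → e m * binomial m k) (ℕₚ.m+[n∸m]≡n (ℕₚ.<⇒≤ k<n))))) ⟩
        e n * binomial n k * (q ^ k * (a k * a₁ (n ℕ.∸ k)))
          ≈⟨ *-assoc _ _ _ ⟩
        e n * (binomial n k * (q ^ k * (a k * a₁ (n ℕ.∸ k)))) ∎)) (Σ<-* n (e n))
      scaled : e n * a (suc n) ≈ e n * ((r + y * q ^ n) * a n + (T + y) * S)
      scaled = +-cancelʳ (q ^ suc n * (e (suc n) * a (suc n)) + T * (q ^ n * (e n * a n))) _ _ (begin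
        e n * a (suc n) + (q ^ suc n * (e (suc n) * a (suc n)) + T * (q ^ n * (e n * a n)))
          ≈⟨ solve 5 (λ e e′ Q a t → e :* a :+ (Q :* (e′ :* a) :+ t) := (e :+ Q :* e′) :* a :+ t) refl (e n) (e (suc n)) (q ^ suc n) (a (suc n)) (T * (q ^ n * (e n * a n))) ⟩
        (e n + q ^ suc n * e (suc n)) * a (suc n) + T * (q ^ n * (e n * a n))
          ≈⟨ +-congʳ (*-congʳ (sym (e-suc n))) ⟩
        e (suc n) * a (suc n) + T * (q ^ n * (e n * a n))
          ≈⟨ e-recurrence n ⟩
        q ^ suc n * (e (suc n) * a (suc n)) + r * (e n * a n) + (T + y) * anti n (λ k j → q ^ k * (e k * a k) * (e j * a₁ j))
          -- The term k = n of the convolution is q^n e_n a_n, since e_0 and the initial value for r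
          -- = 1 are 1. With the factor T + y, its T part cancels against the left side and its y
          -- part becomes the summand y q^n of the coefficient of a_n.
          ≈⟨ +-congˡ (*-congˡ (trans (anti-Σ n _) (+-cong X≈ (*-congˡ (trans (*-cong e-0 a₁-0) (*-identityˡ 1#)))))) ⟩
        q ^ suc n * (e (suc n) * a (suc n)) + r * (e n * a n) + (T + y) * (e n * S + q ^ n * (e n * a n) * 1#)
          ≈⟨ solve 9 (λ Q′ e′ a′ r e a T y QS → let Q = QS in Q′ :* (e′ :* a′) :+ r :* (e :* a) :+ (T :+ y) :* Q
               := r :* (e :* a) :+ (T :+ y) :* Q :+ Q′ :* (e′ :* a′)) refl (q ^ suc n) (e (suc n)) (a (suc n)) r (e n) (a n) T y (e n * S + q ^ n * (e n * a n) * 1#) ⟩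
        r * (e n * a n) + (T + y) * (e n * S + q ^ n * (e n * a n) * 1#) + q ^ suc n * (e (suc n) * a (suc n))
          ≈⟨ solve 8 (λ r e a T y S Q w → r :* (e :* a) :+ (T :+ y) :* (e :* S :+ Q :* (e :* a) :* con 1) :+ w
               := e :* ((r :+ y :* Q) :* a :+ (T :+ y) :* S) :+ (w :+ T :* (Q :* (e :* a)))) refl r (e n) (a n) T y S (q ^ n) (q ^ suc n * (e (suc n) * a (suc n))) ⟩
        e n * ((r + y * q ^ n) * a n + (T + y) * S) + (q ^ suc n * (e (suc n) * a (suc n)) + T * (q ^ n * (e n * a n))) ∎)

-- The statistics on reversed words

module ReversedWords where
  open ≡ using (refl; sym; trans; cong; cong₂)
  open import Data.Nat using (_+_)
  open CSG ℕₚ.+-commutativeSemigroup using () renaming (x∙yz≈y∙xz to exchange)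

  majO excR fixR colorR : List Letter → ℕ
  majO []          = 0
  majO (x ∷ [])    = 0
  majO (x ∷ y ∷ ρ) = (if x ≺ y then suc (length ρ) else 0) + majO (y ∷ ρ)
  excR []          = 0
  excR (x ∷ ρ)     = b2n ((suc (length ρ) , 0) ≺ x) + excR ρ
  fixR []          = 0
  fixR (x ∷ ρ)     = b2n (x ≡L (suc (length ρ) , 0)) + fixR ρ
  colorR []        = 0
  colorR (x ∷ ρ)   = proj₂ x + colorR ρ

  majFrom-∷ʳ : ∀ j w x y →
    majFrom j (w ++ y ∷ x ∷ []) ≡ (if x ≺ y then j + length w else 0) + majFrom j (w ++ y ∷ [])
  majFrom-∷ʳ j []          x y = cong (λ k → (if x ≺ y then k else 0) + 0) (sym (ℕₚ.+-identityʳ j))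
  majFrom-∷ʳ j (a ∷ [])    x y = trans (cong ((if y ≺ a then j else 0) +_) (majFrom-∷ʳ (suc j) [] x y))
    (trans (cong (λ k → (if y ≺ a then j else 0) + ((if x ≺ y then k else 0) + 0)) (sym (ℕₚ.+-suc j 0)))
      (exchange (if y ≺ a then j else 0) (if x ≺ y then j + 1 else 0) 0))
  majFrom-∷ʳ j (a ∷ b ∷ w) x y = trans (cong ((if b ≺ a then j else 0) +_) (majFrom-∷ʳ (suc j) (b ∷ w) x y))
    (trans (cong (λ k → (if b ≺ a then j else 0) + ((if x ≺ y then k else 0) + majFrom (suc j) (b ∷ w ++ y ∷ [])))
             (sym (ℕₚ.+-suc j (suc (length w)))))
      (exchange (if b ≺ a then j else 0) (if x ≺ y then j + suc (suc (length w)) else 0) (majFrom (suc j) (b ∷ w ++ y ∷ []))))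

  excFrom-∷ʳ : ∀ j w x → excFrom j (w ++ x ∷ []) ≡ b2n ((j + length w , 0) ≺ x) + excFrom j w
  excFrom-∷ʳ j []      x = cong (λ k → b2n ((k , 0) ≺ x) + 0) (sym (ℕₚ.+-identityʳ j))
  excFrom-∷ʳ j (a ∷ w) x = trans (cong (b2n ((j , 0) ≺ a) +_) (excFrom-∷ʳ (suc j) w x))
    (trans (sym (ℕₚ.+-assoc (b2n ((j , 0) ≺ a)) _ _)) (trans (cong (_+ excFrom (suc j) w)
      (trans (ℕₚ.+-comm (b2n ((j , 0) ≺ a)) _) (cong (λ k → b2n ((k , 0) ≺ x) + b2n ((j , 0) ≺ a)) (sym (ℕₚ.+-suc j (length w))))))
      (ℕₚ.+-assoc (b2n ((j + suc (length w) , 0) ≺ x)) _ _)))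

  fixFrom-∷ʳ : ∀ j w x → fixFrom j (w ++ x ∷ []) ≡ b2n (x ≡L (j + length w , 0)) + fixFrom j w
  fixFrom-∷ʳ j []      x = cong (λ k → b2n (x ≡L (k , 0)) + 0) (sym (ℕₚ.+-identityʳ j))
  fixFrom-∷ʳ j (a ∷ w) x = trans (cong (b2n (a ≡L (j , 0)) +_) (fixFrom-∷ʳ (suc j) w x))
    (trans (sym (ℕₚ.+-assoc (b2n (a ≡L (j , 0))) _ _)) (trans (cong (_+ fixFrom (suc j) w)
      (trans (ℕₚ.+-comm (b2n (a ≡L (j , 0))) _) (cong (λ k → b2n (x ≡L (k , 0)) + b2n (a ≡L (j , 0))) (sym (ℕₚ.+-suc j (length w))))))
      (ℕₚ.+-assoc (b2n (x ≡L (j + suc (length w) , 0))) _ _)))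

  colorSum-∷ʳ : ∀ w x → colorSum (w ++ x ∷ []) ≡ proj₂ x + colorSum w
  colorSum-∷ʳ []      x = refl
  colorSum-∷ʳ (a ∷ w) x = trans (cong (proj₂ a +_) (colorSum-∷ʳ w x))
    (trans (sym (ℕₚ.+-assoc (proj₂ a) _ _)) (trans (cong (_+ colorSum w) (ℕₚ.+-comm (proj₂ a) _)) (ℕₚ.+-assoc (proj₂ x) _ _)))

  maj-reverse : ∀ ρ → maj (reverse ρ) ≡ majO ρ
  maj-reverse []          = refl
  maj-reverse (x ∷ [])    = refl
  maj-reverse (x ∷ y ∷ ρ) = trans (cong maj shape) (trans (majFrom-∷ʳ 1 (reverse ρ) x y)
    (cong₂ _+_ (cong (λ k → if x ≺ y then suc k else 0) (Listₚ.length-reverse ρ))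
      (trans (cong maj (sym (Listₚ.unfold-reverse y ρ))) (maj-reverse (y ∷ ρ)))))
    where
    shape : reverse (x ∷ y ∷ ρ) ≡ reverse ρ ++ y ∷ x ∷ []
    shape = trans (Listₚ.unfold-reverse x (y ∷ ρ)) (trans (cong (_++ x ∷ []) (Listₚ.unfold-reverse y ρ)) (Listₚ.++-assoc (reverse ρ) _ _))

  exc-reverse : ∀ ρ → exc (reverse ρ) ≡ excR ρ
  exc-reverse []      = refl
  exc-reverse (x ∷ ρ) = trans (cong exc (Listₚ.unfold-reverse x ρ)) (trans (excFrom-∷ʳ 1 (reverse ρ) x)
    (cong₂ _+_ (cong (λ k → b2n ((suc k , 0) ≺ x)) (Listₚ.length-reverse ρ)) (exc-reverse ρ)))

  fix-reverse : ∀ ρ → fix (reverse ρ) ≡ fixR ρ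
  fix-reverse []      = refl
  fix-reverse (x ∷ ρ) = trans (cong fix (Listₚ.unfold-reverse x ρ)) (trans (fixFrom-∷ʳ 1 (reverse ρ) x)
    (cong₂ _+_ (cong (λ k → b2n (x ≡L (suc k , 0))) (Listₚ.length-reverse ρ)) (fix-reverse ρ)))

  colorSum-reverse : ∀ ρ → colorSum (reverse ρ) ≡ colorR ρ
  colorSum-reverse []      = refl
  colorSum-reverse (x ∷ ρ) = trans (cong colorSum (Listₚ.unfold-reverse x ρ)) (trans (colorSum-∷ʳ (reverse ρ) x)
    (cong (proj₂ x +_) (colorSum-reverse ρ)))

  <ᵇ-flip : ∀ {a b} → a ≢ b → not (b <ᵇ a) ≡ (a <ᵇ b)
  <ᵇ-flip {a} {b} a≢b with ℕₚ.<-cmp a b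
  ... | tri< p _ _ rewrite <ᵇ-true p | <ᵇ-false (ℕₚ.<⇒≤ p) = refl
  ... | tri≈ _ p _ = ⊥-elim (a≢b p)
  ... | tri> _ _ p rewrite <ᵇ-true p | <ᵇ-false (ℕₚ.<⇒≤ p) = refl

  <ᵇ-∸ : ∀ {l c d} → c ℕ.≤ l → d ℕ.≤ l → (l ℕ.∸ c <ᵇ l ℕ.∸ d) ≡ (d <ᵇ c)
  <ᵇ-∸ {l} {c} {d} c≤ d≤ with d ℕ.<? c
  ... | yes d<c = trans (<ᵇ-true (ℕₚ.∸-monoʳ-< d<c c≤)) (sym (<ᵇ-true d<c))
  ... | no  d≮c = trans (<ᵇ-false (ℕₚ.∸-monoʳ-≤ l (ℕₚ.≮⇒≥ d≮c))) (sym (<ᵇ-false (ℕₚ.≮⇒≥ d≮c)))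

  ≡ᵇ-∸ : ∀ {l c d} → c ℕ.≤ l → d ℕ.≤ l → (l ℕ.∸ c ≡ᵇ l ℕ.∸ d) ≡ (c ≡ᵇ d)
  ≡ᵇ-∸ {l} {c} {d} c≤ d≤ with c ℕ.≟ d
  ... | yes refl = trans (≡ᵇ-refl (l ℕ.∸ c)) (sym (≡ᵇ-refl c))
  ... | no  c≢d  = trans (≡ᵇ-false (λ eq → c≢d (ℕₚ.∸-cancelˡ-≡ c≤ d≤ eq))) (sym (≡ᵇ-false c≢d))

  -- At the end of a run of excedances the color order has a descent and the order
  -- by type does not; the opposite happens before the run. The difference of the
  -- two major indices telescopes to the number of excedances.
  descent-change : ∀ l n x y → 1 ℕ.≤ l → proj₂ x ℕ.< l → proj₂ y ℕ.< l → proj₁ x ≢ proj₁ y →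
    (if x ≺ y then n else 0) + (if (suc n , 0) ≺ x then suc n else 0)
    ≡ (if descent (kind l (suc n) x) (proj₁ x) (kind l n y) (proj₁ y) then n else 0)
      + b2n ((suc n , 0) ≺ x) + (if (n , 0) ≺ y then n else 0)
  descent-change l n (v , suc c) (u , suc d) _ c< d< v≢u
    rewrite <ᵇ-∸ {l} {suc c} {suc d} (ℕₚ.<⇒≤ c<) (ℕₚ.<⇒≤ d<) | ≡ᵇ-∸ {l} {suc c} {suc d} (ℕₚ.<⇒≤ c<) (ℕₚ.<⇒≤ d<) | <ᵇ-flip v≢u
    = sym (ℕₚ.+-identityʳ _)
  descent-change l n (v , suc c) (u , zero) _ c< _ _ with ℕₚ.<-cmp n u
  ... | tri< n<u _ _ rewrite <ᵇ-true n<u | ≡ᵇ-false {l ℕ.∸ suc c} {0} (ℕₚ.>⇒≢ (ℕₚ.m<n⇒0<n∸m c<)) = ℕₚ.+-identityʳ n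
  ... | tri≈ _ refl _ rewrite <ᵇ-false (ℕₚ.≤-refl {n}) | <ᵇ-true (ℕ.s≤s (ℕₚ.m∸n≤m l (suc c))) = cong (_+ 0) (sym (ℕₚ.+-identityʳ n))
  ... | tri> _ _ u<n rewrite <ᵇ-false (ℕₚ.<⇒≤ u<n) | <ᵇ-true u<n | <ᵇ-true (ℕₚ.∸-monoʳ-< {l} {suc c} {0} (ℕ.s≤s ℕ.z≤n) (ℕₚ.<⇒≤ c<))
    = cong (_+ 0) (sym (ℕₚ.+-identityʳ n))
  descent-change l n (v , zero) (u , suc d) _ _ d< _ with ℕₚ.<-cmp (suc n) v
  ... | tri< n<v _ _ rewrite <ᵇ-true n<v | <ᵇ-true (ℕₚ.m<n⇒0<n∸m d<) = trans (sym (ℕₚ.+-comm n 1)) (sym (ℕₚ.+-identityʳ _))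
  ... | tri≈ _ refl _ rewrite <ᵇ-false (ℕₚ.≤-refl {suc n}) | <ᵇ-false (ℕₚ.≤-trans (ℕₚ.m∸n≤m l (suc d)) (ℕₚ.n≤1+n l))
    | ≡ᵇ-false {suc l} {l ℕ.∸ suc d} (ℕₚ.>⇒≢ (ℕ.s≤s (ℕₚ.m∸n≤m l (suc d)))) = refl
  ... | tri> _ _ v<n rewrite <ᵇ-false (ℕₚ.<⇒≤ v<n) | <ᵇ-true v<n | <ᵇ-false (ℕₚ.m∸n≤m l (suc d))
    | ≡ᵇ-false {l} {l ℕ.∸ suc d} (ℕₚ.>⇒≢ (ℕₚ.∸-monoʳ-< {l} {suc d} {0} (ℕ.s≤s ℕ.z≤n) (ℕₚ.<⇒≤ d<))) = refl
  descent-change l n (v , zero) (u , zero) 1≤l _ _ v≢u with ℕₚ.<-cmp (suc n) v | ℕₚ.<-cmp n u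
  ... | tri< n<v _ _ | tri< n<u _ _ rewrite <ᵇ-true n<v | <ᵇ-true n<u | <ᵇ-flip v≢u =
    trans (cong ((if v <ᵇ u then n else 0) +_) (sym (ℕₚ.+-comm n 1)))
      (trans (cong ((if v <ᵇ u then n else 0) +_) (ℕₚ.+-comm n 1)) (sym (ℕₚ.+-assoc (if v <ᵇ u then n else 0) 1 n)))
  ... | tri< n<v _ _ | tri≈ _ refl _ rewrite <ᵇ-true n<v | <ᵇ-false (ℕₚ.≤-refl {n}) | <ᵇ-false (ℕₚ.<⇒≤ (ℕₚ.<-trans (ℕₚ.n<1+n n) n<v)) =
    trans (sym (ℕₚ.+-comm n 1)) (sym (ℕₚ.+-identityʳ _))
  ... | tri< n<v _ _ | tri> _ _ u<n rewrite <ᵇ-true n<v | <ᵇ-false (ℕₚ.<⇒≤ u<n) | <ᵇ-true u<n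
    | <ᵇ-false (ℕₚ.<⇒≤ (ℕₚ.<-trans u<n (ℕₚ.<-trans (ℕₚ.n<1+n n) n<v))) | <ᵇ-true 1≤l =
    trans (sym (ℕₚ.+-comm n 1)) (sym (ℕₚ.+-identityʳ _))
  ... | tri≈ _ refl _ | tri< n<u _ _ rewrite <ᵇ-false (ℕₚ.≤-refl {suc n}) | <ᵇ-true n<u
    | <ᵇ-true (ℕₚ.≤∧≢⇒< n<u v≢u) = ℕₚ.+-identityʳ n
  ... | tri≈ _ refl _ | tri≈ _ refl _ rewrite <ᵇ-false (ℕₚ.≤-refl {n}) | <ᵇ-false (ℕₚ.n≤1+n n) | <ᵇ-false (ℕₚ.≤-refl {l})
    | ≡ᵇ-refl l | <ᵇ-true (ℕₚ.n<1+n n) = refl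
  ... | tri≈ _ refl _ | tri> _ _ u<n rewrite <ᵇ-false (ℕₚ.≤-refl {suc n}) | <ᵇ-false (ℕₚ.<⇒≤ u<n) | <ᵇ-true u<n
    | <ᵇ-false (ℕₚ.<⇒≤ (ℕₚ.m<n⇒m<1+n u<n)) | <ᵇ-false (ℕₚ.n≤1+n l) | ≡ᵇ-false {suc l} {l} ℕₚ.1+n≢n = refl
  ... | tri> _ _ v<n | tri< n<u _ _ rewrite <ᵇ-false (ℕₚ.<⇒≤ v<n) | <ᵇ-true v<n | <ᵇ-true n<u
    | <ᵇ-true (ℕₚ.≤-<-trans (ℕ.s≤s⁻¹ v<n) n<u) | ≡ᵇ-false {l} {0} (ℕₚ.>⇒≢ 1≤l) = ℕₚ.+-identityʳ n
  ... | tri> _ _ v<n | tri≈ _ refl _ rewrite <ᵇ-false (ℕₚ.<⇒≤ v<n) | <ᵇ-true v<n | <ᵇ-false (ℕₚ.≤-refl {n})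
    | <ᵇ-true (ℕₚ.≤∧≢⇒< (ℕ.s≤s⁻¹ v<n) v≢u) | <ᵇ-true (ℕₚ.n<1+n l) = cong (_+ 0) (sym (ℕₚ.+-identityʳ n))
  ... | tri> _ _ v<n | tri> _ _ u<n rewrite <ᵇ-false (ℕₚ.<⇒≤ v<n) | <ᵇ-true v<n | <ᵇ-false (ℕₚ.<⇒≤ u<n) | <ᵇ-true u<n
    | <ᵇ-false (ℕₚ.≤-refl {l}) | ≡ᵇ-refl l | <ᵇ-flip v≢u = sym (ℕₚ.+-identityʳ _)

  distinct-head : ∀ x y xs → distinct (x ∷ y ∷ xs) ≡ true → x ≢ y
  distinct-head x _ xs eq refl rewrite ≡ᵇ-refl x with () ← eq

  distinct-tail : ∀ x xs → distinct (x ∷ xs) ≡ true → distinct xs ≡ true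
  distinct-tail x xs eq with memb x xs
  ... | false = eq

  -- The sum of the local identities `descent-change`; the telescoping terms leave the one at the
  -- last position of the word.
  majO-majR : ∀ l x ρ → 1 ℕ.≤ l → All (λ x → proj₂ x ℕ.< l) (x ∷ ρ) → distinct (absVals (x ∷ ρ)) ≡ true →
    majO (x ∷ ρ) + (if (suc (length ρ) , 0) ≺ x then suc (length ρ) else 0) ≡ majR l (x ∷ ρ) + excR (x ∷ ρ)
  majO-majR l x [] _ _ _ with (1 , 0) ≺ x
  ... | true  = refl
  ... | false = refl
  majO-majR l x (y ∷ ρ) 1≤l (cx ∷ cy ∷ cs) dis = begin
    dO + majO (y ∷ ρ) + hx        ≡⟨ solve 3 (λ a b c → a :+ b :+ c := a :+ c :+ b) refl dO (majO (y ∷ ρ)) hx ⟩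
    dO + hx + majO (y ∷ ρ)        ≡⟨ cong (_+ majO (y ∷ ρ)) (descent-change l (suc (length ρ)) x y 1≤l cx cy
                                       (distinct-head (proj₁ x) (proj₁ y) (absVals ρ) dis)) ⟩
    dK + ex + hy + majO (y ∷ ρ)   ≡⟨ solve 4 (λ a b c d → a :+ b :+ c :+ d := a :+ b :+ (d :+ c)) refl dK ex hy (majO (y ∷ ρ)) ⟩
    dK + ex + (majO (y ∷ ρ) + hy) ≡⟨ cong (dK + ex +_) (majO-majR l y ρ 1≤l (cy ∷ cs) (distinct-tail (proj₁ x) (absVals (y ∷ ρ)) dis)) ⟩
    dK + ex + (majR l (y ∷ ρ) + excR (y ∷ ρ))
      ≡⟨ solve 4 (λ a b c d → a :+ b :+ (c :+ d) := a :+ c :+ (b :+ d)) refl dK ex (majR l (y ∷ ρ)) (excR (y ∷ ρ)) ⟩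
    dK + majR l (y ∷ ρ) + (ex + excR (y ∷ ρ)) ∎
    where
    open ≡.≡-Reasoning
    open +-*-Solver
    n = suc (length ρ)
    dO = if x ≺ y then n else 0
    dK = if descent (kind l (suc n) x) (proj₁ x) (kind l n y) (proj₁ y) then n else 0
    hx = if (suc n , 0) ≺ x then suc n else 0
    hy = if (n , 0) ≺ y then n else 0
    ex = b2n ((suc n , 0) ≺ x)

  not-excedance : ∀ n x → proj₁ x ℕ.≤ n → ((n , 0) ≺ x) ≡ false
  not-excedance n (v , zero)  v≤n = <ᵇ-false v≤n
  not-excedance n (v , suc c) v≤n = refl

  maj-exc : ∀ l ρ → 1 ℕ.≤ l → All (λ x → proj₁ x ℕ.≤ length ρ × proj₂ x ℕ.< l) ρ → distinct (absVals ρ) ≡ true →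
    maj (reverse ρ) ≡ majR l ρ + exc (reverse ρ)
  maj-exc l []      _   _   _   = refl
  maj-exc l (x ∷ ρ) 1≤l all dis = begin
    maj (reverse (x ∷ ρ))                  ≡⟨ maj-reverse (x ∷ ρ) ⟩
    majO (x ∷ ρ)                           ≡⟨ sym (ℕₚ.+-identityʳ _) ⟩
    -- The remaining telescoping term is 0: at the last position n no value exceeds n, so there is
    -- no excedance.
    majO (x ∷ ρ) + 0                       ≡⟨ cong (λ b → majO (x ∷ ρ) + (if b then suc (length ρ) else 0)) (not-excedance (suc (length ρ)) x (proj₁ (All.head all))) ⟨
    majO (x ∷ ρ) + (if (suc (length ρ) , 0) ≺ x then suc (length ρ) else 0)
                                           ≡⟨ majO-majR l x ρ 1≤l (All.map proj₂ all) dis ⟩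
    majR l (x ∷ ρ) + excR (x ∷ ρ)          ≡⟨ cong (majR l (x ∷ ρ) +_) (exc-reverse (x ∷ ρ)) ⟨
    majR l (x ∷ ρ) + exc (reverse (x ∷ ρ)) ∎
    where open ≡.≡-Reasoning

open ReversedWords

-- Enumerating colored permutations

memb-++ : ∀ x xs ys → memb x (xs ++ ys) ≡ memb x xs ∨ memb x ys
memb-++ x []       ys = ≡.refl
memb-++ x (y ∷ xs) ys = ≡.trans (≡.cong ((x ≡ᵇ y) ∨_) (memb-++ x xs ys)) (≡.sym (Boolₚ.∨-assoc (x ≡ᵇ y) _ _))

≡ᵇ-sym : ∀ a b → (a ≡ᵇ b) ≡ (b ≡ᵇ a)
≡ᵇ-sym zero    zero    = ≡.refl
≡ᵇ-sym zero    (suc b) = ≡.refl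
≡ᵇ-sym (suc a) zero    = ≡.refl
≡ᵇ-sym (suc a) (suc b) = ≡ᵇ-sym a b

distinct-∷ʳ : ∀ xs x → distinct (xs ++ x ∷ []) ≡ not (memb x xs) ∧ distinct xs
distinct-∷ʳ []       x = ≡.refl
distinct-∷ʳ (y ∷ xs) x rewrite memb-++ y xs (x ∷ []) | distinct-∷ʳ xs x | ≡ᵇ-sym x y =
  lemma (memb y xs) (y ≡ᵇ x) (memb x xs) (distinct xs)
  where
  lemma : ∀ a b c d → not (a ∨ (b ∨ false)) ∧ (not c ∧ d) ≡ not (b ∨ c) ∧ (not a ∧ d)
  lemma false false false d = ≡.refl
  lemma false false true  d = ≡.refl
  lemma false true  c     d = ≡.refl
  lemma true  false false d = ≡.refl
  lemma true  false true  d = ≡.refl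
  lemma true  true  c     d = ≡.refl

memb-reverse : ∀ x xs → memb x (reverse xs) ≡ memb x xs
memb-reverse x []       = ≡.refl
memb-reverse x (y ∷ xs) rewrite Listₚ.unfold-reverse y xs | memb-++ x (reverse xs) (y ∷ []) | memb-reverse x xs
  | Boolₚ.∨-identityʳ (x ≡ᵇ y) = Boolₚ.∨-comm (memb x xs) (x ≡ᵇ y)

distinct-reverse : ∀ xs → distinct (reverse xs) ≡ distinct xs
distinct-reverse []       = ≡.refl
distinct-reverse (x ∷ xs) rewrite Listₚ.unfold-reverse x xs | distinct-∷ʳ (reverse xs) x | memb-reverse x xs | distinct-reverse xs = ≡.refl

absVals-reverse : ∀ w → distinct (absVals (reverse w)) ≡ distinct (absVals w)
absVals-reverse w = ≡.trans (≡.cong distinct (Listₚ.reverse-map _ w)) (distinct-reverse (absVals w))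

Desc-remove : ∀ mid {v post} → Desc (mid ++ v ∷ post) → Desc (mid ++ post)
Desc-remove []        (_ ∷ d)  = d
Desc-remove (w ∷ mid) (w> ∷ d) = Allₚ.++⁺ (Allₚ.++⁻ˡ mid w>) (All.tail (Allₚ.++⁻ʳ mid w>)) ∷ Desc-remove mid d

all-reverse : ∀ {P : Letter → Set} {w} → All P w → All P (reverse w)
all-reverse []                   = []
all-reverse {P} (_∷_ {x} {w} p ps) = ≡.subst (All P) (≡.sym (Listₚ.unfold-reverse x w)) (Allₚ.++⁺ (all-reverse ps) (p ∷ []))

all-letters : ∀ n l → All (λ x → proj₁ x ℕ.≤ n × proj₂ x ℕ.< l) (letters n l)
all-letters n l = Allₚ.concat⁺ (Allₚ.map⁺ (Allₚ.applyUpTo⁺₁ id n (λ v< →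
  Allₚ.map⁺ (Allₚ.applyUpTo⁺₁ id l (λ c< → v< , c<)))))

all-wordsOf : ∀ {P : Letter → Set} A m → All P A → All (λ w → length w ≡ m × All P w) (wordsOf A m)
all-wordsOf A zero    ps = (≡.refl , []) ∷ []
all-wordsOf {P} A (suc m) ps = Allₚ.concat⁺ (Allₚ.map⁺ (All.map (λ p →
  Allₚ.map⁺ (All.map (λ { (len , qs) → ≡.cong suc len , p ∷ qs }) (all-wordsOf A m ps))) ps))

all-filt : ∀ {X : Set} {P : X → Set} p xs → All P xs → All (λ x → P x × p x ≡ true) (filt p xs)
all-filt p []       []       = []
all-filt p (x ∷ xs) (q ∷ qs) with p x in eq
... | true  = (q , eq) ∷ all-filt p xs qs
... | false = all-filt p xs qs

Permutation : ℕ → ℕ → List Letter → Set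
Permutation l n w = (length w ≡ n × All (λ x → proj₁ x ℕ.≤ n × proj₂ x ℕ.< l) w) × distinct (absVals w) ≡ true

all-colPerms : ∀ l n → All (Permutation l n) (colPerms l n)
all-colPerms l n = all-filt _ (wordsOf (letters n l) n) (all-wordsOf (letters n l) n (all-letters n l))

maj-exc-majR : ∀ l n w → 1 ℕ.≤ l → Permutation l n w → maj w ≡ majR l (reverse w) ℕ.+ exc w
maj-exc-majR l n w 1≤l ((len , all) , dis) = ≡.subst (λ w′ → maj w′ ≡ majR l (reverse w) ℕ.+ exc w′) (Listₚ.reverse-involutive w)
  (maj-exc l (reverse w) 1≤l (all-reverse (≡.subst (λ n → All (λ x → proj₁ x ℕ.≤ n × proj₂ x ℕ.< l) w) n≡ all))
    (≡.trans (absVals-reverse w) dis))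
  where
  n≡ : n ≡ length (reverse w)
  n≡ = ≡.trans (≡.sym len) (≡.sym (Listₚ.length-reverse w))

module ListSum (R : CommutativeRing 0ℓ 0ℓ) where
  open CommutativeRing R renaming (Carrier to C)
  open SetoidR setoid
  open CSG +-commutativeSemigroup using () renaming (interchange to +-interchange)
  open Series R
  open Splits R

  ∑ : {X : Set} → List X → (X → C) → C
  ∑ []       f = 0#
  ∑ (x ∷ xs) f = f x + ∑ xs f

  ∑-congAll : ∀ {X : Set} {xs : List X} {f g} → All (λ x → f x ≈ g x) xs → ∑ xs f ≈ ∑ xs g
  ∑-congAll []       = refl
  ∑-congAll (p ∷ ps) = +-cong p (∑-congAll ps)

  ∑-cong : ∀ {X : Set} (xs : List X) {f g} → (∀ x → f x ≈ g x) → ∑ xs f ≈ ∑ xs g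
  ∑-cong xs h = ∑-congAll (All.universal h xs)

  ∑-++ : ∀ {X : Set} (xs ys : List X) {f} → ∑ (xs ++ ys) f ≈ ∑ xs f + ∑ ys f
  ∑-++ []       ys = sym (+-identityˡ _)
  ∑-++ (x ∷ xs) ys = trans (+-congˡ (∑-++ xs ys)) (sym (+-assoc _ _ _))

  ∑-map : ∀ {X Y : Set} (h : X → Y) xs {f} → ∑ (map h xs) f ≈ ∑ xs (f ∘ h)
  ∑-map h []       = refl
  ∑-map h (x ∷ xs) = +-congˡ (∑-map h xs)

  ∑-concatMap : ∀ {X Y : Set} (h : X → List Y) xs {f} → ∑ (concatMap h xs) f ≈ ∑ xs (λ x → ∑ (h x) f)
  ∑-concatMap h []       = refl
  ∑-concatMap h (x ∷ xs) = trans (∑-++ (h x) (concatMap h xs)) (+-congˡ (∑-concatMap h xs))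

  ∑-0 : ∀ {X : Set} (xs : List X) → ∑ xs (λ _ → 0#) ≈ 0#
  ∑-0 []       = refl
  ∑-0 (x ∷ xs) = trans (+-identityˡ _) (∑-0 xs)

  ∑-+ : ∀ {X : Set} (xs : List X) {f g} → ∑ xs (λ x → f x + g x) ≈ ∑ xs f + ∑ xs g
  ∑-+ []       = sym (+-identityˡ _)
  ∑-+ (x ∷ xs) = trans (+-congˡ (∑-+ xs)) (+-interchange _ _ _ _)

  ∑-* : ∀ {X : Set} (xs : List X) c {f} → ∑ xs (λ x → c * f x) ≈ c * ∑ xs f
  ∑-* []       c = sym (zeroʳ c)
  ∑-* (x ∷ xs) c = trans (+-congˡ (∑-* xs c)) (sym (distribˡ _ _ _))

  ∑-swap : ∀ {X Y : Set} (xs : List X) (ys : List Y) {f : X → Y → C} →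
    ∑ xs (λ x → ∑ ys (f x)) ≈ ∑ ys (λ y → ∑ xs (λ x → f x y))
  ∑-swap []       ys = sym (∑-0 ys)
  ∑-swap (x ∷ xs) ys = trans (+-congˡ (∑-swap xs ys)) (sym (∑-+ ys))

  ∑-filt : ∀ {X : Set} p (xs : List X) f → ∑ (filt p xs) f ≈ ∑ xs (λ x → 𝟙 (p x) * f x)
  ∑-filt p []       f = refl
  ∑-filt p (x ∷ xs) f with p x
  ... | true  = +-cong (sym (*-identityˡ _)) (∑-filt p xs f)
  ... | false = trans (∑-filt p xs f) (sym (trans (+-congʳ (zeroˡ _)) (+-identityˡ _)))

  ∑-upTo : ∀ n f → ∑ (upTo n) f ≈ Σ< n f
  ∑-upTo n f = go n id
    where
    go : ∀ n (h : ℕ → ℕ) → ∑ (applyUpTo h n) f ≈ Σ< n (f ∘ h)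
    go zero    h = refl
    go (suc n) h = +-congˡ (go n (h ∘ suc))

  Σ<-∷ʳ : ∀ n f → Σ< (suc n) f ≈ Σ< n f + f n
  Σ<-∷ʳ zero    f = +-comm _ _
  Σ<-∷ʳ (suc n) f = trans (+-congˡ (Σ<-∷ʳ n (f ∘ suc))) (sym (+-assoc _ _ _))

  ∑-words-suc : ∀ A m f → ∑ (wordsOf A (suc m)) f ≈ ∑ A (λ x → ∑ (wordsOf A m) (λ w → f (x ∷ w)))
  ∑-words-suc A m f = trans (∑-concatMap (λ x → map (x ∷_) (wordsOf A m)) A) (∑-cong A (λ x → ∑-map (x ∷_) (wordsOf A m)))

  ∑-words-∷ʳ : ∀ A m f → ∑ (wordsOf A (suc m)) f ≈ ∑ (wordsOf A m) (λ w → ∑ A (λ x → f (w ++ x ∷ [])))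
  ∑-words-∷ʳ A zero    f = trans (∑-words-suc A 0 f) (trans (∑-cong A (λ x → +-identityʳ _)) (sym (+-identityʳ _)))
  ∑-words-∷ʳ A (suc m) f = trans (∑-words-suc A (suc m) f) (trans (∑-cong A (λ x → ∑-words-∷ʳ A m (λ w → f (x ∷ w))))
    (sym (∑-words-suc A m (λ w → ∑ A (λ x → f (w ++ x ∷ []))))))

  ∑-words-reverse : ∀ A m f → ∑ (wordsOf A m) (f ∘ reverse) ≈ ∑ (wordsOf A m) f
  ∑-words-reverse A zero    f = refl
  ∑-words-reverse A (suc m) f = begin
    ∑ (wordsOf A (suc m)) (f ∘ reverse)
      ≈⟨ ∑-words-suc A m (f ∘ reverse) ⟩
    ∑ A (λ x → ∑ (wordsOf A m) (λ w → f (reverse (x ∷ w))))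
      ≈⟨ ∑-cong A (λ x → trans (∑-cong (wordsOf A m) (λ w → reflexive (≡.cong f (Listₚ.unfold-reverse x w))))
           (∑-words-reverse A m (λ w → f (w ++ x ∷ [])))) ⟩
    ∑ A (λ x → ∑ (wordsOf A m) (λ w → f (w ++ x ∷ [])))
      ≈⟨ ∑-swap A (wordsOf A m) ⟩
    ∑ (wordsOf A m) (λ w → ∑ A (λ x → f (w ++ x ∷ [])))
      ≈⟨ ∑-words-∷ʳ A m f ⟨
    ∑ (wordsOf A (suc m)) f ∎

module Enumeration (R : CommutativeRing 0ℓ 0ℓ) (l : ℕ)
  (T : CommutativeRing.Carrier R) (γ : ℕ → CommutativeRing.Carrier R) (r q : CommutativeRing.Carrier R) where
  open CommutativeRing R renaming (Carrier to C)
  open SetoidR setoid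
  open Series R
  open Splits R
  open ListSum R
  open Words R l T γ r q

  wordSum : List ℕ → ℕ → (List Letter → C) → C
  wordSum V zero    f = f []
  wordSum V (suc k) f = ∑ V (λ v → Σ< l (λ c → wordSum V k (λ ρ → f ((v , c) ∷ ρ))))

  wordSum-cong : ∀ V k {f g} → (∀ ρ → f ρ ≈ g ρ) → wordSum V k f ≈ wordSum V k g
  wordSum-cong V zero    h = h []
  wordSum-cong V (suc k) {f} {g} h = ∑-cong V (λ v → Σ<-cong l {λ c → wordSum V k (λ ρ → f ((v , c) ∷ ρ))}
    {λ c → wordSum V k (λ ρ → g ((v , c) ∷ ρ))} (λ c _ → wordSum-cong V k (λ ρ → h ((v , c) ∷ ρ))))

  wordSum-0 : ∀ V k → wordSum V k (λ _ → 0#) ≈ 0#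
  wordSum-0 V zero    = refl
  wordSum-0 V (suc k) = trans (∑-cong V (λ v → Σ<-0 l (λ c _ → wordSum-0 V k))) (∑-0 V)

  ∑-segment : ∀ n f → ∑ (segment 0 n) f ≈ Σ< n (f ∘ suc)
  ∑-segment zero    f = refl
  ∑-segment (suc n) f = trans (+-cong (reflexive (≡.cong (f ∘ suc) (ℕₚ.+-identityʳ n))) (∑-segment n f))
    (trans (+-comm _ _) (sym (Σ<-∷ʳ n (f ∘ suc))))

  ∑-letters : ∀ n f → ∑ (letters n l) f ≈ ∑ (segment 0 n) (λ v → Σ< l (λ c → f (v , c)))
  ∑-letters n f = begin
    ∑ (letters n l) f
      ≈⟨ ∑-concatMap (λ v → map (λ c → suc v , c) (upTo l)) (upTo n) ⟩
    ∑ (upTo n) (λ v → ∑ (map (λ c → suc v , c) (upTo l)) f)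
      ≈⟨ ∑-cong (upTo n) (λ v → trans (∑-map {Y = Letter} (λ c → suc v , c) (upTo l) {f}) (∑-upTo l (λ c → f (suc v , c)))) ⟩
    ∑ (upTo n) (λ v → Σ< l (λ c → f (suc v , c)))
      ≈⟨ ∑-upTo n (λ v → Σ< l (λ c → f (suc v , c))) ⟩
    Σ< n (λ v → Σ< l (λ c → f (suc v , c)))
      ≈⟨ ∑-segment n (λ v → Σ< l (λ c → f (v , c))) ⟨
    ∑ (segment 0 n) (λ v → Σ< l (λ c → f (v , c))) ∎

  ∑-wordSum : ∀ n k f → ∑ (wordsOf (letters n l) k) f ≈ wordSum (segment 0 n) k f
  ∑-wordSum n zero    f = +-identityʳ _
  ∑-wordSum n (suc k) f = trans (∑-words-suc (letters n l) k f) (trans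
    (∑-cong (letters n l) (λ x → ∑-wordSum n k (λ w → f (x ∷ w))))
    (∑-letters n (λ x → wordSum (segment 0 n) k (λ w → f (x ∷ w)))))

  ∑-first : ∀ V f → ∑ V f ≈ firstSum V (λ _ v _ → f v)
  ∑-first []      f = refl
  ∑-first (v ∷ V) f = +-congˡ (∑-first V f)

  wordSum-avoid : ∀ k v mid post h → All (v ≢_) mid → All (v ≢_) post →
    wordSum (mid ++ v ∷ post) k (λ ρ → 𝟙 (not (memb v (absVals ρ))) * h ρ) ≈ wordSum (mid ++ post) k h
  wordSum-avoid zero    v mid post h _  _  = *-identityˡ _
  wordSum-avoid (suc k) v mid post h ps qs = begin
    ∑ (mid ++ v ∷ post) K          ≈⟨ ∑-++ mid (v ∷ post) ⟩
    ∑ mid K + (K v + ∑ post K)     ≈⟨ +-cong (∑-congAll (All.map (λ {u} → other u) ps))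
                                        (trans (+-cong K-v (∑-congAll (All.map (λ {u} → other u) qs))) (+-identityˡ _)) ⟩
    ∑ mid K′ + ∑ post K′           ≈⟨ ∑-++ mid post ⟨
    ∑ (mid ++ post) K′ ∎
    where
    V = mid ++ v ∷ post
    K K′ : ℕ → C
    K u = Σ< l (λ c → wordSum V k (λ ρ → 𝟙 (not (memb v (u ∷ absVals ρ))) * h ((u , c) ∷ ρ)))
    K′ u = Σ< l (λ c → wordSum (mid ++ post) k (λ ρ → h ((u , c) ∷ ρ)))
    other : ∀ u → v ≢ u → K u ≈ K′ u
    other u v≢u = Σ<-cong l {λ c → wordSum V k (λ ρ → 𝟙 (not (memb v (u ∷ absVals ρ))) * h ((u , c) ∷ ρ))}
      {λ c → wordSum (mid ++ post) k (λ ρ → h ((u , c) ∷ ρ))} (λ c _ → trans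
      (wordSum-cong V k (λ ρ → *-congʳ (reflexive (≡.cong (λ b → 𝟙 (not (b ∨ memb v (absVals ρ)))) (≡ᵇ-false v≢u)))))
      (wordSum-avoid k v mid post (λ ρ → h ((u , c) ∷ ρ)) ps qs))
    K-v : K v ≈ 0#
    K-v = Σ<-0 l (λ c _ → trans (wordSum-cong V k (λ ρ → trans (*-congʳ (reflexive
      (≡.cong (λ b → 𝟙 (not (b ∨ memb v (absVals ρ)))) (≡ᵇ-refl v)))) (zeroˡ (h ((v , c) ∷ ρ))))) (wordSum-0 V k))

  𝟙-∧ : ∀ a b → 𝟙 (a ∧ b) ≈ 𝟙 a * 𝟙 b
  𝟙-∧ true  b = sym (*-identityˡ _)
  𝟙-∧ false b = sym (zeroˡ _)

  -- Distinctness is tested letter by letter: a letter whose value must not recur removes this value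
  -- from the alphabet of the rest.
  wordSum-distinct : ∀ k V g → Desc V → wordSum V k (λ ρ → 𝟙 (distinct (absVals ρ)) * g ρ) ≈ arrSum k V g
  wordSum-distinct zero    V g d = *-identityˡ _
  wordSum-distinct (suc k) V g d = trans (∑-first V _) (firstSum-cong V letter)
    where
    letter : ∀ mid v post → mid ++ v ∷ post ≡ V →
      Σ< l (λ c → wordSum V k (λ ρ → 𝟙 (distinct (v ∷ absVals ρ)) * g ((v , c) ∷ ρ)))
        ≈ Σ< l (λ c → arrSum k (mid ++ post) (λ ρ → g ((v , c) ∷ ρ)))
    letter mid v post ≡.refl with Desc-split mid d
    ... | mid> , _ , v> , _ = Σ<-cong l {λ c → wordSum V k (λ ρ → 𝟙 (distinct (v ∷ absVals ρ)) * g ((v , c) ∷ ρ))}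
      {λ c → arrSum k (mid ++ post) (λ ρ → g ((v , c) ∷ ρ))} (λ c _ → begin
      wordSum (mid ++ v ∷ post) k (λ ρ → 𝟙 (distinct (v ∷ absVals ρ)) * g ((v , c) ∷ ρ))
        ≈⟨ wordSum-cong (mid ++ v ∷ post) k (λ ρ → trans (*-congʳ (𝟙-∧ (not (memb v (absVals ρ))) (distinct (absVals ρ)))) (*-assoc _ _ _)) ⟩
      wordSum (mid ++ v ∷ post) k (λ ρ → 𝟙 (not (memb v (absVals ρ))) * (𝟙 (distinct (absVals ρ)) * g ((v , c) ∷ ρ)))
        ≈⟨ wordSum-avoid k v mid post (λ ρ → 𝟙 (distinct (absVals ρ)) * g ((v , c) ∷ ρ)) (All.map ℕₚ.<⇒≢ mid>) (All.map ℕₚ.>⇒≢ v>) ⟩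
      wordSum (mid ++ post) k (λ ρ → 𝟙 (distinct (absVals ρ)) * g ((v , c) ∷ ρ))
        ≈⟨ wordSum-distinct k (mid ++ post) (λ ρ → g ((v , c) ∷ ρ)) (Desc-remove mid d) ⟩
      arrSum k (mid ++ post) (λ ρ → g ((v , c) ∷ ρ)) ∎)

  ∑-colPerms : ∀ n f → ∑ (colPerms l n) f ≈ arrSum n (segment 0 n) (f ∘ reverse)
  ∑-colPerms n f = begin
    ∑ (colPerms l n) f
      ≈⟨ ∑-filt (λ w → distinct (absVals w)) (wordsOf (letters n l) n) f ⟩
    ∑ (wordsOf (letters n l) n) (λ w → 𝟙 (distinct (absVals w)) * f w)
      ≈⟨ ∑-words-reverse (letters n l) n (λ w → 𝟙 (distinct (absVals w)) * f w) ⟨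
    ∑ (wordsOf (letters n l) n) (λ w → 𝟙 (distinct (absVals (reverse w))) * f (reverse w))
      ≈⟨ ∑-cong (wordsOf (letters n l) n) (λ w → *-congʳ (reflexive (≡.cong 𝟙 (absVals-reverse w)))) ⟩
    ∑ (wordsOf (letters n l) n) (λ w → 𝟙 (distinct (absVals w)) * f (reverse w))
      ≈⟨ ∑-wordSum n n (λ w → 𝟙 (distinct (absVals w)) * f (reverse w)) ⟩
    wordSum (segment 0 n) n (λ w → 𝟙 (distinct (absVals w)) * f (reverse w))
      ≈⟨ wordSum-distinct n (segment 0 n) (f ∘ reverse) (segment-desc 0 n) ⟩
    arrSum n (segment 0 n) (f ∘ reverse) ∎

open import Data.Integer using (+_)

-- Polynomials and their values

qExponent : Mono → ℤ
qExponent (_ , _ , _ , k) = k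

-- Evaluation in power series reads only the absolute value of the exponent of q, so it respects
-- products and coefficients only in the absence of negative exponents.
NonNeg : Poly → Set
NonNeg = All (λ m → qExponent m ≡ + ∣ qExponent m ∣)

NonNeg-* : ∀ {P Q} → NonNeg P → NonNeg Q → NonNeg (P *P Q)
NonNeg-* {P} {Q} ps qs = Allₚ.concat⁺ (Allₚ.map⁺ (All.map (λ {m} p → Allₚ.map⁺ (All.map (λ {m′} p′ → add m m′ p p′) qs)) ps))
  where
  add : ∀ m m′ → qExponent m ≡ + ∣ qExponent m ∣ → qExponent m′ ≡ + ∣ qExponent m′ ∣ →
    qExponent (mulMono m m′) ≡ + ∣ qExponent (mulMono m m′) ∣
  add (_ , _ , _ , + k) (_ , _ , _ , + k′) _ _ = ≡.refl

NonNeg-sum : ∀ {n} {f : ℕ → Poly} → (∀ k → k ℕ.< n → NonNeg (f k)) → NonNeg (sumP (map f (upTo n)))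
NonNeg-sum {n} {f} h = go n id h
  where
  go : ∀ n (g : ℕ → ℕ) → (∀ k → k ℕ.< n → NonNeg (f (g k))) → NonNeg (sumP (map f (applyUpTo g n)))
  go zero    g h = []
  go (suc n) g h = Allₚ.++⁺ (h 0 (ℕ.s≤s ℕ.z≤n)) (go n (g ∘ suc) (λ k k< → h (suc k) (ℕ.s≤s k<)))

NonNeg-qbinom : ∀ n k → NonNeg (qbinom n k)
NonNeg-qbinom n       zero    = ≡.refl ∷ []
NonNeg-qbinom zero    (suc k) = []
NonNeg-qbinom (suc n) (suc k) = Allₚ.++⁺ (NonNeg-qbinom n k) (NonNeg-* {qPow (+ suc k)} (≡.refl ∷ []) (NonNeg-qbinom n (suc k)))

NonNeg-tBracket : ∀ m → NonNeg (tBracket m)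
NonNeg-tBracket m = Allₚ.map⁺ (Allₚ.applyUpTo⁺₁ id m (λ _ → ≡.refl))

-- The exponent maj - exc is itself a major index, for the order by type, and hence not negative.
qExponent-weight : ∀ {l n w} → 1 ℕ.≤ l → Permutation l n w → (+ maj w) ℤ.- (+ exc w) ≡ + majR l (reverse w)
qExponent-weight {l} {n} {w} 1≤l p = ≡.trans (≡.cong (λ m → (+ m) ℤ.- (+ exc w)) (maj-exc-majR l n w 1≤l p))
  (≡.trans (ℤₚ.+-assoc (+ majR l (reverse w)) (+ exc w) (ℤ.- (+ exc w)))
    (≡.trans (≡.cong (ℤ._+_ (+ majR l (reverse w))) (ℤₚ.+-inverseʳ (+ exc w))) (ℤₚ.+-identityʳ _)))

record Monomials (R : CommutativeRing 0ℓ 0ℓ) : Set where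
  open CommutativeRing R renaming (Carrier to C)
  open Exp semiring using (_^_)
  field
    t r q  : C
    mono   : ℤ → ℕ → ℕ → ℕ → C
    mono-* : ∀ a b i i′ j j′ k k′ →
      mono (a ℤ.* b) (i ℕ.+ i′) (j ℕ.+ j′) (k ℕ.+ k′) ≈ mono a i j k * mono b i′ j′ k′
    mono-1 : ∀ i j k → mono (+ 1) i j k ≈ t ^ i * (r ^ j * q ^ k)

module Semantics (R : CommutativeRing 0ℓ 0ℓ) (monomials : Monomials R) where
  open CommutativeRing R renaming (Carrier to C)
  open Monomials monomials
  open SetoidR setoid
  open Exp semiring using (_^_; ^-homo-*)
  open Solver commutativeSemiring using (solve; _:=_; _:*_; con)
  open Series R using (Σ<; Σ<-cong; Σ<-*)
  open ListSum R

  ⟦_⟧ₘ : Mono → C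
  ⟦ a , i , j , k ⟧ₘ = mono a i j ∣ k ∣

  ⟦_⟧ : Poly → C
  ⟦ P ⟧ = ∑ P ⟦_⟧ₘ

  ⟦⟧-∷ : ∀ m P → ⟦ m ∷ P ⟧ ≈ ⟦ m ⟧ₘ + ⟦ P ⟧
  ⟦⟧-∷ m P = refl

  ⟦⟧-+ : ∀ P Q → ⟦ P +P Q ⟧ ≈ ⟦ P ⟧ + ⟦ Q ⟧
  ⟦⟧-+ P Q = ∑-++ P Q

  ⟦⟧-* : ∀ {P Q} → NonNeg P → NonNeg Q → ⟦ P *P Q ⟧ ≈ ⟦ P ⟧ * ⟦ Q ⟧
  ⟦⟧-* {P} {Q} ps qs = begin
    ⟦ P *P Q ⟧                                   ≈⟨ ∑-concatMap (λ m → map (mulMono m) Q) P ⟩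
    ∑ P (λ m → ∑ (map (mulMono m) Q) ⟦_⟧ₘ)
      ≈⟨ ∑-congAll (All.map (λ {m} p → trans (∑-map (mulMono m) Q) (trans
           (∑-congAll (All.map (λ {m′} p′ → multiply m m′ p p′) qs)) (∑-* Q ⟦ m ⟧ₘ))) ps) ⟩
    ∑ P (λ m → ⟦ m ⟧ₘ * ⟦ Q ⟧)                   ≈⟨ trans (∑-cong P (λ m → *-comm _ _)) (trans (∑-* P ⟦ Q ⟧) (*-comm _ _)) ⟩
    ⟦ P ⟧ * ⟦ Q ⟧ ∎
    where
    multiply : ∀ m m′ → qExponent m ≡ + ∣ qExponent m ∣ → qExponent m′ ≡ + ∣ qExponent m′ ∣ →
      ⟦ mulMono m m′ ⟧ₘ ≈ ⟦ m ⟧ₘ * ⟦ m′ ⟧ₘ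
    multiply (a , i , j , + k) (b , i′ , j′ , + k′) _ _ = mono-* a b i i′ j j′ k k′

  ⟦⟧-sum : ∀ n f → ⟦ sumP (map f (upTo n)) ⟧ ≈ Σ< n (λ k → ⟦ f k ⟧)
  ⟦⟧-sum n f = go n id
    where
    go : ∀ n (g : ℕ → ℕ) → ⟦ sumP (map f (applyUpTo g n)) ⟧ ≈ Σ< n (λ k → ⟦ f (g k) ⟧)
    go zero    g = refl
    go (suc n) g = trans (⟦⟧-+ (f (g 0)) _) (+-congˡ (go n (g ∘ suc)))

  ⟦⟧-mono : ∀ i j k → ⟦ (+ 1 , i , j , + k) ∷ [] ⟧ ≈ t ^ i * (r ^ j * q ^ k)
  ⟦⟧-mono i j k = trans (+-identityʳ _) (mono-1 i j k)

  ⟦1⟧ : ⟦ 1P ⟧ ≈ 1#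
  ⟦1⟧ = trans (⟦⟧-mono 0 0 0) (trans (*-identityˡ _) (*-identityˡ _))

  ⟦t⟧ : ⟦ tP ⟧ ≈ t
  ⟦t⟧ = trans (⟦⟧-mono 1 0 0) (solve 1 (λ t → (t :* con 1) :* (con 1 :* con 1) := t) refl t)

  ⟦r⟧ : ⟦ rP ⟧ ≈ r
  ⟦r⟧ = trans (⟦⟧-mono 0 1 0) (solve 1 (λ r → con 1 :* ((r :* con 1) :* con 1) := r) refl r)

  ⟦q^⟧ : ∀ k → ⟦ qPow (+ k) ⟧ ≈ q ^ k
  ⟦q^⟧ k = trans (⟦⟧-mono 0 0 k) (trans (*-identityˡ _) (*-identityˡ _))

  ⟦[]⟧ : ∀ m → ⟦ tBracket m ⟧ ≈ Σ< m (t ^_)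
  ⟦[]⟧ m = trans (∑-map _ (upTo m)) (trans (∑-upTo m _) (Σ<-cong m (λ i _ → trans (mono-1 i 0 0)
    (solve 1 (λ x → x :* (con 1 :* con 1) := x) refl (t ^ i)))))

  module WithColors (l′ : ℕ) where
    l : ℕ
    l = suc l′

    T : C
    T = t ^ l

    open Colors R l′ (t ^_) using (colors; y)

    t[l-1] : ⟦ tP *P tBracket l′ ⟧ ≈ y
    t[l-1] = trans (⟦⟧-* {tP} (≡.refl ∷ []) (NonNeg-tBracket l′)) (trans (*-cong ⟦t⟧ (⟦[]⟧ l′)) (trans (sym (Σ<-* l′ t))
      (trans (Σ<-cong l′ (λ i _ → reflexive (≡.cong (λ k → t ^ suc k) (≡.trans (≡.sym (ℕₚ.+-identityʳ i)) (≡.cong (i ℕ.+_) (≡.sym (ℕₚ.n∸n≡0 l′)))))))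
        (sym (go l′ ℕₚ.≤-refl)))))
      where
      go : ∀ j → j ℕ.≤ l′ → colors j ≈ Σ< j (λ i → t ^ suc (i ℕ.+ (l′ ℕ.∸ j)))
      go zero    _  = refl
      go (suc j) j< = +-cong (reflexive (≡.cong (t ^_) drop)) (trans (go j (ℕₚ.<⇒≤ j<))
        (Σ<-cong j (λ i _ → reflexive (≡.cong (λ k → t ^ suc k) (≡.trans (≡.cong (i ℕ.+_) drop) (ℕₚ.+-suc i _))))))
        where
        drop : l′ ℕ.∸ j ≡ suc (l′ ℕ.∸ suc j)
        drop = ≡.trans (≡.sym (ℕₚ.suc-pred (l′ ℕ.∸ j) {{ℕ.>-nonZero (ℕₚ.m<n⇒0<n∸m j<)}})) (≡.cong suc (ℕₚ.pred[m∸n]≡m∸[1+n] l′ j))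

    t[l] : ⟦ tP *P tBracket l ⟧ ≈ T + y
    t[l] = begin
      ⟦ tP *P tBracket l ⟧           ≈⟨ trans (⟦⟧-* {tP} (≡.refl ∷ []) (NonNeg-tBracket l)) (*-cong ⟦t⟧ (⟦[]⟧ l)) ⟩
      t * Σ< l (t ^_)                ≈⟨ *-congˡ (Σ<-∷ʳ l′ (t ^_)) ⟩
      t * (Σ< l′ (t ^_) + t ^ l′)    ≈⟨ trans (distribˡ _ _ _) (+-comm _ _) ⟩
      T + t * Σ< l′ (t ^_)
        ≈⟨ +-congˡ (trans (sym (trans (⟦⟧-* {tP} (≡.refl ∷ []) (NonNeg-tBracket l′)) (*-cong ⟦t⟧ (⟦[]⟧ l′)))) t[l-1]) ⟩
      T + y ∎

    NonNeg-A : ∀ n → NonNeg (A l n)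
    NonNeg-A zero    = ≡.refl ∷ []
    NonNeg-A (suc n) = Allₚ.map⁺ (All.map (λ p → ≡.subst (λ k → k ≡ + ∣ k ∣) (≡.sym (qExponent-weight (ℕ.s≤s ℕ.z≤n) p)) ≡.refl) (all-colPerms l (suc n)))

    NonNeg-A2 : ∀ n → NonNeg (A2 l n)
    NonNeg-A2 n = Allₚ.map⁺ (All.map (λ {m} p → p) (NonNeg-A n))

    module _ (r : C) where
      open Words R l T (t ^_) r q using (letterWeight; weightR; arrSum-cong; wsum)
      open Enumeration R l T (t ^_) r q using (∑-colPerms)

      letterWeight-monomial : ∀ pos x → letterWeight pos x ≈ t ^ (l ℕ.* b2n ((pos , 0) ≺ x) ℕ.+ proj₂ x) * r ^ b2n (x ≡L (pos , 0))
      letterWeight-monomial pos (v , suc c)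
        rewrite ℕₚ.*-zeroʳ l′ | Boolₚ.∧-zeroʳ (v ≡ᵇ pos) = sym (*-identityʳ _)
      letterWeight-monomial pos (v , zero) with ℕₚ.<-cmp pos v
      ... | tri< p ≢ _ rewrite <ᵇ-true p | ≡ᵇ-false {v} {pos} (≢ ∘ ≡.sym) | ℕₚ.+-identityʳ (l′ ℕ.* 1) | ℕₚ.*-identityʳ l′ = sym (*-identityʳ _)
      ... | tri≈ _ ≡.refl _ rewrite <ᵇ-false (ℕₚ.≤-refl {pos}) | ≡ᵇ-refl pos | ℕₚ.*-zeroʳ l′ = sym (trans (*-identityˡ _) (*-identityʳ _))
      ... | tri> _ ≢ p rewrite <ᵇ-false (ℕₚ.<⇒≤ p) | <ᵇ-true p | ≡ᵇ-false {v} {pos} (≢ ∘ ≡.sym) | ℕₚ.*-zeroʳ l′ = sym (*-identityˡ _)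

      weightR-monomial : ∀ ρ → weightR ρ ≈ t ^ (l ℕ.* excR ρ ℕ.+ colorR ρ) * r ^ fixR ρ
      weightR-monomial []      = sym (trans (*-identityʳ _) (reflexive (≡.cong (λ k → t ^ (k ℕ.+ 0)) (ℕₚ.*-zeroʳ l))))
      weightR-monomial (x ∷ ρ) = begin
        letterWeight pos x * weightR ρ
          ≈⟨ *-cong (letterWeight-monomial pos x) (weightR-monomial ρ) ⟩
        t ^ (l ℕ.* b ℕ.+ proj₂ x) * r ^ f * (t ^ (l ℕ.* excR ρ ℕ.+ colorR ρ) * r ^ fixR ρ)
          ≈⟨ interchange (t ^ (l ℕ.* b ℕ.+ proj₂ x)) (r ^ f) _ _ ⟩
        t ^ (l ℕ.* b ℕ.+ proj₂ x) * t ^ (l ℕ.* excR ρ ℕ.+ colorR ρ) * (r ^ f * r ^ fixR ρ)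
          ≈⟨ *-cong (sym (^-homo-* t (l ℕ.* b ℕ.+ proj₂ x) _)) (sym (^-homo-* r f (fixR ρ))) ⟩
        t ^ (l ℕ.* b ℕ.+ proj₂ x ℕ.+ (l ℕ.* excR ρ ℕ.+ colorR ρ)) * r ^ (f ℕ.+ fixR ρ)
          ≈⟨ *-congʳ (reflexive (≡.cong (t ^_) (≡.trans (ℕinterchange (l ℕ.* b) (proj₂ x) (l ℕ.* excR ρ) (colorR ρ))
               (≡.cong (ℕ._+ (proj₂ x ℕ.+ colorR ρ)) (≡.sym (ℕₚ.*-distribˡ-+ l b (excR ρ))))))) ⟩
        t ^ (l ℕ.* excR (x ∷ ρ) ℕ.+ colorR (x ∷ ρ)) * r ^ fixR (x ∷ ρ) ∎
        where
        open CSG *-commutativeSemigroup using (interchange)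
        open CSG ℕₚ.+-commutativeSemigroup using () renaming (interchange to ℕinterchange)
        pos = suc (length ρ)
        b = b2n ((pos , 0) ≺ x)
        f = b2n (x ≡L (pos , 0))

      ∑-weights : ∀ n → ∑ (colPerms l n) (λ w → t ^ fexc l w * (r ^ fix w * q ^ majR l (reverse w)))
        ≈ wsum n (segment 0 n) (λ ρ → q ^ majR l ρ)
      ∑-weights n = trans (∑-colPerms n _) (arrSum-cong n (segment 0 n) (λ ρ _ → begin
        t ^ fexc l (reverse ρ) * (r ^ fix (reverse ρ) * q ^ majR l (reverse (reverse ρ)))
          ≡⟨ ≡.cong₂ (λ e w → t ^ e * (r ^ fix (reverse ρ) * q ^ majR l w))
               (≡.cong₂ (λ a b → l ℕ.* a ℕ.+ b) (exc-reverse ρ) (colorSum-reverse ρ)) (Listₚ.reverse-involutive ρ) ⟩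
        t ^ (l ℕ.* excR ρ ℕ.+ colorR ρ) * (r ^ fix (reverse ρ) * q ^ majR l ρ)
          ≡⟨ ≡.cong (λ f → t ^ (l ℕ.* excR ρ ℕ.+ colorR ρ) * (r ^ f * q ^ majR l ρ)) (fix-reverse ρ) ⟩
        t ^ (l ℕ.* excR ρ ℕ.+ colorR ρ) * (r ^ fixR ρ * q ^ majR l ρ)
          ≈⟨ trans (sym (*-assoc _ _ _)) (*-congʳ (sym (weightR-monomial ρ))) ⟩
        weightR ρ * q ^ majR l ρ ∎))

    open Words R l T (t ^_) r q using (wsum)
    open Words R l T (t ^_) 1# q using () renaming (wsum to wsum₁)

    ⟦A⟧ : ∀ n → ⟦ A l n ⟧ ≈ wsum n (segment 0 n) (λ ρ → q ^ majR l ρ)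
    ⟦A⟧ zero    = trans ⟦1⟧ (sym (*-identityˡ _))
    ⟦A⟧ (suc n) = trans (∑-map (weight l) (colPerms l (suc n))) (trans (∑-congAll (All.map (λ {w} p →
      trans (reflexive (≡.cong (λ k → mono (+ 1) (fexc l w) (fix w) ∣ k ∣) (qExponent-weight (ℕ.s≤s ℕ.z≤n) p))) (mono-1 _ _ _)) (all-colPerms l (suc n))))
      (∑-weights r (suc n)))

    1^ : ∀ n → 1# ^ n ≈ 1#
    1^ zero    = refl
    1^ (suc n) = trans (*-identityˡ _) (1^ n)

    ⟦A2⟧ : ∀ n → ⟦ A2 l n ⟧ ≈ wsum₁ n (segment 0 n) (λ ρ → q ^ majR l ρ)
    ⟦A2⟧ zero    = trans ⟦1⟧ (sym (*-identityˡ _))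
    ⟦A2⟧ (suc n) = trans (∑-map _ (A l (suc n))) (trans (∑-map (weight l) (colPerms l (suc n))) (trans (∑-congAll (All.map (λ {w} p →
      trans (reflexive (≡.cong (λ k → mono (+ 1) (fexc l w) 0 ∣ k ∣) (qExponent-weight (ℕ.s≤s ℕ.z≤n) p)))
        (trans (mono-1 _ _ _) (*-congˡ (*-congʳ (sym (1^ (fix w))))))) (all-colPerms l (suc n))))
      (∑-weights 1# (suc n))))

    right-hand-side : ℕ → Poly
    right-hand-side n = (rP +P tP *P tBracket l′ *P qPow (+ n)) *P A l n
      +P tP *P tBracket l *P sumP (map (λ k → qbinom n k *P qPow (+ k) *P A l k *P A2 l (n ℕ.∸ k)) (upTo n))

    private
      NonNeg-t[] : ∀ m → NonNeg (tP *P tBracket m)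
      NonNeg-t[] m = NonNeg-* {tP} (≡.refl ∷ []) (NonNeg-tBracket m)

      NonNeg-term₁ : ∀ n k → NonNeg (qbinom n k *P qPow (+ k))
      NonNeg-term₁ n k = NonNeg-* (NonNeg-qbinom n k) (≡.refl ∷ [])

      NonNeg-term₂ : ∀ n k → NonNeg (qbinom n k *P qPow (+ k) *P A l k)
      NonNeg-term₂ n k = NonNeg-* (NonNeg-term₁ n k) (NonNeg-A k)

      NonNeg-terms : ∀ n → NonNeg (sumP (map (λ k → qbinom n k *P qPow (+ k) *P A l k *P A2 l (n ℕ.∸ k)) (upTo n)))
      NonNeg-terms n = NonNeg-sum {n} (λ k _ → NonNeg-* (NonNeg-term₂ n k) (NonNeg-A2 (n ℕ.∸ k)))

      NonNeg-factor : ∀ n → NonNeg (rP +P tP *P tBracket l′ *P qPow (+ n))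
      NonNeg-factor n = ≡.refl ∷ NonNeg-* (NonNeg-t[] l′) (≡.refl ∷ [])

    NonNeg-right-hand-side : ∀ n → NonNeg (right-hand-side n)
    NonNeg-right-hand-side n = Allₚ.++⁺ (NonNeg-* (NonNeg-factor n) (NonNeg-A n)) (NonNeg-* (NonNeg-t[] l) (NonNeg-terms n))

    module _ (e : ℕ → C) where
      open Recurrence R l′ T (t ^_) r q e

      module _
        (inverse : ∀ n → qfactorial n * e n ≈ 1#)
        (separated : ∀ {x y} → (∀ s → Σ[ w ∈ C ] Limit._~[_]_ R q w s x × Limit._~[_]_ R q w s y) → x ≈ y) where

        ⟦qbinom⟧ : ∀ n k → ⟦ qbinom n k ⟧ ≈ binomial n k
        ⟦qbinom⟧ n       zero    = ⟦1⟧
        ⟦qbinom⟧ zero    (suc k) = refl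
        ⟦qbinom⟧ (suc n) (suc k) = trans (⟦⟧-+ (qbinom n k) _) (+-cong (⟦qbinom⟧ n k)
          (trans (⟦⟧-* {qPow (+ suc k)} (≡.refl ∷ []) (NonNeg-qbinom n (suc k))) (*-cong (⟦q^⟧ (suc k)) (⟦qbinom⟧ n (suc k)))))

        semantic-recurrence : ∀ n → ⟦ A l (suc n) ⟧ ≈ ⟦ right-hand-side n ⟧
        semantic-recurrence n = trans (⟦A⟧ (suc n)) (trans (recurrence inverse separated n) (sym (begin
          ⟦ right-hand-side n ⟧
            ≈⟨ ⟦⟧-+ ((rP +P tP *P tBracket l′ *P qPow (+ n)) *P A l n) _ ⟩
          ⟦ (rP +P tP *P tBracket l′ *P qPow (+ n)) *P A l n ⟧ + ⟦ tP *P tBracket l *P terms ⟧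
            ≈⟨ +-cong (trans (⟦⟧-* (NonNeg-factor n) (NonNeg-A n)) (*-cong
                  (trans (⟦⟧-+ rP (tP *P tBracket l′ *P qPow (+ n))) (+-cong ⟦r⟧ (trans (⟦⟧-* {Q = qPow (+ n)} (NonNeg-t[] l′) (≡.refl ∷ [])) (*-cong t[l-1] (⟦q^⟧ n)))))
                  (⟦A⟧ n)))
                (trans (⟦⟧-* (NonNeg-t[] l) (NonNeg-terms n)) (*-cong t[l] (trans (⟦⟧-sum n _) (Σ<-cong n (λ k _ → term k))))) ⟩
          (r + y * q ^ n) * a n + (T + y) * Σ< n (λ k → binomial n k * (q ^ k * (a k * a₁ (n ℕ.∸ k)))) ∎)))
          where
          terms = sumP (map (λ k → qbinom n k *P qPow (+ k) *P A l k *P A2 l (n ℕ.∸ k)) (upTo n))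
          a a₁ : ℕ → C
          a n = wsum n (segment 0 n) (λ ρ → q ^ majR l ρ)
          a₁ n = wsum₁ n (segment 0 n) (λ ρ → q ^ majR l ρ)
          term : ∀ k → ⟦ qbinom n k *P qPow (+ k) *P A l k *P A2 l (n ℕ.∸ k) ⟧ ≈ binomial n k * (q ^ k * (a k * a₁ (n ℕ.∸ k)))
          term k = begin
            ⟦ qbinom n k *P qPow (+ k) *P A l k *P A2 l (n ℕ.∸ k) ⟧
              ≈⟨ trans (⟦⟧-* (NonNeg-term₂ n k) (NonNeg-A2 (n ℕ.∸ k))) (*-cong (trans (⟦⟧-* (NonNeg-term₁ n k) (NonNeg-A k))
                   (*-cong (trans (⟦⟧-* {Q = qPow (+ k)} (NonNeg-qbinom n k) (≡.refl ∷ [])) (*-cong (⟦qbinom⟧ n k) (⟦q^⟧ k))) (⟦A⟧ k))) (⟦A2⟧ (n ℕ.∸ k))) ⟩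
            binomial n k * q ^ k * a k * a₁ (n ℕ.∸ k)
              ≈⟨ solve 4 (λ b q x y → b :* q :* x :* y := b :* (q :* (x :* y))) refl (binomial n k) (q ^ k) (a k) (a₁ (n ℕ.∸ k)) ⟩
            binomial n k * (q ^ k * (a k * a₁ (n ℕ.∸ k))) ∎

-- Comparing coefficients

module Variable (R : CommutativeRing 0ℓ 0ℓ) where
  open CommutativeRing R renaming (Carrier to C)
  open Series R
  private module Z = CommutativeRing ring⟦z⟧
  private module R^ = Exp semiring
  open Exp Z.semiring using (_^_)

  at : ℕ → C → ℕ → C
  at zero    x         = const x
  at (suc n) x zero    = 0#
  at (suc n) x (suc m) = at n x m

  at-cong : ∀ n {x y} → x ≈ y → at n x ≋ at n y
  at-cong zero    p zero    = p
  at-cong zero    p (suc m) = refl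
  at-cong (suc n) p zero    = refl
  at-cong (suc n) p (suc m) = at-cong n p m

  at-same : ∀ n x → at n x n ≡ x
  at-same zero    x = ≡.refl
  at-same (suc n) x = at-same n x

  at-other : ∀ n m x → m ≢ n → at n x m ≡ 0#
  at-other zero    zero    x p with () ← p ≡.refl
  at-other zero    (suc m) x p = ≡.refl
  at-other (suc n) zero    x p = ≡.refl
  at-other (suc n) (suc m) x p = at-other n m x (λ eq → p (≡.cong suc eq))

  at-suc : ∀ n x → at (suc n) x ≋ z ⊛ at n x
  at-suc n x zero    = sym (z⊛-0 (at n x))
  at-suc n x (suc m) = sym (z⊛-suc (at n x) m)

  const-at : ∀ c n x → at n (c * x) ≋ const c ⊛ at n x
  const-at c n x m = trans (lemma n m) (sym (const-⊛ c (at n x) m))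
    where
    lemma : ∀ n m → at n (c * x) m ≈ c * at n x m
    lemma zero    zero    = refl
    lemma zero    (suc m) = sym (zeroʳ c)
    lemma (suc n) zero    = sym (zeroʳ c)
    lemma (suc n) (suc m) = lemma n m

  at-⊛ : ∀ i j x y → at (i ℕ.+ j) (x * y) ≋ at i x ⊛ at j y
  at-⊛ zero    j x y = const-at x j y
  at-⊛ (suc i) j x y = Z.trans (at-suc (i ℕ.+ j) (x * y)) (Z.trans (Z.*-congˡ {z} (at-⊛ i j x y))
    (Z.trans (Z.sym (Z.*-assoc z (at i x) (at j y))) (Z.*-congʳ {at j y} (Z.sym (at-suc i x)))))

  z^-at : ∀ n → at n 1# ≋ z ^ n
  z^-at zero    = Z.refl
  z^-at (suc n) = Z.trans (at-suc n 1#) (Z.*-congˡ {z} (z^-at n))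

  const-^ : ∀ x n → const (x R^.^ n) ≋ const x ^ n
  const-^ x zero    = Z.refl
  const-^ x (suc n) = Z.trans (at-⊛ 0 0 x (x R^.^ n)) (Z.*-congˡ {const x} (const-^ x n))

  z^-low : ∀ s c n → n ℕ.< s → (z ^ s ⊛ c) n ≈ 0#
  z^-low (suc s) c zero    _           = trans (Z.*-assoc z (z ^ s) c 0) (z⊛-0 (z ^ s ⊛ c))
  z^-low (suc s) c (suc n) (ℕ.s≤s n<s) = trans (Z.*-assoc z (z ^ s) c (suc n)) (trans (z⊛-suc (z ^ s ⊛ c) n) (z^-low s c n n<s))

  -- A congruence modulo z^(n + 1) determines the coefficient of z^n.
  z-separated : ∀ {x y} → (∀ s → Σ[ w ∈ (ℕ → C) ] Limit._~[_]_ ring⟦z⟧ z w s x × Limit._~[_]_ ring⟦z⟧ z w s y) → x ≋ y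
  z-separated {x} {y} h n with h (suc n)
  ... | w , (c Limit., p) , (c′ Limit., p′) = trans (sym (low c p)) (low c′ p′)
    where
    low : ∀ {x} c → w ≋ x ⊕ z ^ suc n ⊛ c → w n ≈ x n
    low c p = trans (p n) (trans (+-congˡ (z^-low (suc n) c n ℕₚ.≤-refl)) (+-identityʳ _))

  -- The series z^c / (1 - z^(k + 1)).
  periodic : ℕ → ℕ → ℕ → C
  periodic k zero    zero    = 1#
  periodic k zero    (suc n) = periodic k k n
  periodic k (suc c) zero    = 0#
  periodic k (suc c) (suc n) = periodic k c n

  periodic-shift : ∀ k c → periodic k c ≋ z ^ c ⊛ periodic k 0
  periodic-shift k zero    = Z.sym (Z.*-identityˡ (periodic k 0))
  periodic-shift k (suc c) = Z.trans step (Z.trans (Z.*-congˡ {z} (periodic-shift k c)) (Z.sym (Z.*-assoc z (z ^ c) (periodic k 0))))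
    where
    step : periodic k (suc c) ≋ z ⊛ periodic k c
    step zero    = sym (z⊛-0 (periodic k c))
    step (suc n) = sym (z⊛-suc (periodic k c) n)

  periodic-inverse : ∀ k → (Z.1# Z.+ Z.- (z ^ suc k)) ⊛ periodic k 0 ≋ Z.1#
  periodic-inverse k = begin
    (Z.1# Z.+ Z.- Q) ⊛ p     ≈⟨ Z.trans (Z.distribʳ p Z.1# (Z.- Q)) (Z.+-congʳ {Z.- Q ⊛ p} (Z.*-identityˡ p)) ⟩
    p ⊕ Z.- Q ⊛ p            ≈⟨ Z.+-cong unroll (Z.sym (-‿distribˡ-* Q p)) ⟩
    Z.1# ⊕ Q ⊛ p ⊕ Z.- (Q ⊛ p) ≈⟨ Z.trans (Z.+-assoc Z.1# (Q ⊛ p) (Z.- (Q ⊛ p))) (Z.trans (Z.+-congˡ {Z.1#} (Z.-‿inverseʳ (Q ⊛ p))) (Z.+-identityʳ Z.1#)) ⟩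
    Z.1# ∎
    where
    open SetoidR Z.setoid
    open RingProps Z.ring using (-‿distribˡ-*)
    Q = z ^ suc k
    p = periodic k 0
    step : p ≋ Z.1# ⊕ z ⊛ periodic k k
    step zero    = sym (trans (+-congˡ (z⊛-0 (periodic k k))) (+-identityʳ _))
    step (suc n) = sym (trans (+-congˡ (z⊛-suc (periodic k k) n)) (+-identityˡ _))
    unroll : p ≋ Z.1# ⊕ Q ⊛ p
    unroll = Z.trans step (Z.+-congˡ {Z.1#} (Z.trans (Z.*-congˡ {z} (periodic-shift k k)) (Z.sym (Z.*-assoc z (z ^ k) p))))

  -- The series 1 / (z;z)_n.
  e : ℕ → ℕ → C
  e zero    = Z.1#
  e (suc n) = e n ⊛ periodic n 0

  qfactorial-inverse : (f : ℕ → ℕ → C) → f 0 ≋ Z.1# → (∀ n → f (suc n) ≋ f n ⊛ (Z.1# Z.+ Z.- (z ^ suc n))) →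
    ∀ n → f n ⊛ e n ≋ Z.1#
  qfactorial-inverse f f-0 f-suc zero    = Z.trans (Z.*-congʳ {Z.1#} f-0) (Z.*-identityˡ Z.1#)
  qfactorial-inverse f f-0 f-suc (suc n) = begin
    f (suc n) ⊛ (e n ⊛ p)       ≈⟨ Z.*-congʳ {e n ⊛ p} (f-suc n) ⟩
    f n ⊛ d ⊛ (e n ⊛ p)         ≈⟨ interchange (f n) d (e n) p ⟩
    f n ⊛ e n ⊛ (d ⊛ p)         ≈⟨ Z.*-cong (qfactorial-inverse f f-0 f-suc n) (periodic-inverse n) ⟩
    Z.1# ⊛ Z.1#                 ≈⟨ Z.*-identityˡ Z.1# ⟩
    Z.1# ∎
    where
    open SetoidR Z.setoid
    open import Algebra.Properties.CommutativeSemigroup Z.*-commutativeSemigroup using (interchange)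
    d = Z.1# Z.+ Z.- (z ^ suc n)
    p = periodic n 0

-- Polynomials as elements of ℤ[[t]][[r]][[q]]

R₀ R₁ R₂ R₃ : CommutativeRing 0ℓ 0ℓ
R₀ = ℤₚ.+-*-commutativeRing
R₁ = Series.ring⟦z⟧ R₀
R₂ = Series.ring⟦z⟧ R₁
R₃ = Series.ring⟦z⟧ R₂

module V₁ = Variable R₀
module V₂ = Variable R₁
module V₃ = Variable R₂
module R₁ = CommutativeRing R₁
module R₂ = CommutativeRing R₂
module R₃ = CommutativeRing R₃

-- The outermost variable is q, in which the congruences are taken; coefficients are therefore read
-- in the order k, j, i.
mono : ℤ → ℕ → ℕ → ℕ → R₃.Carrier
mono a i j k = V₃.at k (V₂.at j (V₁.at i a))

mono-* : ∀ a b i i′ j j′ k k′ →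
  mono (a ℤ.* b) (i ℕ.+ i′) (j ℕ.+ j′) (k ℕ.+ k′) R₃.≈ (mono a i j k R₃.* mono b i′ j′ k′)
mono-* a b i i′ j j′ k k′ = R₃.trans
  (V₃.at-cong (k ℕ.+ k′) (R₂.trans (V₂.at-cong (j ℕ.+ j′) (V₁.at-⊛ i i′ a b)) (V₂.at-⊛ j j′ (V₁.at i a) (V₁.at i′ b))))
  (V₃.at-⊛ k k′ (V₂.at j (V₁.at i a)) (V₂.at j′ (V₁.at i′ b)))

t r q : R₃.Carrier
t = Series.const R₂ (Series.const R₁ (Series.z R₀))
r = Series.const R₂ (Series.z R₁)
q = Series.z R₂

open Exp R₁.semiring using () renaming (_^_ to _^₁_)
open Exp R₂.semiring using () renaming (_^_ to _^₂_)
open Exp R₃.semiring using () renaming (_^_ to _^₃_)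

mono-1 : ∀ i j k → mono (+ 1) i j k R₃.≈ ((t ^₃ i) R₃.* ((r ^₃ j) R₃.* (q ^₃ k)))
mono-1 i j k = R₃.trans (V₃.at-cong k inner) (R₃.trans (V₃.const-at tⁱ k (rʲ R₂.* R₂.1#))
  (R₃.*-cong {V₃.at 0 tⁱ} {t ^₃ i} t-eq (R₃.trans (V₃.const-at rʲ k R₂.1#) (R₃.*-cong {V₃.at 0 rʲ} {r ^₃ j} r-eq (V₃.z^-at k)))))
  where
  tⁱ rʲ : R₂.Carrier
  tⁱ = Series.const R₁ (Series.z R₀) ^₂ i
  rʲ = Series.z R₁ ^₂ j
  t-eq : V₃.at 0 tⁱ R₃.≈ (t ^₃ i)
  t-eq = V₃.const-^ (Series.const R₁ (Series.z R₀)) i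
  r-eq : V₃.at 0 rʲ R₃.≈ (r ^₃ j)
  r-eq = V₃.const-^ (Series.z R₁) j
  inner : V₂.at j (V₁.at i (+ 1)) R₂.≈ (tⁱ R₂.* (rʲ R₂.* R₂.1#))
  inner = R₂.trans (V₂.at-cong j (R₁.trans (V₁.z^-at i) (R₁.sym (R₁.*-identityʳ (Series.z R₀ ^₁ i)))))
    (R₂.trans (V₂.const-at (Series.z R₀ ^₁ i) j R₁.1#) (R₂.*-cong {V₂.at 0 (Series.z R₀ ^₁ i)} {tⁱ} (V₂.const-^ (Series.z R₀) i)
      (R₂.trans (V₂.z^-at j) (R₂.sym (R₂.*-identityʳ rʲ)))))

monomials : Monomials R₃
monomials = record { t = t ; r = r ; q = q ; mono = mono ; mono-* = mono-* ; mono-1 = mono-1 }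

open Semantics R₃ monomials

isEq-false : ∀ k k′ → k ≢ k′ → (∣ + k ℤ.- + k′ ∣ ≡ᵇ 0) ≡ false
isEq-false k k′ k≢ = ≡ᵇ-false (λ eq → k≢ (ℤₚ.+-injective (ℤₚ.i-j≡0⇒i≡j (+ k) (+ k′) (ℤₚ.∣i∣≡0⇒i≡0 eq))))

+-at : ∀ (f g : R₃.Carrier) k j i → (f R₃.+ g) k j i ≡ f k j i ℤ.+ g k j i
+-at f g k j i = ≡.refl

⟦∷⟧ : ∀ m P k j i → ⟦ m ∷ P ⟧ k j i ≡ ⟦ m ⟧ₘ k j i ℤ.+ ⟦ P ⟧ k j i
⟦∷⟧ m P k j i = ≡.trans (⟦⟧-∷ m P k j i) (+-at ⟦ m ⟧ₘ ⟦ P ⟧ k j i)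

coeff-∷ : ∀ a i′ j′ k′ P i j k → coeff ((a , i′ , j′ , k′) ∷ P) i j k
  ≡ (if (i ≡ᵇ i′) ∧ (j ≡ᵇ j′) ∧ (∣ k ℤ.- k′ ∣ ≡ᵇ 0) then a else + 0) ℤ.+ coeff P i j k
coeff-∷ a i′ j′ k′ P i j k = ≡.refl

coeff-⟦⟧ : ∀ {P} → NonNeg P → ∀ i j k → coeff P i j (+ k) ≡ ⟦ P ⟧ k j i
coeff-⟦⟧ [] i j k = ≡.refl
coeff-⟦⟧ {(a , i′ , j′ , + k′) ∷ P} (_ ∷ ps) i j k = ≡.trans (coeff-∷ a i′ j′ (+ k′) P i j (+ k))
  (≡.trans (≡.cong₂ ℤ._+_ head (coeff-⟦⟧ ps i j k)) (≡.sym (⟦∷⟧ (a , i′ , j′ , + k′) P k j i)))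
  where
  head : (if (i ≡ᵇ i′) ∧ (j ≡ᵇ j′) ∧ (∣ + k ℤ.- + k′ ∣ ≡ᵇ 0) then a else + 0) ≡ mono a i′ j′ k′ k j i
  head with k ℕ.≟ k′
  ... | no k≢ rewrite isEq-false k k′ k≢ | Boolₚ.∧-zeroʳ (j ≡ᵇ j′) | Boolₚ.∧-zeroʳ (i ≡ᵇ i′) =
    ≡.sym (≡.cong (λ f → f j i) (V₃.at-other k′ k _ k≢))
  ... | yes ≡.refl rewrite ℤₚ.+-inverseʳ (+ k) | V₃.at-same k (V₂.at j′ (V₁.at i′ a)) with j ℕ.≟ j′
  ...   | no j≢ rewrite ≡ᵇ-false j≢ | Boolₚ.∧-zeroʳ (i ≡ᵇ i′) = ≡.sym (≡.cong (λ f → f i) (V₂.at-other j′ j _ j≢))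
  ...   | yes ≡.refl rewrite ≡ᵇ-refl j | V₂.at-same j (V₁.at i′ a) with i ℕ.≟ i′
  ...     | no i≢ rewrite ≡ᵇ-false i≢ = ≡.sym (V₁.at-other i′ i a i≢)
  ...     | yes ≡.refl rewrite ≡ᵇ-refl i = ≡.sym (V₁.at-same i a)

coeff-negative : ∀ {P} → NonNeg P → ∀ i j k → coeff P i j -[1+ k ] ≡ + 0
coeff-negative [] i j k = ≡.refl
coeff-negative {(a , i′ , j′ , + k′) ∷ P} (_ ∷ ps) i j k = ≡.trans (≡.cong₂ ℤ._+_ head (coeff-negative ps i j k)) ≡.refl
  where
  impossible : -[1+ k ] ≢ + k′
  impossible ()
  head : (if (i ≡ᵇ i′) ∧ (j ≡ᵇ j′) ∧ (∣ -[1+ k ] ℤ.- + k′ ∣ ≡ᵇ 0) then a else + 0) ≡ + 0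
  head rewrite ≡ᵇ-false {∣ -[1+ k ] ℤ.- + k′ ∣} {0} (λ eq → impossible (ℤₚ.i-j≡0⇒i≡j -[1+ k ] (+ k′) (ℤₚ.∣i∣≡0⇒i≡0 eq)))
    | Boolₚ.∧-zeroʳ (j ≡ᵇ j′) | Boolₚ.∧-zeroʳ (i ≡ᵇ i′) = ≡.refl

≈P-from-⟦⟧ : ∀ {P Q} → NonNeg P → NonNeg Q → ⟦ P ⟧ R₃.≈ ⟦ Q ⟧ → P ≈P Q
≈P-from-⟦⟧ ps qs h i j (+ k)    = ≡.trans (coeff-⟦⟧ ps i j k) (≡.trans (h k j i) (≡.sym (coeff-⟦⟧ qs i j k)))
≈P-from-⟦⟧ ps qs h i j -[1+ k ] = ≡.trans (coeff-negative ps i j k) (≡.sym (coeff-negative qs i j k))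

theorem4p18 : (l : ℕ) → 1 ≤ l → (n : ℕ) →
    A l (suc n) ≈P
    (rP +P tP *P tBracket (l ∸ 1) *P qPow (+ n)) *P A l n
    +P tP *P tBracket l *P
    sumP (map (λ k → qbinom n k *P qPow (+ k) *P A l k *P A2 l (n ∸ k)) (upTo n))
theorem4p18 (suc l′) _ n = ≈P-from-⟦⟧ (NonNeg-A (suc n)) (NonNeg-right-hand-side n)
  -- The passage to infinitely many blocks uses two properties of ℤ[[t]][[r]][[q]]: (q;q)_n is
  -- invertible, and elements congruent modulo all powers of q are equal.
  (semantic-recurrence V₃.e (V₃.qfactorial-inverse qfactorial (λ _ → R₂.refl) (λ _ _ → R₂.refl)) V₃.z-separated n)
  where
  open WithColors l′
  open Recurrence R₃ l′ T (t ^₃_) r q V₃.e using (qfactorial)
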